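{- Let $\mathcal{A}$ be a finite list in a finitely generated abelian group $\Gamma$ and let $G$ be a torsion-wise finite divisible abelian group. Then all coefficients of the $G$-Tutte polynomial $T^G_{\mathcal{A}}(x,y)$ are non-negative integers.
   Context: $G$ is torsion-wise finite if $G[d]=\{x\in G\mid dx=0\}$ is finite for all $d>0$, and divisible if multiplication by $k$ is surjective on $G$ for every positive integer $k$. For a sublist $\mathcal{S}$ (distinguished by index) $r_{\mathcal{S}}$ is the rank of $\langle\mathcal{S}\rangle$, $m(\mathcal{S};G)=\#\mathrm{Hom}((\Gamma/\langle\mathcal{S}\rangle)_{\mathrm{tor}},G)$, and $T^G_{\mathcal{A}}(x,y)=\sum_{\mathcal{S}\subset\mathcal{A}}m(\mathcal{S};G)(x-1)^{r_{\mathcal{A}}-r_{\mathcal{S}}}(y-1)^{\#\mathcal{S}-r_{\mathcal{S}}}$. -}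

module Defs where

open import Level using (Level; _⊔_)
open import Algebra.Bundles using (AbelianGroup; RawGroup)
open import Algebra.Morphism.Bundles using (GroupHomomorphism)
open import Algebra.Morphism.Structures using (IsGroupMonomorphism)
import Algebra.Definitions.RawMonoid as RawMonoidDefinitions
import Algebra.Morphism.GroupMonomorphism as GroupMonomorphism
import Algebra.Properties.AbelianGroup as AbelianGroupProperties
import Algebra.Properties.CommutativeMonoid.Mult as CommutativeMonoidMult
open import Data.Bool.Base using (if_then_else_; _∧_)
open import Data.Fin.Base using (Fin)
open import Data.Fin.Subset as Subset using (Subset; inside; outside)
open import Data.Integer.Base as ℤ using (ℤ; +_; -[1+_]; 0ℤ; 1ℤ; -1ℤ)
open import Data.List.Base
  using (List; []; _∷_; _++_; map; concatMap; cartesianProductWith; foldr; length; lookup)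
open import Data.List.Membership.Propositional as List using ()
open import Data.Nat.Base as ℕ using (ℕ; zero; suc; _∸_; _≡ᵇ_)
import Data.Nat.Properties as ℕ
open import Data.Product.Base using (Σ; ∃; _,_; proj₁; proj₂) renaming (_×_ to _and_)
open import Data.Vec.Base using ([]; _∷_)
open import Function.Bundles using (Bijection)
open import Relation.Binary.Bundles using (Setoid)
import Relation.Binary.Construct.On as On
open import Relation.Binary.PropositionalEquality as ≡ using (_≡_)

HasCardinality : ∀ {a ℓ} → Setoid a ℓ → ℕ → Set (a ⊔ ℓ)
HasCardinality S n = Bijection (≡.setoid (Fin n)) S

-- Abelian groups are the library's, hence written multiplicatively;
-- n × x is the n-th multiple of x.

module _ {c ℓ : Level} (Γ : AbelianGroup c ℓ) where

  open AbelianGroup Γ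
  open AbelianGroupProperties Γ using (ε⁻¹≈ε; ⁻¹-anti-homo‿-; ⁻¹-∙-comm)
  open CommutativeMonoidMult commutativeMonoid
    using (×-congʳ; ×-congˡ; ×-assocˡ; ×-distrib-+)
  open RawMonoidDefinitions rawMonoid using (_×_; sum)
  open import Relation.Binary.Reasoning.Setoid setoid

  record IsSubgroup {p} (P : Carrier → Set p) : Set (c ⊔ p) where
    field
      ε-closed  : P ε
      ∙-closed  : ∀ {x y} → P x → P y → P (x ∙ y)
      ⁻¹-closed : ∀ {x} → P x → P (x ⁻¹)

  module _ {p} {P : Carrier → Set p} (isSubgroup : IsSubgroup P) where

    open IsSubgroup isSubgroup

    subgroupRawGroup : RawGroup (c ⊔ p) ℓ
    subgroupRawGroup = record
      { Carrier = Σ Carrier P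
      ; _≈_     = λ x y → proj₁ x ≈ proj₁ y
      ; _∙_     = λ x y → proj₁ x ∙ proj₁ y , ∙-closed (proj₂ x) (proj₂ y)
      ; ε       = ε , ε-closed
      ; _⁻¹     = λ x → proj₁ x ⁻¹ , ⁻¹-closed (proj₂ x)
      }

    proj₁-isGroupMonomorphism : IsGroupMonomorphism subgroupRawGroup rawGroup proj₁
    proj₁-isGroupMonomorphism = record
      { isGroupHomomorphism = record
        { isMonoidHomomorphism = record
          { isMagmaHomomorphism = record
            { isRelHomomorphism = record { cong = λ eq → eq }
            ; homo = λ _ _ → refl
            }
          ; ε-homo = refl
          }
        ; ⁻¹-homo = λ _ → refl
        }
      ; injective = λ eq → eq
      }

    subgroup : AbelianGroup (c ⊔ p) ℓ
    subgroup = record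
      { RawGroup subgroupRawGroup
      ; isAbelianGroup = GroupMonomorphism.isAbelianGroup proj₁-isGroupMonomorphism isAbelianGroup
      }

  data Generated {p} (P : Carrier → Set p) : Carrier → Set (c ⊔ ℓ ⊔ p) where
    gen  : ∀ {x} → P x → Generated P x
    unit : Generated P ε
    mult : ∀ {x y} → Generated P x → Generated P y → Generated P (x ∙ y)
    inv  : ∀ {x} → Generated P x → Generated P (x ⁻¹)
    resp : ∀ {x y} → x ≈ y → Generated P x → Generated P y

  generated-isSubgroup : ∀ {p} (P : Carrier → Set p) → IsSubgroup (Generated P)
  generated-isSubgroup P = record { ε-closed = unit ; ∙-closed = mult ; ⁻¹-closed = inv }

  FinitelyGenerated : Set (c ⊔ ℓ)
  FinitelyGenerated = ∃ λ (L : List Carrier) → ∀ x → Generated (List._∈ L) x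

  generatedSubgroup : ∀ {p} (P : Carrier → Set p) → AbelianGroup (c ⊔ ℓ ⊔ p) ℓ
  generatedSubgroup P = subgroup (generated-isSubgroup P)

  quotient : ∀ {p} (P : Carrier → Set p) → AbelianGroup c (c ⊔ ℓ ⊔ p)
  quotient P = record
    { Carrier = Carrier
    ; _≈_     = _~_
    ; _∙_     = _∙_
    ; ε       = ε
    ; _⁻¹     = _⁻¹
    ; isAbelianGroup = record
      { isGroup = record
        { isMonoid = record
          { isSemigroup = record
            { isMagma = record
              { isEquivalence = record
                { refl  = ≈⇒~ refl
                ; sym   = λ {x} {y} x~y → resp (⁻¹-anti-homo‿- x y) (inv x~y)
                ; trans = λ {x} {y} {z} x~y y~z → resp (telescope x y z) (mult x~y y~z)
                }
              ; ∙-cong = λ {x} {y} {u} {v} x~y u~v → resp (interchange x y u v) (mult x~y u~v)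
              }
            ; assoc = λ x y z → ≈⇒~ (assoc x y z)
            }
          ; identity = (λ x → ≈⇒~ (identityˡ x)) , (λ x → ≈⇒~ (identityʳ x))
          }
        ; inverse = (λ x → ≈⇒~ (inverseˡ x)) , (λ x → ≈⇒~ (inverseʳ x))
        ; ⁻¹-cong = λ {x} {y} x~y → resp (sym (⁻¹-∙-comm x (y ⁻¹))) (inv x~y)
        }
      ; comm = λ x y → ≈⇒~ (comm x y)
      }
    }
    where
    _~_ : Carrier → Carrier → Set _
    x ~ y = Generated P (x - y)

    ≈⇒~ : ∀ {x y} → x ≈ y → x ~ y
    ≈⇒~ {x} {y} x≈y = resp (sym (trans (∙-congʳ x≈y) (inverseʳ y))) unit

    telescope : ∀ x y z → (x - y) ∙ (y - z) ≈ x - z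
    telescope x y z = begin
      (x ∙ y ⁻¹) ∙ (y ∙ z ⁻¹)  ≈⟨ assoc x (y ⁻¹) _ ⟩
      x ∙ (y ⁻¹ ∙ (y ∙ z ⁻¹))  ≈⟨ ∙-congˡ (assoc (y ⁻¹) y _) ⟨
      x ∙ ((y ⁻¹ ∙ y) ∙ z ⁻¹)  ≈⟨ ∙-congˡ (∙-congʳ (inverseˡ y)) ⟩
      x ∙ (ε ∙ z ⁻¹)           ≈⟨ ∙-congˡ (identityˡ _) ⟩
      x ∙ z ⁻¹                 ∎

    interchange : ∀ x y u v → (x - y) ∙ (u - v) ≈ (x ∙ u) - (y ∙ v)
    interchange x y u v = begin
      (x ∙ y ⁻¹) ∙ (u ∙ v ⁻¹)  ≈⟨ assoc x (y ⁻¹) _ ⟩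
      x ∙ (y ⁻¹ ∙ (u ∙ v ⁻¹))  ≈⟨ ∙-congˡ (assoc (y ⁻¹) u _) ⟨
      x ∙ ((y ⁻¹ ∙ u) ∙ v ⁻¹)  ≈⟨ ∙-congˡ (∙-congʳ (comm (y ⁻¹) u)) ⟩
      x ∙ ((u ∙ y ⁻¹) ∙ v ⁻¹)  ≈⟨ ∙-congˡ (assoc u (y ⁻¹) _) ⟩
      x ∙ (u ∙ (y ⁻¹ ∙ v ⁻¹))  ≈⟨ assoc x u _ ⟨
      (x ∙ u) ∙ (y ⁻¹ ∙ v ⁻¹)  ≈⟨ ∙-congˡ (⁻¹-∙-comm y v) ⟩
      (x ∙ u) ∙ (y ∙ v) ⁻¹     ∎

  IsTorsion : Carrier → Set ℓ
  IsTorsion x = ∃ λ d → 0 ℕ.< d and d × x ≈ ε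

  torsion-isSubgroup : IsSubgroup IsTorsion
  torsion-isSubgroup = record
    { ε-closed  = 1 , ℕ.z<s , identityʳ ε
    ; ∙-closed  = λ { {x} {y} (d , d>0 , dx≈ε) (e , e>0 , ey≈ε) →
        d ℕ.* e , ℕ.*-mono-< d>0 e>0 , (begin
          (d ℕ.* e) × (x ∙ y)              ≈⟨ ×-distrib-+ x y (d ℕ.* e) ⟩
          (d ℕ.* e) × x ∙ (d ℕ.* e) × y    ≈⟨ ∙-congʳ (×-congˡ (ℕ.*-comm d e)) ⟩
          (e ℕ.* d) × x ∙ (d ℕ.* e) × y    ≈⟨ ∙-cong (multiple e d dx≈ε) (multiple d e ey≈ε) ⟩
          ε ∙ ε                            ≈⟨ identityʳ ε ⟩
          ε                                ∎) }
    ; ⁻¹-closed = λ { {x} (d , d>0 , dx≈ε) → d , d>0 , (begin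
        d × (x ⁻¹)            ≈⟨ identityʳ _ ⟨
        d × (x ⁻¹) ∙ ε        ≈⟨ ∙-congˡ dx≈ε ⟨
        d × (x ⁻¹) ∙ d × x    ≈⟨ ×-distrib-+ (x ⁻¹) x d ⟨
        d × (x ⁻¹ ∙ x)        ≈⟨ ×-congʳ d (inverseˡ x) ⟩
        d × ε                 ≈⟨ ×-zeroʳ d ⟩
        ε                     ∎) }
    }
    where
    ×-zeroʳ : ∀ n → n × ε ≈ ε
    ×-zeroʳ zero    = refl
    ×-zeroʳ (suc n) = trans (identityˡ _) (×-zeroʳ n)

    multiple : ∀ m n {x} → n × x ≈ ε → (m ℕ.* n) × x ≈ ε
    multiple m n {x} nx≈ε = begin
      (m ℕ.* n) × x  ≈⟨ ×-assocˡ x m n ⟨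
      m × (n × x)    ≈⟨ ×-congʳ m nx≈ε ⟩
      m × ε          ≈⟨ ×-zeroʳ m ⟩
      ε              ∎

  torsionSubgroup : AbelianGroup (c ⊔ ℓ) ℓ
  torsionSubgroup = subgroup torsion-isSubgroup

  -- G[d]
  _-torsion : ℕ → Setoid (c ⊔ ℓ) ℓ
  d -torsion = On.setoid {B = ∃ λ x → d × x ≈ ε} setoid proj₁

  TorsionWiseFinite : Set (c ⊔ ℓ)
  TorsionWiseFinite = ∀ d → 0 ℕ.< d → ∃ λ n → HasCardinality (d -torsion) n

  Divisible : Set (c ⊔ ℓ)
  Divisible = ∀ k → 0 ℕ.< k → ∀ y → ∃ λ x → k × x ≈ y

  _·_ : ℤ → Carrier → Carrier
  (+ n)    · x = n × x
  -[1+ n ] · x = (suc n × x) ⁻¹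

  LinearlyIndependent : ∀ {n} → (Fin n → Carrier) → Set ℓ
  LinearlyIndependent v =
    ∀ (k : Fin _ → ℤ) → sum (λ i → k i · v i) ≈ ε → ∀ i → k i ≡ 0ℤ

  -- The rank is the largest number of ℤ-linearly independent elements.
  HasRank : ℕ → Set (c ⊔ ℓ)
  HasRank r = (∃ λ (v : Fin r → Carrier) → LinearlyIndependent v)
          and (∀ s (v : Fin s → Carrier) → LinearlyIndependent v → s ℕ.≤ r)

Hom : ∀ {a ℓa b ℓb} → AbelianGroup a ℓa → AbelianGroup b ℓb → Setoid (a ⊔ ℓa ⊔ b ⊔ ℓb) (a ⊔ ℓb)
Hom F G = record
  { Carrier = GroupHomomorphism F.rawGroup G.rawGroup
  ; _≈_     = λ φ ψ → ∀ x → ⟦ φ ⟧ x G.≈ ⟦ ψ ⟧ x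
  ; isEquivalence = record
    { refl  = λ _ → G.refl
    ; sym   = λ φ≈ψ x → G.sym (φ≈ψ x)
    ; trans = λ φ≈ψ ψ≈χ x → G.trans (φ≈ψ x) (ψ≈χ x)
    }
  }
  where
  module F = AbelianGroup F
  module G = AbelianGroup G
  open GroupHomomorphism using (⟦_⟧)

-- A sublist of 𝒜 is a set of positions in 𝒜, so repeated entries are kept apart.
module _ {c ℓ : Level} (Γ : AbelianGroup c ℓ) (𝒜 : List (AbelianGroup.Carrier Γ)) where

  Entry : Subset (length 𝒜) → AbelianGroup.Carrier Γ → Set c
  Entry S x = ∃ λ i → i Subset.∈ S and x ≡ lookup 𝒜 i

  -- r is the function S ↦ r_S
  IsRankFunction : (Subset (length 𝒜) → ℕ) → Set (c ⊔ ℓ)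
  IsRankFunction r = ∀ S → HasRank (generatedSubgroup Γ (Entry S)) (r S)

  -- m is the function S ↦ m(S;G) = #Hom((Γ/⟨S⟩)_tor, G)
  IsMultiplicityFunction : ∀ {g ℓg} → AbelianGroup g ℓg →
                           (Subset (length 𝒜) → ℕ) → Set (c ⊔ ℓ ⊔ g ⊔ ℓg)
  IsMultiplicityFunction G m =
    ∀ S → HasCardinality (Hom (torsionSubgroup (quotient Γ (Entry S))) G) (m S)

-- A polynomial in ℤ[x,y] is a finite formal sum of terms a xⁱ yʲ, stored as
-- (a , i , j).  Terms with equal exponents need not be collected, so polynomials
-- are to be compared through their coefficients.
Polynomial : Set
Polynomial = List (ℤ and ℕ and ℕ)

constant : ℤ → Polynomial
constant a = (a , 0 , 0) ∷ []

X-1 Y-1 : Polynomial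
X-1 = (1ℤ , 1 , 0) ∷ (-1ℤ , 0 , 0) ∷ []
Y-1 = (1ℤ , 0 , 1) ∷ (-1ℤ , 0 , 0) ∷ []

infixl 7 _⊗_
infixr 8 _⊗^_

_⊗_ : Polynomial → Polynomial → Polynomial
_⊗_ = cartesianProductWith λ (a , i , j) (b , k , l) → a ℤ.* b , i ℕ.+ k , j ℕ.+ l

_⊗^_ : Polynomial → ℕ → Polynomial
p ⊗^ zero  = constant 1ℤ
p ⊗^ suc n = p ⊗ p ⊗^ n

coefficient : Polynomial → ℕ → ℕ → ℤ
coefficient p i j =
  foldr (λ (a , k , l) s → (if (k ≡ᵇ i) ∧ (l ≡ᵇ j) then a else 0ℤ) ℤ.+ s) 0ℤ p

allSubsets : ∀ n → List (Subset n)
allSubsets zero    = [] ∷ []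
allSubsets (suc n) = map (inside ∷_) (allSubsets n) ++ map (outside ∷_) (allSubsets n)

-- Since r_S ≤ r_𝒜 and r_S ≤ #S, the truncated subtractions in the exponents are exact
-- when r is a rank function.
tuttePolynomial : ∀ {n} → (r m : Subset n → ℕ) → Polynomial
tuttePolynomial {n} r m = concatMap term (allSubsets n)
  where
  term : Subset n → Polynomial
  term S = constant (+ m S) ⊗ X-1 ⊗^ (r Subset.⊤ ∸ r S) ⊗ Y-1 ⊗^ (Subset.∣ S ∣ ∸ r S)

module Submission where

-- Everything that has to be decided about the groups is finite and the conclusion is stable
-- under double negation, so classical reasoning is available where it is needed.
--
-- Deletion and contraction of elements that are neither loops nor coloops write the polynomial
-- as a sum over triples of disjoint sets R, F, T with R ∪ F independent and T torsion over R,
-- the contribution being ∑ m(R ∪ X ∪ Y) (x - 1)^#(F ∖ X) (y - 1)^#Y over X ⊆ F and Y ⊆ T.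
-- Let K = Hom((Γ/⟨R ∪ F⟩)_tor, G).  As G is divisible, characters extend, so that
-- m(R ∪ X ∪ Y) = #{φ ∈ K : φ(Y) = 0} / #K_X, where K_X is the group of the φ ∈ K vanishing on the
-- saturation of R ∪ X, and K_X is the sum of the K_{F ∖ f} with f ∈ F ∖ X.  The numerators give
-- ∑_φ y^#{t ∈ T : φ(t) = 0}.  The denominators 1/#K_X are the values at 0 of products, over f ∈ F ∖ X,
-- of the averages e_f over K_{F ∖ f}, and the product over F of 1 + (x - 1) e_f = (1 - e_f) + x e_f
-- has coefficients which are products of commuting orthogonal projections; these have
-- non-negative diagonal entries.

open import Defs
open import Level using (Level; _⊔_; Lift; lift; lower)
open import Algebra.Bundles using (AbelianGroup; RawGroup)
import Algebra.Construct.Pointwise as Pointwise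
open import Algebra.Core using (Op₁; Op₂)
import Algebra.Definitions.RawMonoid as RawMonoidDefinitions
open import Algebra.Morphism.Bundles using (GroupHomomorphism)
import Algebra.Morphism.GroupMonomorphism as GroupMonomorphism
open import Algebra.Morphism.Structures using (IsGroupMonomorphism)
import Algebra.Properties.AbelianGroup as AbelianGroupProperties
import Algebra.Properties.CommutativeMonoid.Mult as CommutativeMonoidMult
import Algebra.Properties.CommutativeMonoid.Sum as CommutativeMonoidSum
import Algebra.Properties.CommutativeSemigroup as CommutativeSemigroupProperties
open import Algebra.Structures using (IsAbelianGroup)
open import Data.Bool.Base using (Bool; true; false; if_then_else_; _∧_)
open import Data.Bool.Properties using (∧-zeroʳ)
open import Data.Empty using (⊥-elim)
open import Data.Fin.Base using (Fin; zero; suc; punchIn)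
import Data.Fin.Permutation as Permutation
import Data.Fin.Properties as Fin
open import Data.Fin.Subset as Subset
  using (Subset; inside; outside; _∈_; _∉_; _⊆_; _∩_; ∣_∣; ∁)
import Data.Fin.Subset.Properties as Subset
open import Data.Integer.Base as ℤ using (ℤ; 0ℤ; 1ℤ; -1ℤ; _≤_)
import Data.Integer.DivMod as ℤ
import Data.Integer.Properties as ℤ
open import Data.Integer.Tactic.RingSolver using (solve-∀)
open import Data.List.Base as List using (List; []; _∷_; _++_; map; concatMap; allFin; length)
open import Data.List.Membership.Propositional as List using ()
open import Data.List.Membership.Propositional.Properties using (∈-allFin)
import Data.List.Properties as List
open import Data.List.Relation.Unary.All as All using (All; []; _∷_)
import Data.List.Relation.Unary.All.Properties as All
open import Data.List.Relation.Unary.Any using (here; there)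
open import Data.Nat.Base as ℕ using (ℕ; zero; suc; _∸_; _≡ᵇ_)
open import Data.Nat.Induction using (<-rec)
import Data.Nat.Properties as ℕ
open import Data.Product.Base using (Σ; ∃; ∃₂; _×_; _,_; proj₁; proj₂)
open import Data.Sum.Base using (_⊎_; inj₁; inj₂; [_,_]′)
open import Data.Unit.Base using (⊤; tt)
open import Data.Vec.Base as Vec using (Vec; []; _∷_; lookup; _[_]≔_; here; there)
import Data.Vec.Functional as Vector
import Data.Vec.Functional.Properties as Vector
import Data.Vec.Properties as Vec
open import Data.Vec.Relation.Binary.Pointwise.Inductive as Pointwise using (Pointwise; []; _∷_)
open import Effect.Monad using (RawMonad)
open import Function.Base using (_∘_; id)
open import Function.Bundles using (Bijection)
open import Relation.Binary.PropositionalEquality as ≡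
  using (_≡_; _≢_; _≗_; cong; cong₂; subst; module ≡-Reasoning)
open import Relation.Nullary using (¬_; Dec; yes; no; does; contradiction; ¬?)
open import Relation.Nullary.Decidable using (decidable-stable; ¬¬-excluded-middle)
open import Relation.Nullary.Negation using (¬¬-Monad)

-- The branching uses the rank alone. Each step only narrows the range of S in one fixed sum over
-- subsets, so `m` is never asked to satisfy a recursion and all the arithmetic sits in the leaves.
-- There the averages e_f would bring in fractions. Everything stays in ℤ because e_f is replaced by
-- #K_{F ∖ f} e_f, a sum over translates, and a leaf is multiplied by the product D of the orders
-- #K_{F ∖ f}. With Q the product of these operators over F ∖ X, times the orders belonging to F ∩
-- X, and δ the indicator of the neutral character, the identity needed is D m(S) = #{φ ∈ K : φ(Y) =
-- 0} ⟨Q δ, δ⟩. The factor D does not depend on S, so it can be cancelled at the end. For the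
-- induction, δ and the constant weight 1 on K become an arbitrary vector v and an arbitrary
-- non-negative weight w: a free element changes only v, a torsion element only w. The groups
-- Hom((Γ/⟨S⟩)_tor, G) for different S have no common domain. They are compared by lifting their
-- elements to characters of all of Γ and testing agreement on saturations.

-- Coefficients of products of powers of x - 1 and y - 1.

module Coefficients where

  open import Relation.Binary.PropositionalEquality using (refl; sym; trans)
  open import Data.Integer.Base using (_+_; _*_; -_; _-_)
  open ≡-Reasoning

  -- powerCoeff a i is the coefficient of xⁱ in (x - 1)ᵃ.
  powerCoeff : ℕ → ℕ → ℤ
  powerCoeff zero    zero    = 1ℤ
  powerCoeff zero    (suc i) = 0ℤ
  powerCoeff (suc a) zero    = - powerCoeff a zero
  powerCoeff (suc a) (suc i) = powerCoeff a i - powerCoeff a (suc i)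

  coefficient-++ : ∀ p q i j →
    coefficient (p ++ q) i j ≡ coefficient p i j + coefficient q i j
  coefficient-++ []              q i j = sym (ℤ.+-identityˡ _)
  coefficient-++ ((a , k , l) ∷ p) q i j =
    trans (cong (u +_) (coefficient-++ p q i j)) (sym (ℤ.+-assoc u (coefficient p i j) _))
    where u = if (k ≡ᵇ i) ∧ (l ≡ᵇ j) then a else 0ℤ

  coefficient-constant-⊗ : ∀ a p i j →
    coefficient (constant a ⊗ p) i j ≡ a * coefficient p i j
  coefficient-constant-⊗ a [] i j = sym (ℤ.*-zeroʳ a)
  coefficient-constant-⊗ a ((b , k , l) ∷ p) i j
    with (k ≡ᵇ i) ∧ (l ≡ᵇ j)
  ... | true  = trans (cong (a * b +_) (coefficient-constant-⊗ a p i j)) (sym (ℤ.*-distribˡ-+ a b _))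
  ... | false = begin
    0ℤ + coefficient (constant a ⊗ p) i j  ≡⟨ cong (0ℤ +_) (coefficient-constant-⊗ a p i j) ⟩
    0ℤ + a * coefficient p i j             ≡⟨ cong (_+ a * coefficient p i j) (ℤ.*-zeroʳ a) ⟨
    a * 0ℤ + a * coefficient p i j         ≡⟨ ℤ.*-distribˡ-+ a 0ℤ _ ⟨
    a * (0ℤ + coefficient p i j)           ∎

  private
    shiftˣ shiftʸ : ℤ → Polynomial → Polynomial
    shiftˣ a = map λ (b , k , l) → a * b , 1 ℕ.+ k , l
    shiftʸ a = map λ (b , k , l) → a * b , k , 1 ℕ.+ l

    shiftˣ-zero : ∀ p j → coefficient (shiftˣ 1ℤ p) 0 j ≡ 0ℤ
    shiftˣ-zero []      j = refl
    shiftˣ-zero (_ ∷ p) j = trans (ℤ.+-identityˡ _) (shiftˣ-zero p j)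

    shiftˣ-suc : ∀ p i j → coefficient (shiftˣ 1ℤ p) (suc i) j ≡ coefficient p i j
    shiftˣ-suc []                i j = refl
    shiftˣ-suc ((b , k , l) ∷ p) i j with (k ≡ᵇ i) ∧ (l ≡ᵇ j)
    ... | true  = cong₂ _+_ (ℤ.*-identityˡ b) (shiftˣ-suc p i j)
    ... | false = cong (0ℤ +_) (shiftˣ-suc p i j)

    shiftʸ-zero : ∀ p i → coefficient (shiftʸ 1ℤ p) i 0 ≡ 0ℤ
    shiftʸ-zero []                i = refl
    shiftʸ-zero ((b , k , l) ∷ p) i rewrite ∧-zeroʳ (k ≡ᵇ i) =
      trans (ℤ.+-identityˡ _) (shiftʸ-zero p i)

    shiftʸ-suc : ∀ p i j → coefficient (shiftʸ 1ℤ p) i (suc j) ≡ coefficient p i j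
    shiftʸ-suc []                i j = refl
    shiftʸ-suc ((b , k , l) ∷ p) i j with (k ≡ᵇ i) ∧ (l ≡ᵇ j)
    ... | true  = cong₂ _+_ (ℤ.*-identityˡ b) (shiftʸ-suc p i j)
    ... | false = cong (0ℤ +_) (shiftʸ-suc p i j)

    0+0-u : ∀ u → 0ℤ + (-1ℤ * u + 0ℤ) ≡ - u
    0+0-u = solve-∀

    u+0-v : ∀ u v → u + (-1ℤ * v + 0ℤ) ≡ u - v
    u+0-v = solve-∀

  coefficient-[X-1]^ : ∀ a i → coefficient (X-1 ⊗^ a) i 0 ≡ powerCoeff a i
  coefficient-[X-1]^ zero    zero    = refl
  coefficient-[X-1]^ zero    (suc i) = refl
  coefficient-[X-1]^ (suc a) i = trans (trans
    (coefficient-++ (shiftˣ 1ℤ q) (constant -1ℤ ⊗ q) i 0)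
    (cong (coefficient (shiftˣ 1ℤ q) i 0 +_)
      (trans (coefficient-constant-⊗ -1ℤ q i 0) (sym (ℤ.+-identityʳ _)))))
    (lemma i)
    where
    q = X-1 ⊗^ a
    lemma : ∀ i → coefficient (shiftˣ 1ℤ q) i 0 + (-1ℤ * coefficient q i 0 + 0ℤ) ≡ powerCoeff (suc a) i
    lemma zero    = trans (cong₂ (λ u v → u + (-1ℤ * v + 0ℤ)) (shiftˣ-zero q 0) (coefficient-[X-1]^ a 0)) (0+0-u _)
    lemma (suc i) = trans (cong₂ (λ u v → u + (-1ℤ * v + 0ℤ))
      (trans (shiftˣ-suc q i 0) (coefficient-[X-1]^ a i)) (coefficient-[X-1]^ a (suc i))) (u+0-v (powerCoeff a i) (powerCoeff a (suc i)))

  coefficient-[Y-1]^ : ∀ b j → coefficient (Y-1 ⊗^ b) 0 j ≡ powerCoeff b j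
  coefficient-[Y-1]^ zero    zero    = refl
  coefficient-[Y-1]^ zero    (suc j) = refl
  coefficient-[Y-1]^ (suc b) j = trans (trans
    (coefficient-++ (shiftʸ 1ℤ q) (constant -1ℤ ⊗ q) 0 j)
    (cong (coefficient (shiftʸ 1ℤ q) 0 j +_)
      (trans (coefficient-constant-⊗ -1ℤ q 0 j) (sym (ℤ.+-identityʳ _)))))
    (lemma j)
    where
    q = Y-1 ⊗^ b
    lemma : ∀ j → coefficient (shiftʸ 1ℤ q) 0 j + (-1ℤ * coefficient q 0 j + 0ℤ) ≡ powerCoeff (suc b) j
    lemma zero    = trans (cong₂ (λ u v → u + (-1ℤ * v + 0ℤ)) (shiftʸ-zero q 0) (coefficient-[Y-1]^ b 0)) (0+0-u _)
    lemma (suc j) = trans (cong₂ (λ u v → u + (-1ℤ * v + 0ℤ))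
      (trans (shiftʸ-suc q 0 j) (coefficient-[Y-1]^ b j)) (coefficient-[Y-1]^ b (suc j))) (u+0-v (powerCoeff b j) (powerCoeff b (suc j)))

  FreeOfX FreeOfY : Polynomial → Set
  FreeOfX = All λ (_ , k , _) → k ≡ 0
  FreeOfY = All λ (_ , _ , l) → l ≡ 0

  private
    ⊗-freeOfX : ∀ {p q} → FreeOfX p → FreeOfX q → FreeOfX (p ⊗ q)
    ⊗-freeOfX []         q-free = []
    ⊗-freeOfX (refl ∷ p) q-free = All.++⁺ (All.map⁺ q-free) (⊗-freeOfX p q-free)

    ⊗-freeOfY : ∀ {p q} → FreeOfY p → FreeOfY q → FreeOfY (p ⊗ q)
    ⊗-freeOfY []         q-free = []
    ⊗-freeOfY (refl ∷ p) q-free = All.++⁺ (All.map⁺ q-free) (⊗-freeOfY p q-free)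

  [X-1]^-freeOfY : ∀ a → FreeOfY (X-1 ⊗^ a)
  [X-1]^-freeOfY zero    = refl ∷ []
  [X-1]^-freeOfY (suc a) = ⊗-freeOfY {p = X-1} (refl ∷ refl ∷ []) ([X-1]^-freeOfY a)

  [Y-1]^-freeOfX : ∀ b → FreeOfX (Y-1 ⊗^ b)
  [Y-1]^-freeOfX zero    = refl ∷ []
  [Y-1]^-freeOfX (suc b) = ⊗-freeOfX {p = Y-1} (refl ∷ refl ∷ []) ([Y-1]^-freeOfX b)

  -- With the variables separated, xⁱ can only come from the first factor and yʲ only from the
  -- second, so no convolution sum appears.
  coefficient-⊗ : ∀ {p q} → FreeOfY p → FreeOfX q → ∀ i j →
    coefficient (p ⊗ q) i j ≡ coefficient p i 0 * coefficient q 0 j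
  coefficient-⊗ [] Fq i j = refl
  coefficient-⊗ {(a , k , .0) ∷ p} {q} (refl ∷ Fp) Fq i j = begin
    coefficient (map _ q ++ p ⊗ q) i j
      ≡⟨ coefficient-++ (map _ q) (p ⊗ q) i j ⟩
    coefficient (map _ q) i j + coefficient (p ⊗ q) i j
      ≡⟨ cong₂ _+_ (monomial Fq) (coefficient-⊗ Fp Fq i j) ⟩
    (if (k ≡ᵇ i) ∧ true then a else 0ℤ) * coefficient q 0 j + coefficient p i 0 * coefficient q 0 j
      ≡⟨ ℤ.*-distribʳ-+ (coefficient q 0 j) (if (k ≡ᵇ i) ∧ true then a else 0ℤ) (coefficient p i 0) ⟨
    ((if (k ≡ᵇ i) ∧ true then a else 0ℤ) + coefficient p i 0) * coefficient q 0 j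
      ∎
    where
    monomial : ∀ {q} → FreeOfX q →
      coefficient (map (λ (b , k′ , l) → a * b , k ℕ.+ k′ , l) q) i j
        ≡ (if (k ≡ᵇ i) ∧ true then a else 0ℤ) * coefficient q 0 j
    monomial [] = sym (ℤ.*-zeroʳ (if (k ≡ᵇ i) ∧ true then a else 0ℤ))
    monomial {(b , .0 , l) ∷ q} (refl ∷ Fq) rewrite ℕ.+-identityʳ k | monomial Fq
      with k ≡ᵇ i | l ≡ᵇ j
    ... | true  | true  = sym (ℤ.*-distribˡ-+ a b _)
    ... | true  | false = trans (ℤ.+-identityˡ _) (cong (a *_) (sym (ℤ.+-identityˡ _)))
    ... | false | _     = refl

  coefficient-term : ∀ n a b i j →
    coefficient (constant n ⊗ X-1 ⊗^ a ⊗ Y-1 ⊗^ b) i j ≡ n * powerCoeff a i * powerCoeff b j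
  coefficient-term n a b i j = begin
    coefficient (constant n ⊗ X-1 ⊗^ a ⊗ Y-1 ⊗^ b) i j
      ≡⟨ coefficient-⊗ (⊗-freeOfY {p = constant n} (refl ∷ []) ([X-1]^-freeOfY a)) ([Y-1]^-freeOfX b) i j ⟩
    coefficient (constant n ⊗ X-1 ⊗^ a) i 0 * coefficient (Y-1 ⊗^ b) 0 j
      ≡⟨ cong₂ _*_ (trans (coefficient-constant-⊗ n (X-1 ⊗^ a) i 0) (cong (n *_) (coefficient-[X-1]^ a i)))
                   (coefficient-[Y-1]^ b j) ⟩
    n * powerCoeff a i * powerCoeff b j
      ∎

-- Sums over subsets constrained by the status of each position.

module Statuses where

  open import Relation.Binary.PropositionalEquality using (refl; sym; trans)
  open import Data.Integer.Base using (_+_; _*_)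
  open Coefficients

  -- Undecided elements are eventually contracted, deleted, or set aside: as torsion if they are
  -- loops of the current minor and as free if they are coloops.
  data Status : Set where
    undecided contracted deleted free torsion : Status

  -- Contracted positions are forced into the subset and deleted ones out of it. The other three
  -- statuses are summed alike, so that setting an undecided position aside as free or torsion does
  -- not change the value.
  ∑[_] : ∀ {n} → Vec Status n → (Subset n → ℤ) → ℤ
  ∑[ [] ]             f = f []
  ∑[ contracted ∷ σ ] f = ∑[ σ ] (f ∘ (inside ∷_))
  ∑[ deleted    ∷ σ ] f = ∑[ σ ] (f ∘ (outside ∷_))
  ∑[ _          ∷ σ ] f = ∑[ σ ] (f ∘ (inside ∷_)) + ∑[ σ ] (f ∘ (outside ∷_))

  coefficient-concatMap : ∀ {n} (p : Subset n → Polynomial) i j →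
    coefficient (concatMap p (allSubsets n)) i j ≡ ∑[ Vec.replicate n undecided ] (λ S → coefficient (p S) i j)
  coefficient-concatMap {zero}  p i j = cong (λ q → coefficient q i j) (List.++-identityʳ (p []))
  coefficient-concatMap {suc n} p i j = begin
    coefficient (concatMap p (map (inside ∷_) A ++ map (outside ∷_) A)) i j
      ≡⟨ cong (λ q → coefficient q i j) (List.concatMap-++ p (map (inside ∷_) A) _) ⟩
    coefficient (concatMap p (map (inside ∷_) A) ++ concatMap p (map (outside ∷_) A)) i j
      ≡⟨ coefficient-++ (concatMap p (map (inside ∷_) A)) _ i j ⟩
    coefficient (concatMap p (map (inside ∷_) A)) i j + coefficient (concatMap p (map (outside ∷_) A)) i j
      ≡⟨ cong₂ _+_ (half inside) (half outside) ⟩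
    ∑[ Vec.replicate (suc n) undecided ] (λ S → coefficient (p S) i j) ∎
    where
    open ≡-Reasoning
    A = allSubsets n
    half : ∀ s → coefficient (concatMap p (map (s ∷_) A)) i j
               ≡ ∑[ Vec.replicate n undecided ] (λ S → coefficient (p (s ∷ S)) i j)
    half s = trans (cong (λ q → coefficient q i j) (List.concatMap-map p (s ∷_) A))
                   (coefficient-concatMap (p ∘ (s ∷_)) i j)

  ∑-cong : ∀ {n} (σ : Vec Status n) {f g} → (∀ S → f S ≡ g S) → ∑[ σ ] f ≡ ∑[ σ ] g
  ∑-cong []               f≡g = f≡g []
  ∑-cong (undecided  ∷ σ) f≡g = cong₂ _+_ (∑-cong σ (f≡g ∘ (inside ∷_))) (∑-cong σ (f≡g ∘ (outside ∷_)))
  ∑-cong (contracted ∷ σ) f≡g = ∑-cong σ (f≡g ∘ (inside ∷_))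
  ∑-cong (deleted    ∷ σ) f≡g = ∑-cong σ (f≡g ∘ (outside ∷_))
  ∑-cong (free       ∷ σ) f≡g = cong₂ _+_ (∑-cong σ (f≡g ∘ (inside ∷_))) (∑-cong σ (f≡g ∘ (outside ∷_)))
  ∑-cong (torsion    ∷ σ) f≡g = cong₂ _+_ (∑-cong σ (f≡g ∘ (inside ∷_))) (∑-cong σ (f≡g ∘ (outside ∷_)))

  tutteTerm : ∀ {n} → (r m : Subset n → ℕ) → ℕ → ℕ → Subset n → ℤ
  tutteTerm r m i j S =
    ℤ.+ m S * powerCoeff (r Subset.⊤ ∸ r S) i * powerCoeff (Subset.∣ S ∣ ∸ r S) j

  coefficient-tuttePolynomial : ∀ {n} (r m : Subset n → ℕ) i j →
    coefficient (tuttePolynomial r m) i j ≡ ∑[ Vec.replicate n undecided ] (tutteTerm r m i j)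
  coefficient-tuttePolynomial {n} r m i j = trans
    (coefficient-concatMap (λ S → constant (ℤ.+ m S) ⊗ X-1 ⊗^ (r Subset.⊤ ∸ r S) ⊗ Y-1 ⊗^ (Subset.∣ S ∣ ∸ r S)) i j)
    (∑-cong (Vec.replicate n undecided) λ S →
      coefficient-term (ℤ.+ m S) (r Subset.⊤ ∸ r S) (Subset.∣ S ∣ ∸ r S) i j)

-- Adding and dropping elements, and induction along chains of subsets.

module Subsets where

  open import Relation.Binary.PropositionalEquality using (refl; sym; trans)
  add drop : ∀ {n} → Fin n → Subset n → Subset n
  add  i S = S [ i ]≔ inside
  drop i S = S [ i ]≔ outside

  module _ {n} {S : Subset n} where

    ∈-add : ∀ i → i ∈ add i S
    ∈-add i = Vec.[]≔-updates S i

    add-⊇ : ∀ i → S ⊆ add i S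
    add-⊇ i {j} j∈S with i Fin.≟ j
    ... | yes refl = ∈-add i
    ... | no  i≢j  = Vec.[]≔-minimal S j i (i≢j ∘ sym) j∈S

    ∈-add⁻ : ∀ {i j} → j ∈ add i S → j ≡ i ⊎ j ∈ S
    ∈-add⁻ {i} {j} j∈ with j Fin.≟ i
    ... | yes j≡i = inj₁ j≡i
    ... | no  j≢i = inj₂ (Vec.lookup⇒[]= j S
          (trans (sym (Vec.lookup∘update′ j≢i S inside)) (Vec.[]=⇒lookup j∈)))

    ∈-drop⁺ : ∀ {i j} → j ≢ i → j ∈ S → j ∈ drop i S
    ∈-drop⁺ {i} {j} j≢i = Vec.[]≔-minimal S j i j≢i

    ∉-drop : ∀ i → i ∉ drop i S
    ∉-drop i i∈ with () ← trans (sym (Vec.lookup∘update i S outside)) (Vec.[]=⇒lookup i∈)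

    ∈-drop⁻ : ∀ {i j} → j ∈ drop i S → j ≢ i × j ∈ S
    ∈-drop⁻ {i} {j} j∈ with j Fin.≟ i
    ... | yes refl = contradiction j∈ (∉-drop i)
    ... | no  j≢i  = j≢i , Vec.lookup⇒[]= j S
          (trans (sym (Vec.lookup∘update′ j≢i S outside)) (Vec.[]=⇒lookup j∈))

    drop-⊆ : ∀ i → drop i S ⊆ S
    drop-⊆ i = proj₂ ∘ ∈-drop⁻

  add-drop : ∀ {n} {S : Subset n} {i} → i ∈ S → add i (drop i S) ≡ S
  add-drop {S = S} {i} i∈S = Subset.⊆-antisym
    ([ (λ { refl → i∈S }) , drop-⊆ i ]′ ∘ ∈-add⁻) S⊆
    where
    S⊆ : S ⊆ add i (drop i S)
    S⊆ {j} j∈S with j Fin.≟ i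
    ... | yes refl = ∈-add i
    ... | no  j≢i  = add-⊇ i (∈-drop⁺ j≢i j∈S)

  ∣add∣ : ∀ {n} {S : Subset n} {i} → i ∉ S → ∣ add i S ∣ ≡ suc ∣ S ∣
  ∣add∣ {S = inside  ∷ S} {zero}  i∉S = ⊥-elim (i∉S here)
  ∣add∣ {S = outside ∷ S} {zero}  i∉S = refl
  ∣add∣ {S = inside  ∷ S} {suc i} i∉S = cong suc (∣add∣ (i∉S ∘ there))
  ∣add∣ {S = outside ∷ S} {suc i} i∉S = ∣add∣ (i∉S ∘ there)

  -- The positions where the two sets differ are switched one at a time, so every intermediate U
  -- agrees at each position with one of the ends. The inductions along S ⊆ S′, upwards and
  -- downwards, are the two monotone cases.
  walk : ∀ {p n} (P : Subset n → Set p) (S S′ : Subset n) →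
    (∀ U i → (∀ j → lookup U j ≡ lookup S j ⊎ lookup U j ≡ lookup S′ j) →
      lookup U i ≡ lookup S i → lookup S i ≢ lookup S′ i → P U → P (U [ i ]≔ lookup S′ i)) →
    P S → P S′
  walk P []      []        step PS = PS
  walk P (s ∷ S) (s′ ∷ S′) step PS = head s s′ refl refl
    where
    tail : P (s ∷ S′)
    tail = walk (P ∘ (s ∷_)) S S′
      (λ U i between → step (s ∷ U) (suc i) λ { zero → inj₁ refl ; (suc j) → between j }) PS
    go : s ≢ s′ → P (s′ ∷ S′)
    go s≢s′ = step (s ∷ S′) zero (λ { zero → inj₁ refl ; (suc j) → inj₂ refl }) refl s≢s′ tail
    head : ∀ t t′ → s ≡ t → s′ ≡ t′ → P (s′ ∷ S′)
    head inside  inside  refl refl = tail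
    head outside outside refl refl = tail
    head inside  outside refl refl = go λ ()
    head outside inside  refl refl = go λ ()

  ∉⇒lookup : ∀ {n} {S : Subset n} {i} → i ∉ S → lookup S i ≡ outside
  ∉⇒lookup {S = S} {i} i∉S with lookup S i in eq
  ... | inside  = ⊥-elim (i∉S (Vec.lookup⇒[]= i S eq))
  ... | outside = refl

  lookup⇒∉ : ∀ {n} {S : Subset n} {i} → lookup S i ≡ outside → i ∉ S
  lookup⇒∉ eq i∈S with () ← trans (sym eq) (Vec.[]=⇒lookup i∈S)

  grow : ∀ {p n} (P : Subset n → Set p) {S S′ : Subset n} → S ⊆ S′ →
    (∀ U i → S ⊆ U → U ⊆ S′ → i ∉ U → i ∈ S′ → P U → P (add i U)) →
    P S → P S′
  grow P {S} {S′} S⊆S′ step = walk P S S′ λ U i between Ui≡Si Si≢S′i PU → go U i between Ui≡Si Si≢S′i PU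
    where
    go : ∀ U i → (∀ j → lookup U j ≡ lookup S j ⊎ lookup U j ≡ lookup S′ j) →
      lookup U i ≡ lookup S i → lookup S i ≢ lookup S′ i → P U → P (U [ i ]≔ lookup S′ i)
    go U i between Ui≡Si Si≢S′i PU with lookup S i in eq | lookup S′ i in eq′
    ... | inside  | inside  = ⊥-elim (Si≢S′i refl)
    ... | outside | outside = ⊥-elim (Si≢S′i refl)
    ... | inside  | outside = ⊥-elim (lookup⇒∉ eq′ (S⊆S′ (Vec.lookup⇒[]= i S eq)))
    ... | outside | inside  = step U i S⊆U U⊆S′ (lookup⇒∉ Ui≡Si) (Vec.lookup⇒[]= i S′ eq′) PU
      where
      S⊆U : S ⊆ U
      S⊆U {j} j∈S = Vec.lookup⇒[]= j U
        ([ (λ e → trans e (Vec.[]=⇒lookup j∈S)) , (λ e → trans e (Vec.[]=⇒lookup (S⊆S′ j∈S))) ]′ (between j))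
      U⊆S′ : U ⊆ S′
      U⊆S′ {j} j∈U with between j
      ... | inj₁ e = S⊆S′ (Vec.lookup⇒[]= j S (trans (sym e) (Vec.[]=⇒lookup j∈U)))
      ... | inj₂ e = Vec.lookup⇒[]= j S′ (trans (sym e) (Vec.[]=⇒lookup j∈U))

  shrink : ∀ {p n} (P : Subset n → Set p) {S S′ : Subset n} → S′ ⊆ S →
    (∀ U i → S′ ⊆ U → U ⊆ S → i ∈ U → i ∉ S′ → P U → P (drop i U)) →
    P S → P S′
  shrink P {S} {S′} S′⊆S step = walk P S S′ λ U i between Ui≡Si Si≢S′i PU → go U i between Ui≡Si Si≢S′i PU
    where
    go : ∀ U i → (∀ j → lookup U j ≡ lookup S j ⊎ lookup U j ≡ lookup S′ j) →
      lookup U i ≡ lookup S i → lookup S i ≢ lookup S′ i → P U → P (U [ i ]≔ lookup S′ i)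
    go U i between Ui≡Si Si≢S′i PU with lookup S i in eq | lookup S′ i in eq′
    ... | inside  | inside  = ⊥-elim (Si≢S′i refl)
    ... | outside | outside = ⊥-elim (Si≢S′i refl)
    ... | outside | inside  = ⊥-elim (lookup⇒∉ eq (S′⊆S (Vec.lookup⇒[]= i S′ eq′)))
    ... | inside  | outside = step U i S′⊆U U⊆S (Vec.lookup⇒[]= i U Ui≡Si) (lookup⇒∉ eq′) PU
      where
      S′⊆U : S′ ⊆ U
      S′⊆U {j} j∈S′ = Vec.lookup⇒[]= j U
        ([ (λ e → trans e (Vec.[]=⇒lookup (S′⊆S j∈S′))) , (λ e → trans e (Vec.[]=⇒lookup j∈S′)) ]′ (between j))
      U⊆S : U ⊆ S
      U⊆S {j} j∈U with between j
      ... | inj₁ e = Vec.lookup⇒[]= j S (trans (sym e) (Vec.[]=⇒lookup j∈U))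
      ... | inj₂ e = S′⊆S (Vec.lookup⇒[]= j S′ (trans (sym e) (Vec.[]=⇒lookup j∈U)))

-- Matroid rank functions, loops and coloops.

module Matroids where

  open import Relation.Binary.PropositionalEquality using (refl; sym; trans)
  open Subsets

  -- Submodularity is required only in the local form `closure-mono`. This is the form that
  -- saturations provide: an element that is torsion over S is torsion over every larger set.
  record IsMatroidRank {n} (r : Subset n → ℕ) : Set where
    field
      rank-⊥     : r Subset.⊥ ≡ 0
      rank-mono  : ∀ i S → r S ℕ.≤ r (add i S)
      rank-add-≤ : ∀ i S → r (add i S) ℕ.≤ suc (r S)
      closure-mono : ∀ {i S S′} → S ⊆ S′ → r (add i S) ≡ r S → r (add i S′) ≡ r S′

    rank-add-≢ : ∀ {i S} → r (add i S) ≢ r S → r (add i S) ≡ suc (r S)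
    rank-add-≢ {i} {S} ≢ = ℕ.≤-antisym (rank-add-≤ i S) (ℕ.≤∧≢⇒< (rank-mono i S) (≢ ∘ sym))

    rank≤∣∣ : ∀ S → r S ℕ.≤ ∣ S ∣
    rank≤∣∣ S = grow (λ U → r U ℕ.≤ ∣ U ∣) (Subset.⊆-min S)
      (λ U i _ _ i∉U _ rU≤ → ℕ.≤-trans (rank-add-≤ i U) (ℕ.≤-trans (ℕ.s≤s rU≤) (ℕ.≤-reflexive (sym (∣add∣ i∉U)))))
      (ℕ.≤-trans (ℕ.≤-reflexive rank-⊥) ℕ.z≤n)

    rank-closure : ∀ {S S′} → S ⊆ S′ → (∀ i → i ∈ S′ → i ∉ S → r (add i S) ≡ r S) → r S′ ≡ r S
    rank-closure {S} S⊆S′ closed = grow (λ U → r U ≡ r S) S⊆S′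
      (λ U i S⊆U _ i∉U i∈S′ eq → trans (closure-mono S⊆U (closed i i∈S′ (i∉U ∘ S⊆U))) eq) refl

    -- If i did not raise the rank of S, it would not raise that of the larger set `drop i B`
    -- either, and could not be a coloop of B.
    coloop-add : ∀ {i S B} → i ∈ B → i ∉ S → S ⊆ B → r (drop i B) ℕ.< r B → r (add i S) ≡ suc (r S)
    coloop-add {i} {S} {B} i∈B i∉S S⊆B coloop = rank-add-≢ λ eq → ℕ.<-irrefl
      (trans (sym (closure-mono (λ j∈S → ∈-drop⁺ (λ { refl → i∉S j∈S }) (S⊆B j∈S)) eq)) (cong r (add-drop i∈B)))
      coloop

    rank-coloops : ∀ {S S′ B} → S ⊆ S′ → S′ ⊆ B → (∀ i → i ∈ B → i ∉ S → r (drop i B) ℕ.< r B) →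
      r S ≡ ∣ S ∣ → r S′ ≡ ∣ S′ ∣
    rank-coloops {S} S⊆S′ S′⊆B coloop = grow (λ U → r U ≡ ∣ U ∣) S⊆S′
      λ U i S⊆U U⊆S′ i∉U i∈S′ eq → trans
        (coloop-add (S′⊆B i∈S′) i∉U (S′⊆B ∘ U⊆S′) (coloop i (S′⊆B i∈S′) (i∉U ∘ S⊆U)))
        (trans (cong suc eq) (sym (∣add∣ i∉U)))

    independent⇒coloop : ∀ {B i} → r B ≡ ∣ B ∣ → i ∈ B → r (drop i B) ℕ.< r B
    independent⇒coloop {B} {i} rB≡ i∈B = begin-strict
      r (drop i B)           ≤⟨ rank≤∣∣ (drop i B) ⟩
      ∣ drop i B ∣           <⟨ ℕ.n<1+n _ ⟩
      suc ∣ drop i B ∣       ≡⟨ ∣add∣ (∉-drop {S = B} i) ⟨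
      ∣ add i (drop i B) ∣   ≡⟨ cong ∣_∣ (add-drop i∈B) ⟩
      ∣ B ∣                  ≡⟨ rB≡ ⟨
      r B                    ∎
      where open ℕ.≤-Reasoning

-- Deletion and contraction down to the leaves.

module DeletionContraction where

  open CommutativeSemigroupProperties ℤ.+-commutativeSemigroup using () renaming (interchange to +-interchange)
  open import Relation.Binary.PropositionalEquality using (refl; sym; trans)
  open Coefficients
  open Statuses
  open Subsets
  open Matroids
  open import Data.Integer.Base using (_≤_; _+_; _*_)

  isContracted isKept : Status → Bool
  isContracted contracted = inside
  isContracted _          = outside
  isKept deleted = outside
  isKept torsion = outside
  isKept _       = inside

  -- At a leaf these are R and R ∪ F. Before that, `kept` also contains the undecided positions, so
  -- it is what remains after deleting and setting loops aside.
  base kept : ∀ {n} → Vec Status n → Subset n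
  base = Vec.map isContracted
  kept = Vec.map isKept

  Allowed : Status → Bool → Set
  Allowed contracted s = s ≡ inside
  Allowed deleted    s = s ≡ outside
  Allowed _          s = ⊤

  Compatible : ∀ {n} → Vec Status n → Subset n → Set
  Compatible = Pointwise Allowed

  Decided : ∀ {n} → Vec Status n → Set
  Decided σ = ∀ i → lookup σ i ≢ undecided

  ∑-cong-compatible : ∀ {n} (σ : Vec Status n) {f g} →
    (∀ S → Compatible σ S → f S ≡ g S) → ∑[ σ ] f ≡ ∑[ σ ] g
  ∑-cong-compatible []               f≡g = f≡g [] []
  ∑-cong-compatible (undecided  ∷ σ) f≡g = cong₂ _+_
    (∑-cong-compatible σ λ S c → f≡g (inside ∷ S) (tt ∷ c)) (∑-cong-compatible σ λ S c → f≡g (outside ∷ S) (tt ∷ c))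
  ∑-cong-compatible (contracted ∷ σ) f≡g = ∑-cong-compatible σ λ S c → f≡g (inside ∷ S) (refl ∷ c)
  ∑-cong-compatible (deleted    ∷ σ) f≡g = ∑-cong-compatible σ λ S c → f≡g (outside ∷ S) (refl ∷ c)
  ∑-cong-compatible (free       ∷ σ) f≡g = cong₂ _+_
    (∑-cong-compatible σ λ S c → f≡g (inside ∷ S) (tt ∷ c)) (∑-cong-compatible σ λ S c → f≡g (outside ∷ S) (tt ∷ c))
  ∑-cong-compatible (torsion    ∷ σ) f≡g = cong₂ _+_
    (∑-cong-compatible σ λ S c → f≡g (inside ∷ S) (tt ∷ c)) (∑-cong-compatible σ λ S c → f≡g (outside ∷ S) (tt ∷ c))

  private
    both-branch : ∀ {n} (σ : Vec Status n) i (f : Subset (suc n) → ℤ) →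
      (∑[ σ ] (f ∘ (inside ∷_)) ≡
        ∑[ σ [ i ]≔ contracted ] (f ∘ (inside ∷_)) + ∑[ σ [ i ]≔ deleted ] (f ∘ (inside ∷_))) →
      (∑[ σ ] (f ∘ (outside ∷_)) ≡
        ∑[ σ [ i ]≔ contracted ] (f ∘ (outside ∷_)) + ∑[ σ [ i ]≔ deleted ] (f ∘ (outside ∷_))) →
      ∑[ σ ] (f ∘ (inside ∷_)) + ∑[ σ ] (f ∘ (outside ∷_)) ≡
        (∑[ σ [ i ]≔ contracted ] (f ∘ (inside ∷_)) + ∑[ σ [ i ]≔ contracted ] (f ∘ (outside ∷_))) +
        (∑[ σ [ i ]≔ deleted ] (f ∘ (inside ∷_)) + ∑[ σ [ i ]≔ deleted ] (f ∘ (outside ∷_)))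
    both-branch σ i f eq₁ eq₂ = trans (cong₂ _+_ eq₁ eq₂)
      (+-interchange (∑[ σ [ i ]≔ contracted ] (f ∘ (inside ∷_))) (∑[ σ [ i ]≔ deleted ] (f ∘ (inside ∷_)))
                   (∑[ σ [ i ]≔ contracted ] (f ∘ (outside ∷_))) (∑[ σ [ i ]≔ deleted ] (f ∘ (outside ∷_))))

  ∑-free : ∀ {n} (σ : Vec Status n) i f → lookup σ i ≡ undecided → ∑[ σ [ i ]≔ free ] f ≡ ∑[ σ ] f
  ∑-free (undecided  ∷ σ) zero    f refl = refl
  ∑-free (undecided  ∷ σ) (suc i) f eq = cong₂ _+_ (∑-free σ i _ eq) (∑-free σ i _ eq)
  ∑-free (contracted ∷ σ) (suc i) f eq = ∑-free σ i _ eq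
  ∑-free (deleted    ∷ σ) (suc i) f eq = ∑-free σ i _ eq
  ∑-free (free       ∷ σ) (suc i) f eq = cong₂ _+_ (∑-free σ i _ eq) (∑-free σ i _ eq)
  ∑-free (torsion    ∷ σ) (suc i) f eq = cong₂ _+_ (∑-free σ i _ eq) (∑-free σ i _ eq)

  ∑-torsion : ∀ {n} (σ : Vec Status n) i f → lookup σ i ≡ undecided → ∑[ σ [ i ]≔ torsion ] f ≡ ∑[ σ ] f
  ∑-torsion (undecided  ∷ σ) zero    f refl = refl
  ∑-torsion (undecided  ∷ σ) (suc i) f eq = cong₂ _+_ (∑-torsion σ i _ eq) (∑-torsion σ i _ eq)
  ∑-torsion (contracted ∷ σ) (suc i) f eq = ∑-torsion σ i _ eq
  ∑-torsion (deleted    ∷ σ) (suc i) f eq = ∑-torsion σ i _ eq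
  ∑-torsion (free       ∷ σ) (suc i) f eq = cong₂ _+_ (∑-torsion σ i _ eq) (∑-torsion σ i _ eq)
  ∑-torsion (torsion    ∷ σ) (suc i) f eq = cong₂ _+_ (∑-torsion σ i _ eq) (∑-torsion σ i _ eq)

  ∑-branch : ∀ {n} (σ : Vec Status n) i f → lookup σ i ≡ undecided →
    ∑[ σ ] f ≡ ∑[ σ [ i ]≔ contracted ] f + ∑[ σ [ i ]≔ deleted ] f
  ∑-branch (undecided  ∷ σ) zero    f refl = refl
  ∑-branch (undecided  ∷ σ) (suc i) f eq =
    both-branch σ i f (∑-branch σ i (f ∘ (inside ∷_)) eq) (∑-branch σ i (f ∘ (outside ∷_)) eq)
  ∑-branch (contracted ∷ σ) (suc i) f eq = ∑-branch σ i _ eq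
  ∑-branch (deleted    ∷ σ) (suc i) f eq = ∑-branch σ i _ eq
  ∑-branch (free       ∷ σ) (suc i) f eq =
    both-branch σ i f (∑-branch σ i (f ∘ (inside ∷_)) eq) (∑-branch σ i (f ∘ (outside ∷_)) eq)
  ∑-branch (torsion    ∷ σ) (suc i) f eq =
    both-branch σ i f (∑-branch σ i (f ∘ (inside ∷_)) eq) (∑-branch σ i (f ∘ (outside ∷_)) eq)

  -- The invariant of the branching. Loops are taken over the contracted set and coloops inside the
  -- kept set; once nothing is undecided, the independence of `base σ` and the coloops together make
  -- `kept σ` independent and spanning.
  record Minor {n} (r : Subset n → ℕ) (σ : Vec Status n) : Set where
    field
      base-independent : r (base σ) ≡ ∣ base σ ∣
      torsion-loop     : ∀ i → lookup σ i ≡ torsion → r (add i (base σ)) ≡ r (base σ)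
      free-coloop      : ∀ i → lookup σ i ≡ free → r (drop i (kept σ)) ℕ.< r (kept σ)
      kept-spanning    : r Subset.⊤ ≡ r (kept σ)

  ∈-map⁺ : ∀ {n} {f : Status → Bool} (σ : Vec Status n) {i} → f (lookup σ i) ≡ inside → i ∈ Vec.map f σ
  ∈-map⁺ {f = f} σ {i} eq = Vec.lookup⇒[]= i (Vec.map f σ) (trans (Vec.lookup-map i f σ) eq)

  ∈-map⁻ : ∀ {n} {f : Status → Bool} (σ : Vec Status n) {i} → i ∈ Vec.map f σ → f (lookup σ i) ≡ inside
  ∈-map⁻ {f = f} σ {i} i∈ = trans (sym (Vec.lookup-map i f σ)) (Vec.[]=⇒lookup i∈)

  base⊆kept : ∀ {n} (σ : Vec Status n) → base σ ⊆ kept σ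
  base⊆kept σ {i} i∈ with lookup σ i in eq | ∈-map⁻ σ i∈
  ... | contracted | _ = ∈-map⁺ σ (cong isKept eq)

  module _ {n} {r : Subset n → ℕ} (isRank : IsMatroidRank r) where

    open IsMatroidRank isRank

    private
      lookup-update : ∀ (σ : Vec Status n) i s j {t} → s ≢ t → lookup (σ [ i ]≔ s) j ≡ t → j ≢ i × lookup σ j ≡ t
      lookup-update σ i s j s≢t eq with j Fin.≟ i
      ... | yes refl = contradiction (trans (sym (Vec.lookup∘update i σ s)) eq) s≢t
      ... | no  j≢i  = j≢i , trans (sym (Vec.lookup∘update′ j≢i σ s)) eq

    initial-minor : Minor r (Vec.replicate n undecided)
    initial-minor = record
      { base-independent = trans (cong r base≡⊥) (trans rank-⊥ (trans (sym (Subset.∣⊥∣≡0 n)) (cong ∣_∣ (sym base≡⊥))))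
      ; torsion-loop     = λ i eq → contradiction (trans (sym (Vec.lookup-replicate i undecided)) eq) λ ()
      ; free-coloop      = λ i eq → contradiction (trans (sym (Vec.lookup-replicate i undecided)) eq) λ ()
      ; kept-spanning    = cong r (sym (Vec.map-replicate isKept undecided n))
      }
      where
      base≡⊥ : base (Vec.replicate n undecided) ≡ Subset.⊥
      base≡⊥ = Vec.map-replicate isContracted undecided n

    module _ {σ : Vec Status n} (minor : Minor r σ) {i : Fin n} (σᵢ : lookup σ i ≡ undecided) where

      open Minor minor

      private
        i∈kept : i ∈ kept σ
        i∈kept = ∈-map⁺ σ (cong isKept σᵢ)

        i∉base : i ∉ base σ
        i∉base i∈ with () ← trans (sym (∈-map⁻ σ i∈)) (cong isContracted σᵢ)

        base-unchanged : ∀ {s} → isContracted s ≡ outside → base (σ [ i ]≔ s) ≡ base σ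
        base-unchanged {s} eq = trans (Vec.map-[]≔ isContracted σ i)
          (trans (cong (base σ [ i ]≔_) (trans eq (trans (cong isContracted (sym σᵢ)) (sym (Vec.lookup-map i isContracted σ)))))
            (Vec.[]≔-lookup (base σ) i))

        kept-unchanged : ∀ {s} → isKept s ≡ inside → kept (σ [ i ]≔ s) ≡ kept σ
        kept-unchanged {s} eq = trans (Vec.map-[]≔ isKept σ i)
          (trans (cong (kept σ [ i ]≔_) (trans eq (trans (cong isKept (sym σᵢ)) (sym (Vec.lookup-map i isKept σ)))))
            (Vec.[]≔-lookup (kept σ) i))

        kept-dropped : ∀ {s} → isKept s ≡ outside → kept (σ [ i ]≔ s) ≡ drop i (kept σ)
        kept-dropped {s} eq = trans (Vec.map-[]≔ isKept σ i) (cong (kept σ [ i ]≔_) eq)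

        -- A coloop j of the kept set raises the rank of every subset avoiding it, in particular
        -- that of the kept set without i and j; hence it remains a coloop once i is gone.
        free-coloop-drop : r (drop i (kept σ)) ≡ r (kept σ) →
          ∀ j → j ≢ i → lookup σ j ≡ free → r (drop j (drop i (kept σ))) ℕ.< r (drop i (kept σ))
        free-coloop-drop eq j j≢i σⱼ = subst (r (drop j (drop i (kept σ))) ℕ.<_)
          (trans (sym (coloop-add j∈kept (∉-drop {S = drop i (kept σ)} j)
                     (drop-⊆ i ∘ drop-⊆ j) (free-coloop j σⱼ)))
                 (cong r (add-drop (∈-drop⁺ j≢i j∈kept))))
          (ℕ.n<1+n _)
          where
          j∈kept : j ∈ kept σ
          j∈kept = ∈-map⁺ σ (cong isKept σⱼ)

      set-torsion : r (add i (base σ)) ≡ r (base σ) → Minor r (σ [ i ]≔ torsion)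
      set-torsion loop = record
        { base-independent = subst (λ S → r S ≡ ∣ S ∣) (sym base≡) base-independent
        ; torsion-loop     = λ j eq → subst (λ S → r (add j S) ≡ r S) (sym base≡) (torsion-loop′ j eq)
        ; free-coloop      = λ j eq → subst (λ S → r (drop j S) ℕ.< r S) (sym kept≡)
            (let j≢i , σⱼ = lookup-update σ i torsion j (λ ()) eq in free-coloop-drop dropped j j≢i σⱼ)
        ; kept-spanning    = trans kept-spanning (trans (sym dropped) (cong r (sym kept≡)))
        }
        where
        base≡ = base-unchanged {torsion} refl
        kept≡ = kept-dropped {torsion} refl
        torsion-loop′ : ∀ j → lookup (σ [ i ]≔ torsion) j ≡ torsion → r (add j (base σ)) ≡ r (base σ)
        torsion-loop′ j eq with j Fin.≟ i
        ... | yes refl = loop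
        ... | no  j≢i  = torsion-loop j (trans (sym (Vec.lookup∘update′ j≢i σ torsion)) eq)
        dropped : r (drop i (kept σ)) ≡ r (kept σ)
        -- A loop over `base σ` is also a loop over the larger set `drop i (kept σ)`, so leaving it
        -- out costs no rank.
        dropped = trans (sym (closure-mono (λ {j} j∈ → ∈-drop⁺ (λ { refl → i∉base j∈ }) (base⊆kept σ j∈)) loop))
                        (cong r (add-drop i∈kept))

      set-free : r (drop i (kept σ)) ≢ r (kept σ) → Minor r (σ [ i ]≔ free)
      set-free coloop = record
        { base-independent = subst (λ S → r S ≡ ∣ S ∣) (sym base≡) base-independent
        ; torsion-loop     = λ j eq → subst (λ S → r (add j S) ≡ r S) (sym base≡)
            (torsion-loop j (proj₂ (lookup-update σ i free j (λ ()) eq)))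
        ; free-coloop      = λ j eq → subst (λ S → r (drop j S) ℕ.< r S) (sym kept≡) (free-coloop′ j eq)
        ; kept-spanning    = trans kept-spanning (cong r (sym kept≡))
        }
        where
        base≡ = base-unchanged {free} refl
        kept≡ = kept-unchanged {free} refl
        free-coloop′ : ∀ j → lookup (σ [ i ]≔ free) j ≡ free → r (drop j (kept σ)) ℕ.< r (kept σ)
        free-coloop′ j eq with j Fin.≟ i
        ... | yes refl = ℕ.≤∧≢⇒< (subst (r (drop i (kept σ)) ℕ.≤_) (cong r (add-drop i∈kept)) (rank-mono i _)) coloop
        ... | no  j≢i  = free-coloop j (trans (sym (Vec.lookup∘update′ j≢i σ free)) eq)

      contract : r (add i (base σ)) ≢ r (base σ) → Minor r (σ [ i ]≔ contracted)
      contract ≢ = record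
        { base-independent = subst (λ S → r S ≡ ∣ S ∣) (sym base≡)
            (trans (rank-add-≢ ≢) (trans (cong suc base-independent) (sym (∣add∣ i∉base))))
        ; torsion-loop     = λ j eq → subst (λ S → r (add j S) ≡ r S) (sym base≡)
            (closure-mono (add-⊇ i) (torsion-loop j (proj₂ (lookup-update σ i contracted j (λ ()) eq))))
        ; free-coloop      = λ j eq → subst (λ S → r (drop j S) ℕ.< r S) (sym kept≡)
            (free-coloop j (proj₂ (lookup-update σ i contracted j (λ ()) eq)))
        ; kept-spanning    = trans kept-spanning (cong r (sym kept≡))
        }
        where
        base≡ : base (σ [ i ]≔ contracted) ≡ add i (base σ)
        base≡ = Vec.map-[]≔ isContracted σ i
        kept≡ = kept-unchanged {contracted} refl

      delete : r (drop i (kept σ)) ≡ r (kept σ) → Minor r (σ [ i ]≔ deleted)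
      delete dropped = record
        { base-independent = subst (λ S → r S ≡ ∣ S ∣) (sym base≡) base-independent
        ; torsion-loop     = λ j eq → subst (λ S → r (add j S) ≡ r S) (sym base≡)
            (torsion-loop j (proj₂ (lookup-update σ i deleted j (λ ()) eq)))
        ; free-coloop      = λ j eq → subst (λ S → r (drop j S) ℕ.< r S) (sym kept≡)
            (let j≢i , σⱼ = lookup-update σ i deleted j (λ ()) eq in free-coloop-drop dropped j j≢i σⱼ)
        ; kept-spanning    = trans kept-spanning (trans (sym dropped) (cong r (sym kept≡)))
        }
        where
        base≡ = base-unchanged {deleted} refl
        kept≡ = kept-dropped {deleted} refl

    private
      undecided? : ∀ s → Dec (s ≡ undecided)
      undecided? undecided  = yes refl
      undecided? contracted = no λ ()
      undecided? deleted    = no λ ()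
      undecided? free       = no λ ()
      undecided? torsion    = no λ ()

    module _ (f : Subset n → ℤ) (leaf : ∀ σ → Decided σ → Minor r σ → 0ℤ ≤ ∑[ σ ] f) where

      private
        Pending : Vec Status n → List (Fin n) → Set
        Pending σ is = ∀ j → lookup σ j ≡ undecided → j List.∈ is

        pending-tail : ∀ {σ i is s} → s ≢ undecided → Pending σ (i ∷ is) → Pending (σ [ i ]≔ s) is
        pending-tail {σ} {i} {s = s} s≢ pending j eq with lookup-update σ i s j s≢ eq
        ... | j≢i , σⱼ with pending j σⱼ
        ...   | here j≡i = contradiction j≡i j≢i
        ...   | there j∈ = j∈

      -- The summand f stays the same throughout. Only an element that is neither a loop nor a
      -- coloop splits the sum, into the S that contain it and the S that do not; loops and coloops
      -- are merely relabelled.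
      minor-∑-nonneg : ∀ is σ → Pending σ is → Minor r σ → 0ℤ ≤ ∑[ σ ] f
      minor-∑-nonneg [] σ pending minor = leaf σ (λ j σⱼ → contradiction (pending j σⱼ) λ ()) minor
      minor-∑-nonneg (i ∷ is) σ pending minor with undecided? (lookup σ i)
      ... | no  σᵢ≢ = minor-∑-nonneg is σ (λ j σⱼ → skip j σⱼ (pending j σⱼ)) minor
        where
        skip : ∀ j → lookup σ j ≡ undecided → j List.∈ (i ∷ is) → j List.∈ is
        skip j σⱼ (here refl) = contradiction σⱼ σᵢ≢
        skip j σⱼ (there j∈)  = j∈
      ... | yes σᵢ with r (add i (base σ)) ℕ.≟ r (base σ) | r (drop i (kept σ)) ℕ.≟ r (kept σ)
      ...   | yes loop | _         = subst (0ℤ ≤_) (∑-torsion σ i f σᵢ)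
        (minor-∑-nonneg is _ (pending-tail {σ} (λ ()) pending) (set-torsion minor σᵢ loop))
      ...   | no  _    | no coloop = subst (0ℤ ≤_) (∑-free σ i f σᵢ)
        (minor-∑-nonneg is _ (pending-tail {σ} (λ ()) pending) (set-free minor σᵢ coloop))
      ...   | no ¬loop | yes ¬coloop = subst (0ℤ ≤_) (sym (∑-branch σ i f σᵢ)) (ℤ.+-mono-≤
        (minor-∑-nonneg is _ (pending-tail {σ} (λ ()) pending) (contract minor σᵢ ¬loop))
        (minor-∑-nonneg is _ (pending-tail {σ} (λ ()) pending) (delete minor σᵢ ¬coloop)))

      ∑-nonneg : 0ℤ ≤ ∑[ Vec.replicate n undecided ] f
      ∑-nonneg = minor-∑-nonneg (allFin n) (Vec.replicate n undecided) (λ j _ → ∈-allFin j) initial-minor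

  -- For S = R ∪ X ∪ Y these are #(F ∖ X) and #Y, which at a leaf are the exponents of x - 1 and y -
  -- 1.
  freeOutside torsionInside : ∀ {n} → Vec Status n → Subset n → ℕ
  freeOutside []         []            = 0
  freeOutside (free ∷ σ) (outside ∷ S) = suc (freeOutside σ S)
  freeOutside (_    ∷ σ) (_       ∷ S) = freeOutside σ S
  torsionInside []            []           = 0
  torsionInside (torsion ∷ σ) (inside ∷ S) = suc (torsionInside σ S)
  torsionInside (_       ∷ σ) (_      ∷ S) = torsionInside σ S

  freeOutside-count : ∀ {n} {σ : Vec Status n} {S} → Decided σ → Compatible σ S →
    freeOutside σ S ℕ.+ ∣ kept σ ∩ S ∣ ≡ ∣ kept σ ∣
  freeOutside-count {σ = []} d [] = refl
  freeOutside-count {σ = undecided  ∷ σ} d (_ ∷ c) = ⊥-elim (d zero refl)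
  freeOutside-count {σ = contracted ∷ σ} d (refl ∷ c) =
    trans (ℕ.+-suc (freeOutside σ _) _) (cong suc (freeOutside-count (d ∘ suc) c))
  freeOutside-count {σ = deleted ∷ σ} d (refl ∷ c) = freeOutside-count (d ∘ suc) c
  freeOutside-count {σ = free    ∷ σ} {inside  ∷ S} d (_ ∷ c) =
    trans (ℕ.+-suc (freeOutside σ S) _) (cong suc (freeOutside-count (d ∘ suc) c))
  freeOutside-count {σ = free    ∷ σ} {outside ∷ S} d (_ ∷ c) = cong suc (freeOutside-count (d ∘ suc) c)
  freeOutside-count {σ = torsion ∷ σ} {_ ∷ S} d (_ ∷ c) = freeOutside-count (d ∘ suc) c

  torsionInside-count : ∀ {n} {σ : Vec Status n} {S} → Decided σ → Compatible σ S →
    torsionInside σ S ℕ.+ ∣ kept σ ∩ S ∣ ≡ ∣ S ∣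
  torsionInside-count {σ = []} d [] = refl
  torsionInside-count {σ = undecided  ∷ σ} d (_ ∷ c) = ⊥-elim (d zero refl)
  torsionInside-count {σ = contracted ∷ σ} d (refl ∷ c) =
    trans (ℕ.+-suc (torsionInside σ _) _) (cong suc (torsionInside-count (d ∘ suc) c))
  torsionInside-count {σ = deleted ∷ σ} d (refl ∷ c) = torsionInside-count (d ∘ suc) c
  torsionInside-count {σ = free    ∷ σ} {inside  ∷ S} d (_ ∷ c) =
    trans (ℕ.+-suc (torsionInside σ S) _) (cong suc (torsionInside-count (d ∘ suc) c))
  torsionInside-count {σ = free    ∷ σ} {outside ∷ S} d (_ ∷ c) = torsionInside-count (d ∘ suc) c
  torsionInside-count {σ = torsion ∷ σ} {inside  ∷ S} d (_ ∷ c) = cong suc (torsionInside-count (d ∘ suc) c)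
  torsionInside-count {σ = torsion ∷ σ} {outside ∷ S} d (_ ∷ c) = torsionInside-count (d ∘ suc) c

  module _ {n} {r : Subset n → ℕ} (isRank : IsMatroidRank r)
           {σ : Vec Status n} (decided : Decided σ) (minor : Minor r σ) where

    open IsMatroidRank isRank
    open Minor minor

    kept-free : ∀ {i} → i ∈ kept σ → i ∉ base σ → lookup σ i ≡ free
    kept-free {i} i∈kept i∉base with lookup σ i in eq | ∈-map⁻ σ i∈kept
    ... | undecided  | _ = contradiction eq (decided i)
    ... | contracted | _ = contradiction (∈-map⁺ σ (cong isContracted eq)) i∉base
    ... | free       | _ = refl

    unkept-torsion : ∀ {S i} → Compatible σ S → i ∈ S → i ∉ kept σ → lookup σ i ≡ torsion
    unkept-torsion {S} {i} c i∈S i∉kept with lookup σ i in eq | Pointwise.lookup c i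
    ... | undecided  | _ = contradiction eq (decided i)
    ... | contracted | _ = contradiction (∈-map⁺ σ (cong isKept eq)) i∉kept
    ... | deleted    | Sᵢ with () ← trans (sym Sᵢ) (Vec.[]=⇒lookup i∈S)
    ... | free       | _ = contradiction (∈-map⁺ σ (cong isKept eq)) i∉kept
    ... | torsion    | _ = refl

    base-compatible : ∀ {S} → Compatible σ S → base σ ⊆ S
    base-compatible {S} c {i} i∈base with lookup σ i | ∈-map⁻ σ i∈base | Pointwise.lookup c i
    ... | contracted | _ | Sᵢ = Vec.lookup⇒[]= i S Sᵢ

    kept-independent : r (kept σ) ≡ ∣ kept σ ∣
    kept-independent = rank-coloops (base⊆kept σ) Subset.⊆-refl
      (λ i i∈kept i∉base → free-coloop i (kept-free i∈kept i∉base)) base-independent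

    module _ {S : Subset n} (c : Compatible σ S) where

      base⊆kept∩S : base σ ⊆ kept σ ∩ S
      base⊆kept∩S i∈base = Subset.x∈p∩q⁺ (base⊆kept σ i∈base , base-compatible c i∈base)

      -- The torsion elements of S are loops over `base σ`, which lies in `kept σ ∩ S`, so they add
      -- no rank. The rest of `kept σ ∩ S` consists of coloops above the independent set `base σ`.
      rank-compatible : r S ≡ ∣ kept σ ∩ S ∣
      rank-compatible = trans
        (rank-closure (Subset.p∩q⊆q (kept σ) S) λ i i∈S i∉ →
          closure-mono base⊆kept∩S (torsion-loop i
            (unkept-torsion c i∈S (λ i∈kept → i∉ (Subset.x∈p∩q⁺ (i∈kept , i∈S))))))
        (rank-coloops base⊆kept∩S (Subset.p∩q⊆p (kept σ) S)
          (λ i i∈kept i∉base → free-coloop i (kept-free i∈kept i∉base)) base-independent)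

      corank-compatible : r Subset.⊤ ∸ r S ≡ freeOutside σ S
      corank-compatible = trans
        (cong₂ _∸_ (trans kept-spanning (trans kept-independent (sym (freeOutside-count decided c)))) rank-compatible)
        (ℕ.m+n∸n≡m (freeOutside σ S) ∣ kept σ ∩ S ∣)

      nullity-compatible : ∣ S ∣ ∸ r S ≡ torsionInside σ S
      nullity-compatible = trans
        (cong₂ _∸_ (sym (torsionInside-count decided c)) rank-compatible)
        (ℕ.m+n∸n≡m (torsionInside σ S) ∣ kept σ ∩ S ∣)

-- Quadratic forms and scaled orthogonal projections over ℤ.

module Forms where

  open import Relation.Binary.PropositionalEquality using (refl; sym; trans)
  open import Algebra.Properties.Semiring.Sum ℤ.+-*-semiring
    using (sum; ∑-distrib-+; sum-cong-≗; *-distribˡ-sum)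
  open import Data.Integer.Base using (_≤_; _+_; _*_; -_; _-_)
  open ≡-Reasoning

  *-nonneg : ∀ {a b} → 0ℤ ≤ a → 0ℤ ≤ b → 0ℤ ≤ a * b
  *-nonneg {ℤ.+ a} {ℤ.+ b} _ _ = subst (0ℤ ≤_) (ℤ.pos-* a b) (ℤ.+≤+ ℕ.z≤n)

  square-nonneg : ∀ a → 0ℤ ≤ a * a
  square-nonneg (ℤ.+ a)    = *-nonneg {ℤ.+ a} {ℤ.+ a} (ℤ.+≤+ ℕ.z≤n) (ℤ.+≤+ ℕ.z≤n)
  square-nonneg ℤ.-[1+ a ] = ℤ.+≤+ ℕ.z≤n

  sum-nonneg : ∀ {n} (f : Fin n → ℤ) → (∀ i → 0ℤ ≤ f i) → 0ℤ ≤ sum f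
  sum-nonneg {zero}  f f≥0 = ℤ.≤-refl
  sum-nonneg {suc n} f f≥0 = ℤ.+-mono-≤ (f≥0 zero) (sum-nonneg (f ∘ suc) (f≥0 ∘ suc))

  module _ {N : ℕ} where

    private
      V : Set
      V = Fin N → ℤ

    ⟨_,_⟩ : V → V → ℤ
    ⟨ u , v ⟩ = sum λ k → u k * v k

    ⟨⟩-cong : ∀ {u u′ v v′} → u ≗ u′ → v ≗ v′ → ⟨ u , v ⟩ ≡ ⟨ u′ , v′ ⟩
    ⟨⟩-cong u≗ v≗ = sum-cong-≗ λ k → cong₂ _*_ (u≗ k) (v≗ k)

    ⟨⟩-comm : ∀ u v → ⟨ u , v ⟩ ≡ ⟨ v , u ⟩
    ⟨⟩-comm u v = sum-cong-≗ λ k → ℤ.*-comm (u k) (v k)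

    ⟨⟩-+ˡ : ∀ u u′ v → ⟨ (λ k → u k + u′ k) , v ⟩ ≡ ⟨ u , v ⟩ + ⟨ u′ , v ⟩
    ⟨⟩-+ˡ u u′ v = trans (sum-cong-≗ λ k → ℤ.*-distribʳ-+ (v k) (u k) (u′ k)) (∑-distrib-+ (λ k → u k * v k) (λ k → u′ k * v k))

    ⟨⟩-*ˡ : ∀ a u v → ⟨ (λ k → a * u k) , v ⟩ ≡ a * ⟨ u , v ⟩
    ⟨⟩-*ˡ a u v = trans (sum-cong-≗ λ k → ℤ.*-assoc a (u k) (v k)) (sym (*-distribˡ-sum a λ k → u k * v k))

    ⟨⟩-+ʳ : ∀ u v v′ → ⟨ u , (λ k → v k + v′ k) ⟩ ≡ ⟨ u , v ⟩ + ⟨ u , v′ ⟩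
    ⟨⟩-+ʳ u v v′ = trans (⟨⟩-comm u _) (trans (⟨⟩-+ˡ v v′ u) (cong₂ _+_ (⟨⟩-comm v u) (⟨⟩-comm v′ u)))

    ⟨⟩-*ʳ : ∀ a u v → ⟨ u , (λ k → a * v k) ⟩ ≡ a * ⟨ u , v ⟩
    ⟨⟩-*ʳ a u v = trans (⟨⟩-comm u _) (trans (⟨⟩-*ˡ a v u) (cong (a *_) (⟨⟩-comm v u)))

    record IsLinear (A : V → V) : Set where
      field
        op-cong : ∀ {u v} → u ≗ v → A u ≗ A v
        op-+    : ∀ u v → A (λ k → u k + v k) ≗ λ k → A u k + A v k
        op-*    : ∀ a u → A (λ k → a * u k) ≗ λ k → a * A u k

    -- op is scale times an orthogonal projection.
    record ScaledProjection : Set where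
      field
        op        : V → V
        scale     : ℤ
        scale-pos : ℤ.Positive scale
        isLinear  : IsLinear op
        symmetric : ∀ u v → ⟨ op u , v ⟩ ≡ ⟨ u , op v ⟩
        op-op     : ∀ u → op (op u) ≗ λ k → scale * op u k
      open IsLinear isLinear public

    open ScaledProjection

    Commute : (V → V) → (V → V) → Set
    Commute A B = ∀ u → A (B u) ≗ B (A u)

    -- For the form (u , v) ↦ ⟨ Q u , v ⟩ the summands A v and h v - A v of h v are orthogonal.
    module _ (P : ScaledProjection) {Q : V → V} (Q-linear : IsLinear Q) (commute : Commute (op P) Q) (v : V) where

      private
        A = op P
        h = scale P
        v⊥ : V
        v⊥ k = h * v k + -1ℤ * A v k
        module Q = IsLinear Q-linear

      -- Symmetry moves the right-hand A to the left, commutation carries it past Q, and there it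
      -- meets the other A in A A = h A.
      form-image : ⟨ Q (A v) , A v ⟩ ≡ h * ⟨ Q (A v) , v ⟩
      form-image = begin
        ⟨ Q (A v) , A v ⟩              ≡⟨ symmetric P _ v ⟨
        ⟨ A (Q (A v)) , v ⟩            ≡⟨ ⟨⟩-cong (commute (A v)) (λ _ → refl) ⟩
        ⟨ Q (A (A v)) , v ⟩            ≡⟨ ⟨⟩-cong (λ k → trans (Q.op-cong (op-op P v) k) (Q.op-* h (A v) k)) (λ _ → refl) ⟩
        ⟨ (λ k → h * Q (A v) k) , v ⟩  ≡⟨ ⟨⟩-*ˡ h (Q (A v)) v ⟩
        h * ⟨ Q (A v) , v ⟩            ∎

      private
        form-mixed : ⟨ Q v , A v ⟩ ≡ ⟨ Q (A v) , v ⟩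
        form-mixed = trans (sym (symmetric P (Q v) v)) (⟨⟩-cong (commute v) (λ _ → refl))

        ⟨_,v⊥⟩ : ∀ u → ⟨ u , v⊥ ⟩ ≡ h * ⟨ u , v ⟩ + -1ℤ * ⟨ u , A v ⟩
        ⟨ u ,v⊥⟩ = trans (⟨⟩-+ʳ u (λ k → h * v k) (λ k → -1ℤ * A v k)) (cong₂ _+_ (⟨⟩-*ʳ h u v) (⟨⟩-*ʳ -1ℤ u (A v)))

        Qv⊥ : Q v⊥ ≗ λ k → h * Q v k + -1ℤ * Q (A v) k
        Qv⊥ k = trans (Q.op-+ (λ k → h * v k) (λ k → -1ℤ * A v k) k) (cong₂ _+_ (Q.op-* h v k) (Q.op-* -1ℤ (A v) k))

        expand : ∀ h a b → h * (h * a + -1ℤ * b) + -1ℤ * (h * b + -1ℤ * (h * b)) ≡ h * (h * a) - h * b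
        expand = solve-∀

      -- Pythagoras: the form at h v minus the form at A v, the latter rewritten by `form-image`.
      form-complement : ⟨ Q v⊥ , v⊥ ⟩ ≡ h * (h * ⟨ Q v , v ⟩) - h * ⟨ Q (A v) , v ⟩
      form-complement = begin
        ⟨ Q v⊥ , v⊥ ⟩
          ≡⟨ ⟨⟩-cong Qv⊥ (λ _ → refl) ⟩
        ⟨ (λ k → h * Q v k + -1ℤ * Q (A v) k) , v⊥ ⟩
          ≡⟨ ⟨⟩-+ˡ (λ k → h * Q v k) (λ k → -1ℤ * Q (A v) k) v⊥ ⟩
        ⟨ (λ k → h * Q v k) , v⊥ ⟩ + ⟨ (λ k → -1ℤ * Q (A v) k) , v⊥ ⟩
          ≡⟨ cong₂ _+_ (trans (⟨⟩-*ˡ h (Q v) v⊥) (cong (h *_) ⟨ Q v ,v⊥⟩))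
                       (trans (⟨⟩-*ˡ -1ℤ (Q (A v)) v⊥) (cong (-1ℤ *_) ⟨ Q (A v) ,v⊥⟩)) ⟩
        h * (h * ⟨ Q v , v ⟩ + -1ℤ * ⟨ Q v , A v ⟩) + -1ℤ * (h * ⟨ Q (A v) , v ⟩ + -1ℤ * ⟨ Q (A v) , A v ⟩)
          ≡⟨ cong₂ (λ a b → h * (h * ⟨ Q v , v ⟩ + -1ℤ * a) + -1ℤ * (h * ⟨ Q (A v) , v ⟩ + -1ℤ * b)) form-mixed form-image ⟩
        h * (h * ⟨ Q v , v ⟩ + -1ℤ * ⟨ Q (A v) , v ⟩) + -1ℤ * (h * ⟨ Q (A v) , v ⟩ + -1ℤ * (h * ⟨ Q (A v) , v ⟩))
          ≡⟨ expand h ⟨ Q v , v ⟩ ⟨ Q (A v) , v ⟩ ⟩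
        h * (h * ⟨ Q v , v ⟩) - h * ⟨ Q (A v) , v ⟩ ∎

-- Positivity of a leaf, for abstract projections and indicators.

module LeafPositivity where

  open CommutativeSemigroupProperties ℤ.+-commutativeSemigroup using () renaming (interchange to +-interchange)
  open CommutativeSemigroupProperties ℤ.*-commutativeSemigroup using (x∙yz≈y∙xz)
  open import Relation.Binary.PropositionalEquality using (refl; sym; trans)
  open import Algebra.Properties.Semiring.Sum ℤ.+-*-semiring
    using (∑-distrib-+; sum-cong-≗; *-distribˡ-sum)
  open import Data.Integer.Base using (_≤_; _+_; _*_; -_; _-_)
  open Coefficients
  open Statuses
  open DeletionContraction
  open Forms
  open ScaledProjection using (op; scale; scale-pos; isLinear)

  ∑-+ : ∀ {n} (σ : Vec Status n) f g → ∑[ σ ] (λ S → f S + g S) ≡ ∑[ σ ] f + ∑[ σ ] g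
  ∑-+ []               f g = refl
  ∑-+ (contracted ∷ σ) f g = ∑-+ σ _ _
  ∑-+ (deleted    ∷ σ) f g = ∑-+ σ _ _
  ∑-+ (undecided  ∷ σ) f g = trans (cong₂ _+_ (∑-+ σ _ _) (∑-+ σ _ _))
    (+-interchange (∑[ σ ] (f ∘ (inside ∷_))) (∑[ σ ] (g ∘ (inside ∷_))) (∑[ σ ] (f ∘ (outside ∷_))) (∑[ σ ] (g ∘ (outside ∷_))))
  ∑-+ (free       ∷ σ) f g = trans (cong₂ _+_ (∑-+ σ _ _) (∑-+ σ _ _))
    (+-interchange (∑[ σ ] (f ∘ (inside ∷_))) (∑[ σ ] (g ∘ (inside ∷_))) (∑[ σ ] (f ∘ (outside ∷_))) (∑[ σ ] (g ∘ (outside ∷_))))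
  ∑-+ (torsion    ∷ σ) f g = trans (cong₂ _+_ (∑-+ σ _ _) (∑-+ σ _ _))
    (+-interchange (∑[ σ ] (f ∘ (inside ∷_))) (∑[ σ ] (g ∘ (inside ∷_))) (∑[ σ ] (f ∘ (outside ∷_))) (∑[ σ ] (g ∘ (outside ∷_))))

  ∑-* : ∀ {n} (σ : Vec Status n) a f → ∑[ σ ] (λ S → a * f S) ≡ a * ∑[ σ ] f
  ∑-* []               a f = refl
  ∑-* (contracted ∷ σ) a f = ∑-* σ a _
  ∑-* (deleted    ∷ σ) a f = ∑-* σ a _
  ∑-* (undecided  ∷ σ) a f = trans (cong₂ _+_ (∑-* σ a _) (∑-* σ a _)) (sym (ℤ.*-distribˡ-+ a (∑[ σ ] (f ∘ (inside ∷_))) _))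
  ∑-* (free       ∷ σ) a f = trans (cong₂ _+_ (∑-* σ a _) (∑-* σ a _)) (sym (ℤ.*-distribˡ-+ a (∑[ σ ] (f ∘ (inside ∷_))) _))
  ∑-* (torsion    ∷ σ) a f = trans (cong₂ _+_ (∑-* σ a _) (∑-* σ a _)) (sym (ℤ.*-distribˡ-+ a (∑[ σ ] (f ∘ (inside ∷_))) _))

  module _ {N : ℕ} where

    private
      V : Set
      V = Fin N → ℤ

    -- The operator attached to S: the averages over the free elements outside S, each average over
    -- a free element inside S being replaced by its scale to keep the result integral.
    filter : ∀ {n} → Vec Status n → Subset n → (Fin n → ScaledProjection {N}) → V → V
    filter []         []            P v   = v
    filter (free ∷ σ) (inside  ∷ S) P v k = scale (P zero) * filter σ S (P ∘ suc) v k
    filter (free ∷ σ) (outside ∷ S) P v   = filter σ S (P ∘ suc) (op (P zero) v)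
    filter (_    ∷ σ) (_       ∷ S) P v   = filter σ S (P ∘ suc) v

    -- With κ t the indicator of the characters that vanish at t, this is the indicator of the
    -- characters that vanish on Y.
    weight : ∀ {n} → Vec Status n → Subset n → (Fin n → V) → V
    weight []            []           κ k = 1ℤ
    weight (torsion ∷ σ) (inside ∷ S) κ k = κ zero k * weight σ S (κ ∘ suc) k
    weight (_       ∷ σ) (_      ∷ S) κ   = weight σ S (κ ∘ suc)

    -- For v = δ and w = 1 this becomes D times the summand of S in the Tutte polynomial. Both
    -- vectors are left variable because the induction over positions changes them.
    leafTerm : ∀ {n} → Vec Status n → (Fin n → ScaledProjection {N}) → (Fin n → V) → V → V → ℕ → ℕ → Subset n → ℤ
    leafTerm σ P κ v w i j S =
      ⟨ w , weight σ S κ ⟩ * ⟨ filter σ S P v , v ⟩ * powerCoeff (freeOutside σ S) i * powerCoeff (torsionInside σ S) j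

    filter-linear : ∀ {n} (σ : Vec Status n) S P → IsLinear (filter σ S P)
    filter-linear [] [] P = record
      { op-cong = λ u≗v → u≗v ; op-+ = λ _ _ _ → refl ; op-* = λ _ _ _ → refl }
    filter-linear (free ∷ σ) (inside ∷ S) P = record
      { op-cong = λ u≗v k → cong (h *_) (op-cong u≗v k)
      ; op-+    = λ u v k → trans (cong (h *_) (op-+ u v k)) (ℤ.*-distribˡ-+ h (filter σ S (P ∘ suc) u k) _)
      ; op-*    = λ a u k → trans (cong (h *_) (op-* a u k)) (x∙yz≈y∙xz h a (filter σ S (P ∘ suc) u k))
      }
      where
      open IsLinear (filter-linear σ S (P ∘ suc))
      h = scale (P zero)
    filter-linear (free ∷ σ) (outside ∷ S) P = record
      { op-cong = λ u≗v → op-cong (IsLinear.op-cong (isLinear (P zero)) u≗v)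
      ; op-+    = λ u v k → trans (op-cong (IsLinear.op-+ (isLinear (P zero)) u v) k) (op-+ _ _ k)
      ; op-*    = λ a u k → trans (op-cong (IsLinear.op-* (isLinear (P zero)) a u) k) (op-* a _ k)
      }
      where open IsLinear (filter-linear σ S (P ∘ suc))
    filter-linear (undecided  ∷ σ) (_ ∷ S) P = filter-linear σ S (P ∘ suc)
    filter-linear (contracted ∷ σ) (_ ∷ S) P = filter-linear σ S (P ∘ suc)
    filter-linear (deleted    ∷ σ) (_ ∷ S) P = filter-linear σ S (P ∘ suc)
    filter-linear (torsion    ∷ σ) (_ ∷ S) P = filter-linear σ S (P ∘ suc)

    filter-commute : ∀ {n} (σ : Vec Status n) S P (B : ScaledProjection) →
      (∀ f → Commute (op B) (op (P f))) → Commute (op B) (filter σ S P)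
    filter-commute [] [] P B comm u k = refl
    filter-commute (free ∷ σ) (inside ∷ S) P B comm u k =
      trans (IsLinear.op-* (isLinear B) (scale (P zero)) (filter σ S (P ∘ suc) u) k)
            (cong (scale (P zero) *_) (filter-commute σ S (P ∘ suc) B (comm ∘ suc) u k))
    filter-commute (free ∷ σ) (outside ∷ S) P B comm u k =
      trans (filter-commute σ S (P ∘ suc) B (comm ∘ suc) (op (P zero) u) k)
            (IsLinear.op-cong (filter-linear σ S (P ∘ suc)) (comm zero u) k)
    filter-commute (undecided  ∷ σ) (_ ∷ S) P B comm = filter-commute σ S (P ∘ suc) B (comm ∘ suc)
    filter-commute (contracted ∷ σ) (_ ∷ S) P B comm = filter-commute σ S (P ∘ suc) B (comm ∘ suc)
    filter-commute (deleted    ∷ σ) (_ ∷ S) P B comm = filter-commute σ S (P ∘ suc) B (comm ∘ suc)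
    filter-commute (torsion    ∷ σ) (_ ∷ S) P B comm = filter-commute σ S (P ∘ suc) B (comm ∘ suc)

    private
      free-zero : ∀ h W q q′ c d →
        h * (W * (h * q) * c * d + W * q′ * (- c) * d) ≡ W * (h * (h * q) - h * q′) * c * d
      free-zero = solve-∀

      free-suc : ∀ h W q q′ c c′ d →
        h * (W * (h * q) * c′ * d + W * q′ * (c - c′) * d) ≡ W * (h * (h * q) - h * q′) * c′ * d + W * (h * q′) * c * d
      free-suc = solve-∀

      torsion-zero : ∀ W W′ q c d → W′ * q * c * (- d) + W * q * c * d ≡ (W + -1ℤ * W′) * q * c * d
      torsion-zero = solve-∀

      torsion-suc : ∀ W W′ q c d d′ →
        W′ * q * c * (d - d′) + W * q * c * d′ ≡ (W + -1ℤ * W′) * q * c * d′ + W′ * q * c * d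
      torsion-suc = solve-∀

    -- A torsion position contributes 1 + (y - 1) κ = (1 - κ) + y κ, which splits w into two
    -- non-negative weights. A free position contributes the form at v of h Q + (x - 1) Q A; times
    -- h, this is the form of Q at h v - A v plus x times its form at A v. In both cases two sums of
    -- the same shape with one position fewer remain.
    leafTerm-∑-nonneg : ∀ {n} (σ : Vec Status n) P κ →
      (∀ f g → Commute (op (P f)) (op (P g))) →
      (∀ t k → 0ℤ ≤ κ t k) → (∀ t k → 0ℤ ≤ 1ℤ + -1ℤ * κ t k) →
      ∀ v w → (∀ k → 0ℤ ≤ w k) → ∀ i j → 0ℤ ≤ ∑[ σ ] (leafTerm σ P κ v w i j)
    leafTerm-∑-nonneg [] P κ comm κ≥0 κ≤1 v w w≥0 i j =
      -- With no position left, the form is the squared length of v and the weight is the total of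
      -- w.
      *-nonneg (*-nonneg (*-nonneg
        (sum-nonneg (λ k → w k * 1ℤ) λ k → *-nonneg (w≥0 k) (ℤ.+≤+ ℕ.z≤n))
        (sum-nonneg (λ k → v k * v k) λ k → square-nonneg (v k)))
        (powerCoeff-zero i)) (powerCoeff-zero j)
      where
      powerCoeff-zero : ∀ i → 0ℤ ≤ powerCoeff 0 i
      powerCoeff-zero zero    = ℤ.+≤+ ℕ.z≤n
      powerCoeff-zero (suc i) = ℤ.≤-refl
    leafTerm-∑-nonneg (undecided ∷ σ) P κ comm κ≥0 κ≤1 v w w≥0 i j = ℤ.+-mono-≤ ih ih
      where ih = leafTerm-∑-nonneg σ (P ∘ suc) (κ ∘ suc) (λ f g → comm (suc f) (suc g)) (κ≥0 ∘ suc) (κ≤1 ∘ suc) v w w≥0 i j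
    leafTerm-∑-nonneg (contracted ∷ σ) P κ comm κ≥0 κ≤1 v w w≥0 i j =
      leafTerm-∑-nonneg σ (P ∘ suc) (κ ∘ suc) (λ f g → comm (suc f) (suc g)) (κ≥0 ∘ suc) (κ≤1 ∘ suc) v w w≥0 i j
    leafTerm-∑-nonneg (deleted ∷ σ) P κ comm κ≥0 κ≤1 v w w≥0 i j =
      leafTerm-∑-nonneg σ (P ∘ suc) (κ ∘ suc) (λ f g → comm (suc f) (suc g)) (κ≥0 ∘ suc) (κ≤1 ∘ suc) v w w≥0 i j
    leafTerm-∑-nonneg {suc n} (free ∷ σ) P κ comm κ≥0 κ≤1 v w w≥0 i j =
      -- The orthogonal splitting is integral only for h v, whose form is h² times that of v. One
      -- factor h comes from `filter` or from A A = h A; the other is supplied here.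
      ℤ.*-cancelˡ-≤-pos 0ℤ _ h {{scale-pos (P zero)}} (subst (_≤ h * (∑[ σ ] (T ∘ (inside ∷_)) + ∑[ σ ] (T ∘ (outside ∷_))))
        (sym (ℤ.*-zeroʳ h)) (go i))
      where
      h = scale (P zero)
      A = op (P zero)
      v⊥ : V
      v⊥ k = h * v k + -1ℤ * A v k
      T = leafTerm (free ∷ σ) P κ v w i j
      ih = λ u → leafTerm-∑-nonneg σ (P ∘ suc) (κ ∘ suc) (λ f g → comm (suc f) (suc g)) (κ≥0 ∘ suc) (κ≤1 ∘ suc) u w w≥0
      U : V → ℕ → Subset n → ℤ
      U u i = leafTerm σ (P ∘ suc) (κ ∘ suc) u w i j

      factor : ∀ i → h * (∑[ σ ] (leafTerm (free ∷ σ) P κ v w i j ∘ (inside ∷_)) + ∑[ σ ] (leafTerm (free ∷ σ) P κ v w i j ∘ (outside ∷_)))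
        ≡ ∑[ σ ] (λ S → h * (leafTerm (free ∷ σ) P κ v w i j (inside ∷ S) + leafTerm (free ∷ σ) P κ v w i j (outside ∷ S)))
      factor i = trans (cong (h *_) (sym (∑-+ σ (leafTerm (free ∷ σ) P κ v w i j ∘ (inside ∷_)) _))) (sym (∑-* σ h _))

      module _ (S : Subset n) where
        W = ⟨ w , weight σ S (κ ∘ suc) ⟩
        Q = filter σ S (P ∘ suc)
        Q-linear = filter-linear σ S (P ∘ suc)
        commute = filter-commute σ S (P ∘ suc) (P zero) (comm zero ∘ suc)
        b = freeOutside σ S
        d = powerCoeff (torsionInside σ S) j
        scaled : ⟨ (λ k → h * Q v k) , v ⟩ ≡ h * ⟨ Q v , v ⟩
        scaled = ⟨⟩-*ˡ h (Q v) v

        pointwise-zero : h * (leafTerm (free ∷ σ) P κ v w 0 j (inside ∷ S) + leafTerm (free ∷ σ) P κ v w 0 j (outside ∷ S)) ≡ U v⊥ 0 S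
        pointwise-zero = begin
          h * (W * ⟨ (λ k → h * Q v k) , v ⟩ * powerCoeff b 0 * d + W * ⟨ Q (A v) , v ⟩ * (- powerCoeff b 0) * d)
            ≡⟨ cong (λ q → h * (W * q * powerCoeff b 0 * d + W * ⟨ Q (A v) , v ⟩ * (- powerCoeff b 0) * d)) scaled ⟩
          h * (W * (h * ⟨ Q v , v ⟩) * powerCoeff b 0 * d + W * ⟨ Q (A v) , v ⟩ * (- powerCoeff b 0) * d)
            ≡⟨ free-zero h W ⟨ Q v , v ⟩ ⟨ Q (A v) , v ⟩ (powerCoeff b 0) d ⟩
          W * (h * (h * ⟨ Q v , v ⟩) - h * ⟨ Q (A v) , v ⟩) * powerCoeff b 0 * d
            ≡⟨ cong (λ q → W * q * powerCoeff b 0 * d) (form-complement (P zero) Q-linear commute v) ⟨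
          W * ⟨ Q v⊥ , v⊥ ⟩ * powerCoeff b 0 * d ∎
          where open ≡-Reasoning

        pointwise-suc : ∀ i → h * (leafTerm (free ∷ σ) P κ v w (suc i) j (inside ∷ S) + leafTerm (free ∷ σ) P κ v w (suc i) j (outside ∷ S))
          ≡ U v⊥ (suc i) S + U (A v) i S
        pointwise-suc i = begin
          h * (W * ⟨ (λ k → h * Q v k) , v ⟩ * c′ * d + W * ⟨ Q (A v) , v ⟩ * (c - c′) * d)
            ≡⟨ cong (λ q → h * (W * q * c′ * d + W * ⟨ Q (A v) , v ⟩ * (c - c′) * d)) scaled ⟩
          h * (W * (h * ⟨ Q v , v ⟩) * c′ * d + W * ⟨ Q (A v) , v ⟩ * (c - c′) * d)
            ≡⟨ free-suc h W ⟨ Q v , v ⟩ ⟨ Q (A v) , v ⟩ c c′ d ⟩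
          W * (h * (h * ⟨ Q v , v ⟩) - h * ⟨ Q (A v) , v ⟩) * c′ * d + W * (h * ⟨ Q (A v) , v ⟩) * c * d
            ≡⟨ cong₂ (λ q q′ → W * q * c′ * d + W * q′ * c * d)
                 (form-complement (P zero) Q-linear commute v) (form-image (P zero) Q-linear commute v) ⟨
          W * ⟨ Q v⊥ , v⊥ ⟩ * c′ * d + W * ⟨ Q (A v) , A v ⟩ * c * d ∎
          where
          open ≡-Reasoning
          c  = powerCoeff b i
          c′ = powerCoeff b (suc i)

      go : ∀ i → 0ℤ ≤ h * (∑[ σ ] (leafTerm (free ∷ σ) P κ v w i j ∘ (inside ∷_)) + ∑[ σ ] (leafTerm (free ∷ σ) P κ v w i j ∘ (outside ∷_)))
      go zero    = subst (0ℤ ≤_) (sym (trans (factor 0) (∑-cong σ pointwise-zero))) (ih v⊥ 0 j)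
      go (suc i) = subst (0ℤ ≤_)
        (sym (trans (factor (suc i)) (trans (∑-cong σ λ S → pointwise-suc S i) (∑-+ σ (U v⊥ (suc i)) (U (A v) i)))))
        (ℤ.+-mono-≤ (ih v⊥ (suc i) j) (ih (A v) i j))
    leafTerm-∑-nonneg {suc n} (torsion ∷ σ) P κ comm κ≥0 κ≤1 v w w≥0 i j = go j
      where
      κ₀ = κ zero
      w′ w⊥ : V
      w′ k = w k * κ₀ k
      w⊥ k = w k * (1ℤ + -1ℤ * κ₀ k)
      ih = λ u u≥0 → leafTerm-∑-nonneg σ (P ∘ suc) (κ ∘ suc) (λ f g → comm (suc f) (suc g)) (κ≥0 ∘ suc) (κ≤1 ∘ suc) v u u≥0 i
      ih′ = ih w′ (λ k → *-nonneg (w≥0 k) (κ≥0 zero k))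
      ih⊥ = ih w⊥ (λ k → *-nonneg (w≥0 k) (κ≤1 zero k))
      U : V → ℕ → Subset n → ℤ
      U u j = leafTerm σ (P ∘ suc) (κ ∘ suc) v u i j

      module _ (S : Subset n) where
        ω = weight σ S (κ ∘ suc)
        q = ⟨ filter σ S (P ∘ suc) v , v ⟩
        c = powerCoeff (freeOutside σ S) i
        b = torsionInside σ S

        inside-weight : ⟨ w , (λ k → κ₀ k * ω k) ⟩ ≡ ⟨ w′ , ω ⟩
        inside-weight = sum-cong-≗ λ k → sym (ℤ.*-assoc (w k) (κ₀ k) (ω k))

        complement-weight : ⟨ w⊥ , ω ⟩ ≡ ⟨ w , ω ⟩ + -1ℤ * ⟨ w′ , ω ⟩
        complement-weight = trans (sum-cong-≗ λ k → expand (w k) (κ₀ k) (ω k))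
          (trans (∑-distrib-+ (λ k → w k * ω k) (λ k → -1ℤ * (w′ k * ω k)))
                 (cong (⟨ w , ω ⟩ +_) (sym (*-distribˡ-sum -1ℤ λ k → w′ k * ω k))))
          where
          expand : ∀ a b c → a * (1ℤ + -1ℤ * b) * c ≡ a * c + -1ℤ * (a * b * c)
          expand = solve-∀

        pointwise-zero : leafTerm (torsion ∷ σ) P κ v w i 0 (inside ∷ S) + leafTerm (torsion ∷ σ) P κ v w i 0 (outside ∷ S) ≡ U w⊥ 0 S
        pointwise-zero = begin
          ⟨ w , (λ k → κ₀ k * ω k) ⟩ * q * c * (- powerCoeff b 0) + ⟨ w , ω ⟩ * q * c * powerCoeff b 0
            ≡⟨ cong (λ W → W * q * c * (- powerCoeff b 0) + ⟨ w , ω ⟩ * q * c * powerCoeff b 0) inside-weight ⟩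
          ⟨ w′ , ω ⟩ * q * c * (- powerCoeff b 0) + ⟨ w , ω ⟩ * q * c * powerCoeff b 0
            ≡⟨ torsion-zero ⟨ w , ω ⟩ ⟨ w′ , ω ⟩ q c (powerCoeff b 0) ⟩
          (⟨ w , ω ⟩ + -1ℤ * ⟨ w′ , ω ⟩) * q * c * powerCoeff b 0
            ≡⟨ cong (λ W → W * q * c * powerCoeff b 0) complement-weight ⟨
          ⟨ w⊥ , ω ⟩ * q * c * powerCoeff b 0 ∎
          where open ≡-Reasoning

        pointwise-suc : ∀ j → leafTerm (torsion ∷ σ) P κ v w i (suc j) (inside ∷ S) + leafTerm (torsion ∷ σ) P κ v w i (suc j) (outside ∷ S)
          ≡ U w⊥ (suc j) S + U w′ j S
        pointwise-suc j = begin
          ⟨ w , (λ k → κ₀ k * ω k) ⟩ * q * c * (d - d′) + ⟨ w , ω ⟩ * q * c * d′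
            ≡⟨ cong (λ W → W * q * c * (d - d′) + ⟨ w , ω ⟩ * q * c * d′) inside-weight ⟩
          ⟨ w′ , ω ⟩ * q * c * (d - d′) + ⟨ w , ω ⟩ * q * c * d′
            ≡⟨ torsion-suc ⟨ w , ω ⟩ ⟨ w′ , ω ⟩ q c d d′ ⟩
          (⟨ w , ω ⟩ + -1ℤ * ⟨ w′ , ω ⟩) * q * c * d′ + ⟨ w′ , ω ⟩ * q * c * d
            ≡⟨ cong (λ W → W * q * c * d′ + ⟨ w′ , ω ⟩ * q * c * d) complement-weight ⟨
          ⟨ w⊥ , ω ⟩ * q * c * d′ + ⟨ w′ , ω ⟩ * q * c * d ∎
          where
          open ≡-Reasoning
          d  = powerCoeff b j
          d′ = powerCoeff b (suc j)

      go : ∀ j → 0ℤ ≤ ∑[ torsion ∷ σ ] (leafTerm (torsion ∷ σ) P κ v w i j)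
      go zero    = subst (0ℤ ≤_)
        (sym (trans (sym (∑-+ σ (leafTerm (torsion ∷ σ) P κ v w i 0 ∘ (inside ∷_)) _)) (∑-cong σ pointwise-zero))) (ih⊥ 0)
      go (suc j) = subst (0ℤ ≤_)
        (sym (trans (sym (∑-+ σ (leafTerm (torsion ∷ σ) P κ v w i (suc j) ∘ (inside ∷_)) _))
             (trans (∑-cong σ λ S → pointwise-suc S j) (∑-+ σ (U w⊥ (suc j)) (U w′ j)))))
        (ℤ.+-mono-≤ (ih⊥ (suc j)) (ih′ j))

-- Integer multiples in an abelian group.

module Multiples {c ℓ : Level} (Γ : AbelianGroup c ℓ) where

  open AbelianGroup Γ
  open AbelianGroupProperties Γ public using (ε⁻¹≈ε; ⁻¹-∙-comm; ⁻¹-involutive; inverseˡ-unique; inverseʳ-unique; x∙y⁻¹≈ε⇒x≈y)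
  open CommutativeMonoidMult commutativeMonoid public
    using (×-congʳ; ×-congˡ; ×-assocˡ; ×-distrib-+; ×-homo-+; ×-homo-1)
  open CommutativeSemigroupProperties commutativeSemigroup public using (interchange)
  open CommutativeMonoidSum commutativeMonoid public using (sum; ∑-distrib-+; sum-cong-≋; sum-remove)
  open RawMonoidDefinitions rawMonoid public using () renaming (_×_ to infixr 8 _×ᴳ_)
  open import Relation.Binary.Reasoning.Setoid setoid

  infixr 8 _•_
  _•_ : ℤ → Carrier → Carrier
  _•_ = _·_ Γ

  ×-ε : ∀ n → n ×ᴳ ε ≈ ε
  ×-ε zero    = refl
  ×-ε (suc n) = trans (identityˡ _) (×-ε n)

  ×-⁻¹ : ∀ n x → n ×ᴳ (x ⁻¹) ≈ (n ×ᴳ x) ⁻¹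
  ×-⁻¹ n x = inverseˡ-unique _ _ (begin
    n ×ᴳ (x ⁻¹) ∙ n ×ᴳ x  ≈⟨ ×-distrib-+ (x ⁻¹) x n ⟨
    n ×ᴳ (x ⁻¹ ∙ x)       ≈⟨ ×-congʳ n (inverseˡ x) ⟩
    n ×ᴳ ε                ≈⟨ ×-ε n ⟩
    ε                     ∎)

  •-congʳ : ∀ n {x y} → x ≈ y → n • x ≈ n • y
  •-congʳ (ℤ.+ n)    x≈y = ×-congʳ n x≈y
  •-congʳ ℤ.-[1+ n ] x≈y = ⁻¹-cong (×-congʳ (suc n) x≈y)

  •-congˡ : ∀ {m n} x → m ≡ n → m • x ≈ n • x
  •-congˡ x ≡.refl = refl

  1-• : ∀ x → 1ℤ • x ≈ x
  1-• = ×-homo-1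

  •-distrib-∙ : ∀ n x y → n • (x ∙ y) ≈ n • x ∙ n • y
  •-distrib-∙ (ℤ.+ n)    x y = ×-distrib-+ x y n
  •-distrib-∙ ℤ.-[1+ n ] x y = trans (⁻¹-cong (×-distrib-+ x y (suc n))) (sym (⁻¹-∙-comm _ _))

  -‿• : ∀ n x → (ℤ.- n) • x ≈ (n • x) ⁻¹
  -‿• (ℤ.+ zero)  x = sym ε⁻¹≈ε
  -‿• (ℤ.+ suc n) x = refl
  -‿• ℤ.-[1+ n ]  x = sym (⁻¹-involutive _)

  private
    ⊖-• : ∀ m n x → (m ℤ.⊖ n) • x ≈ m ×ᴳ x ∙ (n ×ᴳ x) ⁻¹
    ⊖-• zero    zero    x = sym (inverseʳ ε)
    ⊖-• zero    (suc n) x = sym (identityˡ _)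
    ⊖-• (suc m) zero    x = sym (trans (∙-congˡ ε⁻¹≈ε) (identityʳ _))
    ⊖-• (suc m) (suc n) x = begin
      (suc m ℤ.⊖ suc n) • x                       ≈⟨ •-congˡ x (ℤ.[1+m]⊖[1+n]≡m⊖n m n) ⟩
      (m ℤ.⊖ n) • x                               ≈⟨ ⊖-• m n x ⟩
      m ×ᴳ x ∙ (n ×ᴳ x) ⁻¹                        ≈⟨ identityˡ _ ⟨
      ε ∙ (m ×ᴳ x ∙ (n ×ᴳ x) ⁻¹)                  ≈⟨ ∙-congʳ (inverseʳ x) ⟨
      (x ∙ x ⁻¹) ∙ (m ×ᴳ x ∙ (n ×ᴳ x) ⁻¹)         ≈⟨ interchange _ _ _ _ ⟩
      (x ∙ m ×ᴳ x) ∙ (x ⁻¹ ∙ (n ×ᴳ x) ⁻¹)         ≈⟨ ∙-congˡ (⁻¹-∙-comm x _) ⟩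
      (x ∙ m ×ᴳ x) ∙ (x ∙ n ×ᴳ x) ⁻¹              ∎

  •-homo-+ : ∀ m n x → (m ℤ.+ n) • x ≈ m • x ∙ n • x
  •-homo-+ (ℤ.+ m)    (ℤ.+ n)    x = ×-homo-+ x m n
  •-homo-+ (ℤ.+ m)    ℤ.-[1+ n ] x = ⊖-• m (suc n) x
  •-homo-+ ℤ.-[1+ m ] (ℤ.+ n)    x = trans (⊖-• n (suc m) x) (comm _ _)
  •-homo-+ ℤ.-[1+ m ] ℤ.-[1+ n ] x = trans
    (⁻¹-cong (trans (×-congˡ (cong suc (≡.sym (ℕ.+-suc m n)))) (×-homo-+ x (suc m) (suc n)))) (sym (⁻¹-∙-comm _ _))

  •-assoc : ∀ m n x → (m ℤ.* n) • x ≈ m • (n • x)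
  •-assoc (ℤ.+ m)    n x = nonneg m
    where
    nonneg : ∀ m → ((ℤ.+ m) ℤ.* n) • x ≈ m ×ᴳ (n • x)
    nonneg zero    = •-congˡ x (ℤ.*-zeroˡ n)
    nonneg (suc m) = trans (•-congˡ x (ℤ.suc-* (ℤ.+ m) n))
      (trans (•-homo-+ n ((ℤ.+ m) ℤ.* n) x) (∙-congˡ (nonneg m)))
  •-assoc ℤ.-[1+ m ] n x = begin
    (ℤ.-[1+ m ] ℤ.* n) • x       ≈⟨ •-congˡ x (≡.sym (ℤ.neg-distribˡ-* (ℤ.+ suc m) n)) ⟩
    (ℤ.- (ℤ.+ suc m ℤ.* n)) • x  ≈⟨ -‿• (ℤ.+ suc m ℤ.* n) x ⟩
    ((ℤ.+ suc m ℤ.* n) • x) ⁻¹   ≈⟨ ⁻¹-cong (•-assoc (ℤ.+ suc m) n x) ⟩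
    (suc m ×ᴳ (n • x)) ⁻¹        ∎

  sum-• : ∀ {n} (k : Fin n → ℤ) x →
    sum (λ i → k i • x) ≈ Vector.foldr ℤ._+_ 0ℤ k • x
  sum-• {zero}  k x = refl
  sum-• {suc n} k x = trans (∙-congˡ (sum-• (k ∘ suc) x)) (sym (•-homo-+ (k zero) _ x))

  module Closure {p} {P : Carrier → Set p} (isSubgroup : IsSubgroup Γ P) where

    open IsSubgroup isSubgroup

    ×-closed : ∀ n {x} → P x → P (n ×ᴳ x)
    ×-closed zero    Px = ε-closed
    ×-closed (suc n) Px = ∙-closed Px (×-closed n Px)

    •-closed : ∀ n {x} → P x → P (n • x)
    •-closed (ℤ.+ n)    Px = ×-closed n Px
    •-closed ℤ.-[1+ n ] Px = ⁻¹-closed (×-closed (suc n) Px)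

    module _ (P-resp : ∀ {x y} → x ≈ y → P x → P y) where

      ∣∣-closed : ∀ n {x} → P (n • x) → P (ℤ.∣ n ∣ ×ᴳ x)
      ∣∣-closed (ℤ.+ n)    Px = Px
      ∣∣-closed ℤ.-[1+ n ] Px = P-resp (⁻¹-involutive _) (⁻¹-closed Px)

      cancelʳ : ∀ {x y} → P y → P (x ∙ y) → P x
      cancelʳ {x} {y} Py Pxy = P-resp
        (trans (assoc x y _) (trans (∙-congˡ (inverseʳ y)) (identityʳ x))) (∙-closed Pxy (⁻¹-closed Py))

      cancelˡ : ∀ {x y} → P x → P (x ∙ y) → P y
      cancelˡ {x} {y} Px Pxy = cancelʳ Px (P-resp (comm x y) Pxy)

      generated-minimal : ∀ {q} {Q : Carrier → Set q} → (∀ {x} → Q x → P x) → ∀ {x} → Generated Γ Q x → P x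
      generated-minimal Q⊆P (gen Qx)      = Q⊆P Qx
      generated-minimal Q⊆P unit          = ε-closed
      generated-minimal Q⊆P (mult u v)    = ∙-closed (generated-minimal Q⊆P u) (generated-minimal Q⊆P v)
      generated-minimal Q⊆P (inv u)       = ⁻¹-closed (generated-minimal Q⊆P u)
      generated-minimal Q⊆P (resp x≈y u)  = P-resp x≈y (generated-minimal Q⊆P u)

-- Spans, saturations and independence of sublists.

module Spans {c ℓ : Level} (Γ : AbelianGroup c ℓ) (𝒜 : List (AbelianGroup.Carrier Γ)) where

  open AbelianGroup Γ
  open Multiples Γ
  open Subsets
  open import Relation.Binary.Reasoning.Setoid setoid

  el : Fin (length 𝒜) → Carrier
  el = List.lookup 𝒜

  -- `Sat S` is the preimage in Γ of (Γ/⟨S⟩)_tor. Working with it keeps the torsion groups of all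
  -- the quotients inside one ambient group.
  Span Sat : Subset (length 𝒜) → Carrier → Set _
  Span S = Generated Γ (Entry Γ 𝒜 S)
  Sat S x = ∃ λ d → 0 ℕ.< d × Span S (d ×ᴳ x)

  span-isSubgroup : ∀ S → IsSubgroup Γ (Span S)
  span-isSubgroup S = generated-isSubgroup Γ (Entry Γ 𝒜 S)

  module _ {S : Subset (length 𝒜)} where
    open Closure (span-isSubgroup S) public using () renaming (×-closed to span-×; •-closed to span-•)

    span-el : ∀ {i} → i ∈ S → Span S (el i)
    span-el i∈S = gen (_ , i∈S , ≡.refl)

  span-minimal : ∀ {p} {P : Carrier → Set p} → IsSubgroup Γ P → (∀ {x y} → x ≈ y → P x → P y) →
    ∀ {S x} → (∀ i → i ∈ S → P (el i)) → Span S x → P x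
  span-minimal isSubgroup P-resp el∈P =
    Closure.generated-minimal isSubgroup P-resp λ { (i , i∈S , ≡.refl) → el∈P i i∈S }

  span-mono : ∀ {S S′} → S ⊆ S′ → ∀ {x} → Span S x → Span S′ x
  span-mono {S′ = S′} S⊆S′ = span-minimal (span-isSubgroup S′) resp λ i i∈S → span-el (S⊆S′ i∈S)

  -- The hypothesis is a covering of S′ by i and S, so that it applies both to passing from
  -- `add i S` to S and from U to `drop i U`.
  span-split : ∀ {S S′ i} → (∀ {j} → j ∈ S′ → j ≡ i ⊎ j ∈ S) → ∀ {x} → Span S′ x →
    ∃₂ λ n u → Span S u × x ≈ u ∙ n • el i
  span-split {i = i} split (gen (j , j∈S′ , ≡.refl)) with split j∈S′
  ... | inj₁ ≡.refl = 1ℤ , ε , unit , sym (trans (identityˡ _) (1-• (el i)))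
  ... | inj₂ j∈S    = 0ℤ , el j , span-el j∈S , sym (identityʳ _)
  span-split split unit = 0ℤ , ε , unit , sym (identityʳ ε)
  span-split {i = i} split (mult x∈ y∈) with span-split split x∈ | span-split split y∈
  ... | m , u , u∈ , x≈ | n , v , v∈ , y≈ = m ℤ.+ n , u ∙ v , mult u∈ v∈ ,
    trans (∙-cong x≈ y≈) (trans (interchange u _ v _) (∙-congˡ (sym (•-homo-+ m n (el i)))))
  span-split {i = i} split (inv x∈) with span-split split x∈
  ... | n , u , u∈ , x≈ = ℤ.- n , u ⁻¹ , inv u∈ ,
    trans (⁻¹-cong x≈) (trans (sym (⁻¹-∙-comm u _)) (∙-congˡ (sym (-‿• n (el i)))))
  span-split split (resp x≈y x∈) with span-split split x∈
  ... | n , u , u∈ , x≈ = n , u , u∈ , trans (sym x≈y) x≈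

  span⊆sat : ∀ {S x} → Span S x → Sat S x
  span⊆sat {x = x} x∈ = 1 , ℕ.z<s , resp (sym (×-homo-1 x)) x∈

  sat-mono : ∀ {S S′} → S ⊆ S′ → ∀ {x} → Sat S x → Sat S′ x
  sat-mono S⊆S′ (d , d>0 , dx∈) = d , d>0 , span-mono S⊆S′ dx∈

  sat-resp : ∀ {S x y} → x ≈ y → Sat S x → Sat S y
  sat-resp x≈y (d , d>0 , dx∈) = d , d>0 , resp (×-congʳ d x≈y) dx∈

  sat-isSubgroup : ∀ S → IsSubgroup Γ (Sat S)
  sat-isSubgroup S = record
    { ε-closed  = span⊆sat unit
    ; ∙-closed  = λ { {x} {y} (d , d>0 , dx∈) (e , e>0 , ey∈) → d ℕ.* e , ℕ.*-mono-< d>0 e>0 ,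
        resp (sym (×-distrib-+ x y (d ℕ.* e))) (mult
          (resp (trans (×-assocˡ x e d) (×-congˡ (ℕ.*-comm e d))) (span-× e dx∈))
          (resp (×-assocˡ y d e) (span-× d ey∈))) }
    ; ⁻¹-closed = λ { {x} (d , d>0 , dx∈) → d , d>0 , resp (sym (×-⁻¹ d x)) (inv dx∈) }
    }

  sat-× : ∀ {S d x} → 0 ℕ.< d → Sat S (d ×ᴳ x) → Sat S x
  sat-× {d = d} {x} d>0 (e , e>0 , edx∈) = e ℕ.* d , ℕ.*-mono-< e>0 d>0 , resp (×-assocˡ x e d) edx∈

  sat-• : ∀ {S n x} → n ≢ 0ℤ → Sat S (n • x) → Sat S x
  sat-• {S} {n} n≢0 nx∈ = sat-× (ℕ.n≢0⇒n>0 (n≢0 ∘ ℤ.∣i∣≡0⇒i≡0))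
    (Closure.∣∣-closed (sat-isSubgroup S) sat-resp n nx∈)

  sat-closed : ∀ {S S′} → (∀ i → i ∈ S′ → Sat S (el i)) → ∀ {x} → Sat S′ x → Sat S x
  sat-closed {S} el∈ (d , d>0 , dx∈) = sat-× d>0 (span-minimal (sat-isSubgroup S) sat-resp el∈ dx∈)

  Independent : Subset (length 𝒜) → Set _
  Independent B = ∀ i → i ∈ B → ¬ Sat (drop i B) (el i)

  -- The coefficient of x at an element i of I outside J must vanish: otherwise a non-zero multiple
  -- of `el i` would be torsion over the rest of B, since x is. So the elements of I outside J can
  -- be removed one by one.
  independent-∩ : ∀ {B} → Independent B → ∀ {I J} → I ⊆ B → J ⊆ B →
    ∀ {x} → Span I x → Sat J x → Span (I ∩ J) x
  independent-∩ {B} indep {I} {J} I⊆B J⊆B {x} x∈I x∈J =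
    shrink (λ U → Span U x) (Subset.p∩q⊆p I J) step x∈I
    where
    step : ∀ U i → I ∩ J ⊆ U → U ⊆ I → i ∈ U → i ∉ I ∩ J → Span U x → Span (drop i U) x
    step U i _ U⊆I i∈U i∉I∩J x∈U with span-split split x∈U
      where
      split : ∀ {j} → j ∈ U → j ≡ i ⊎ j ∈ drop i U
      split {j} j∈U with j Fin.≟ i
      ... | yes j≡i = inj₁ j≡i
      ... | no  j≢i = inj₂ (∈-drop⁺ j≢i j∈U)
    ... | n , u , u∈ , x≈ with n ℤ.≟ 0ℤ
    ...   | yes ≡.refl = resp (sym (trans x≈ (identityʳ u))) u∈
    ...   | no  n≢0    = contradiction
      (sat-• n≢0 (Closure.cancelˡ (sat-isSubgroup (drop i B)) sat-resp
        (span⊆sat (span-mono (λ j∈ → let j≢i , j∈U = ∈-drop⁻ j∈ in ∈-drop⁺ j≢i (I⊆B (U⊆I j∈U))) u∈))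
        (sat-resp x≈ (sat-mono (λ j∈J → ∈-drop⁺ (λ { ≡.refl → i∉I∩J (Subset.x∈p∩q⁺ (U⊆I i∈U , j∈J)) }) (J⊆B j∈J)) x∈J))))
      (indep i (I⊆B (U⊆I i∈U)))

-- The rank of the spans is a matroid rank function.

module Ranks {c ℓ : Level} (Γ : AbelianGroup c ℓ) (𝒜 : List (AbelianGroup.Carrier Γ)) where

  open AbelianGroup Γ
  open Multiples Γ
  open Spans Γ 𝒜
  open Subsets
  open Matroids
  open import Relation.Binary.Reasoning.Setoid setoid

  module _ {p} {P : Carrier → Set p} (isSubgroup : IsSubgroup Γ P) where

    private
      H = subgroup Γ isSubgroup
      module H = AbelianGroup H
      open RawMonoidDefinitions H.rawMonoid using () renaming (_×_ to _×ᴴ_; sum to sumᴴ)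

      proj₁-× : ∀ n x → proj₁ (n ×ᴴ x) ≡ n ×ᴳ proj₁ x
      proj₁-× zero    x = ≡.refl
      proj₁-× (suc n) x = cong (proj₁ x ∙_) (proj₁-× n x)

      proj₁-• : ∀ n x → proj₁ (_·_ H n x) ≡ n • proj₁ x
      proj₁-• (ℤ.+ n)    x = proj₁-× n x
      proj₁-• ℤ.-[1+ n ] x = cong _⁻¹ (proj₁-× (suc n) x)

      proj₁-sum : ∀ {n} (k : Fin n → ℤ) (v : Fin n → H.Carrier) →
        proj₁ (sumᴴ λ i → _·_ H (k i) (v i)) ≡ sum λ i → k i • proj₁ (v i)
      proj₁-sum {zero}  k v = ≡.refl
      proj₁-sum {suc n} k v = cong₂ _∙_ (proj₁-• (k zero) (v zero)) (proj₁-sum (k ∘ suc) (v ∘ suc))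

    subgroup-independent⁺ : ∀ {n} {v : Fin n → H.Carrier} → LinearlyIndependent Γ (proj₁ ∘ v) → LinearlyIndependent H v
    subgroup-independent⁺ indep k eq = indep k (trans (reflexive (≡.sym (proj₁-sum k _))) eq)

    subgroup-independent⁻ : ∀ {n} {v : Fin n → H.Carrier} → LinearlyIndependent H v → LinearlyIndependent Γ (proj₁ ∘ v)
    subgroup-independent⁻ indep k eq = indep k (trans (reflexive (proj₁-sum k _)) eq)

  module _ {r : Subset (length 𝒜) → ℕ} (isRank : IsRankFunction Γ 𝒜 r) where

    rank-attained : ∀ S → ∃ λ (v : Fin (r S) → Carrier) → (∀ i → Span S (v i)) × LinearlyIndependent Γ v
    rank-attained S with proj₁ (isRank S)
    ... | v , indep = proj₁ ∘ v , proj₂ ∘ v , subgroup-independent⁻ (span-isSubgroup S) indep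

    rank-bound : ∀ S {s} (v : Fin s → Carrier) → (∀ i → Span S (v i)) → LinearlyIndependent Γ v → s ℕ.≤ r S
    rank-bound S v v∈ indep = proj₂ (isRank S) _ (λ i → v i , v∈ i) (subgroup-independent⁺ (span-isSubgroup S) indep)

    rank-⊥ : r Subset.⊥ ≡ 0
    rank-⊥ with r Subset.⊥ | rank-attained Subset.⊥
    ... | zero  | _ = ≡.refl
    ... | suc s | v , v∈ , indep = contradiction (indep k k·v≈ε zero) λ ()
      where
      trivial : ∀ {x} → Span Subset.⊥ x → x ≈ ε
      trivial = span-minimal {P = _≈ ε}
        (record { ε-closed = refl ; ∙-closed = λ x≈ y≈ → trans (∙-cong x≈ y≈) (identityʳ ε)
                ; ⁻¹-closed = λ x≈ → trans (⁻¹-cong x≈) ε⁻¹≈ε })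
        (λ x≈y x≈ → trans (sym x≈y) x≈) λ i i∈⊥ → contradiction i∈⊥ Subset.∉⊥
      k : Fin (suc s) → ℤ
      k zero    = 1ℤ
      k (suc i) = 0ℤ
      zeros : ∀ {s} (v : Fin s → Carrier) → sum (λ i → 0ℤ • v i) ≈ ε
      zeros {zero}  v = refl
      zeros {suc s} v = trans (identityˡ _) (zeros (v ∘ suc))
      k·v≈ε : sum (λ i → k i • v i) ≈ ε
      k·v≈ε = trans (∙-cong (trans (1-• (v zero)) (trivial (v∈ zero))) (zeros (v ∘ suc))) (identityʳ ε)

    rank-⊆ : ∀ {S S′} → S ⊆ S′ → r S ℕ.≤ r S′
    rank-⊆ {S} {S′} S⊆S′ with rank-attained S
    ... | v , v∈ , indep = rank-bound S′ v (λ i → span-mono S⊆S′ (v∈ i)) indep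

    -- Multiplication by the d with d · `el i` in the span of S carries the larger span into the
    -- smaller one and preserves linear independence.
    sat⇒rank-add : ∀ {S i} → Sat S (el i) → r (add i S) ≡ r S
    sat⇒rank-add {S} {i} (d , d>0 , de∈) with rank-attained (add i S)
    ... | v , v∈ , indep = ℕ.≤-antisym (rank-bound S (λ j → d ×ᴳ v j) (λ j → multiples (v∈ j)) indep′) (rank-⊆ (add-⊇ i))
      where
      multiples : ∀ {x} → Span (add i S) x → Span S (d ×ᴳ x)
      multiples = span-minimal {P = λ x → Span S (d ×ᴳ x)}
        (record { ε-closed = resp (sym (×-ε d)) unit
                ; ∙-closed = λ {x} {y} x∈ y∈ → resp (sym (×-distrib-+ x y d)) (mult x∈ y∈)
                ; ⁻¹-closed = λ {x} x∈ → resp (sym (×-⁻¹ d x)) (inv x∈) })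
        (λ x≈y → resp (×-congʳ d x≈y))
        λ j j∈ → [ (λ { ≡.refl → de∈ }) , (λ j∈S → span-× d (span-el j∈S)) ]′ (∈-add⁻ j∈)
      indep′ : LinearlyIndependent Γ (λ j → d ×ᴳ v j)
      indep′ k eq j with ℤ.i*j≡0⇒i≡0∨j≡0 (k j) (indep (λ j → k j ℤ.* ℤ.+ d)
        (trans (sum-cong-≋ λ j → •-assoc (k j) (ℤ.+ d) (v j)) eq) j)
      ... | inj₁ k≡0 = k≡0
      ... | inj₂ d≡0 = contradiction (ℤ.+-injective d≡0) (ℕ.n>0⇒n≢0 d>0)

    -- A largest independent family in the span of S can be extended by `el i`: a relation with a
    -- non-zero coefficient there would make `el i` torsion over S.
    ¬sat⇒rank-add : ∀ {S i} → ¬ Sat S (el i) → r S ℕ.< r (add i S)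
    ¬sat⇒rank-add {S} {i} ¬sat with rank-attained S
    ... | v , v∈ , indep = rank-bound (add i S) v′ v′∈ indep′
      where
      v′ : Fin (suc (r S)) → Carrier
      v′ zero    = el i
      v′ (suc j) = v j
      v′∈ : ∀ j → Span (add i S) (v′ j)
      v′∈ zero    = span-el (∈-add i)
      v′∈ (suc j) = span-mono (add-⊇ i) (v∈ j)
      sum∈ : ∀ {s} (k : Fin s → ℤ) (v : Fin s → Carrier) → (∀ j → Span S (v j)) → Span S (sum λ j → k j • v j)
      sum∈ {zero}  k v v∈ = unit
      sum∈ {suc s} k v v∈ = mult (span-• (k zero) (v∈ zero)) (sum∈ (k ∘ suc) (v ∘ suc) (v∈ ∘ suc))
      indep′ : LinearlyIndependent Γ v′
      indep′ k eq = λ { zero → k₀≡0 ; (suc j) → indep (k ∘ suc) rest j }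
        where
        k₀≡0 : k zero ≡ 0ℤ
        k₀≡0 with k zero ℤ.≟ 0ℤ
        ... | yes k₀≡0 = k₀≡0
        ... | no  k₀≢0 = contradiction
          (sat-• k₀≢0 (span⊆sat (resp (sym (inverseˡ-unique _ _ eq)) (inv (sum∈ (k ∘ suc) v v∈))))) ¬sat
        rest : sum (λ j → k (suc j) • v j) ≈ ε
        rest = trans (sym (identityˡ _)) (trans (∙-congʳ (sym (•-congˡ (el i) k₀≡0))) eq)

    -- Gaussian elimination, the pivot being some vⱼ with a non-zero coefficient at the new element.
    eliminate : ∀ {S i s} (v : Fin (suc s) → Carrier) → (∀ j → Span (add i S) (v j)) → LinearlyIndependent Γ v →
      s ℕ.≤ r S
    eliminate {S} {i} {s} v v∈ indep with Fin.any? (λ j → ¬? (n j ℤ.≟ 0ℤ))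
      where
      n : Fin (suc s) → ℤ
      n j = proj₁ (span-split ∈-add⁻ (v∈ j))
    ... | no ¬pivot = ℕ.≤-trans (ℕ.n≤1+n s) (rank-bound S v v∈S indep)
      where
      v∈S : ∀ j → Span S (v j)
      v∈S j with span-split ∈-add⁻ (v∈ j) | (λ n≢0 → ¬pivot (j , n≢0))
      ... | n , u , u∈ , v≈ | ¬n≢0 with n ℤ.≟ 0ℤ
      ...   | yes ≡.refl = resp (sym (trans v≈ (identityʳ u))) u∈
      ...   | no  n≢0    = contradiction n≢0 ¬n≢0
    ... | yes (j , nⱼ≢0) = rank-bound S w w∈ indep′
      where
      n : Fin (suc s) → ℤ
      n j = proj₁ (span-split ∈-add⁻ (v∈ j))
      u : Fin (suc s) → Carrier
      u j = proj₁ (proj₂ (span-split ∈-add⁻ (v∈ j)))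
      u∈ : ∀ j → Span S (u j)
      u∈ j = proj₁ (proj₂ (proj₂ (span-split ∈-add⁻ (v∈ j))))
      v≈ : ∀ j → v j ≈ u j ∙ n j • el i
      v≈ j = proj₂ (proj₂ (proj₂ (span-split ∈-add⁻ (v∈ j))))
      e = el i
      p : Fin s → Fin (suc s)
      p = punchIn j
      w : Fin s → Carrier
      w l = n j • v (p l) ∙ (ℤ.- n (p l)) • v j
      w∈ : ∀ l → Span S (w l)
      w∈ l = resp (sym w≈) (mult (span-• (n j) (u∈ (p l))) (span-• (ℤ.- n (p l)) (u∈ j)))
        where
        cancel : n j ℤ.* n (p l) ℤ.+ (ℤ.- n (p l)) ℤ.* n j ≡ 0ℤ
        cancel = lemma (n j) (n (p l))
          where
          lemma : ∀ a b → a ℤ.* b ℤ.+ (ℤ.- b) ℤ.* a ≡ 0ℤ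
          lemma = solve-∀
        w≈ : w l ≈ n j • u (p l) ∙ (ℤ.- n (p l)) • u j
        w≈ = begin
          n j • v (p l) ∙ (ℤ.- n (p l)) • v j
            ≈⟨ ∙-cong (•-congʳ (n j) (v≈ (p l))) (•-congʳ (ℤ.- n (p l)) (v≈ j)) ⟩
          n j • (u (p l) ∙ n (p l) • e) ∙ (ℤ.- n (p l)) • (u j ∙ n j • e)
            ≈⟨ ∙-cong (•-distrib-∙ (n j) _ _) (•-distrib-∙ (ℤ.- n (p l)) _ _) ⟩
          (n j • u (p l) ∙ n j • n (p l) • e) ∙ ((ℤ.- n (p l)) • u j ∙ (ℤ.- n (p l)) • n j • e)
            ≈⟨ interchange _ _ _ _ ⟩
          (n j • u (p l) ∙ (ℤ.- n (p l)) • u j) ∙ (n j • n (p l) • e ∙ (ℤ.- n (p l)) • n j • e)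
            ≈⟨ ∙-congˡ (∙-cong (•-assoc (n j) (n (p l)) e) (•-assoc (ℤ.- n (p l)) (n j) e)) ⟨
          (n j • u (p l) ∙ (ℤ.- n (p l)) • u j) ∙ ((n j ℤ.* n (p l)) • e ∙ ((ℤ.- n (p l)) ℤ.* n j) • e)
            ≈⟨ ∙-congˡ (•-homo-+ (n j ℤ.* n (p l)) ((ℤ.- n (p l)) ℤ.* n j) e) ⟨
          (n j • u (p l) ∙ (ℤ.- n (p l)) • u j) ∙ (n j ℤ.* n (p l) ℤ.+ (ℤ.- n (p l)) ℤ.* n j) • e
            ≈⟨ ∙-congˡ (•-congˡ e cancel) ⟩
          (n j • u (p l) ∙ (ℤ.- n (p l)) • u j) ∙ ε
            ≈⟨ identityʳ _ ⟩
          n j • u (p l) ∙ (ℤ.- n (p l)) • u j ∎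
      indep′ : LinearlyIndependent Γ w
      indep′ k eq l with ℤ.i*j≡0⇒i≡0∨j≡0 (k l) (≡.trans (≡.sym (Vector.insertAt-punchIn kn j total l)) (indep K K·v≈ε (p l)))
        where
        kn : Fin s → ℤ
        kn l = k l ℤ.* n j
        total : ℤ
        total = Vector.foldr ℤ._+_ 0ℤ λ l → k l ℤ.* (ℤ.- n (p l))
        K : Fin (suc s) → ℤ
        K = Vector.insertAt kn j total
        K·v≈ε : sum (λ m → K m • v m) ≈ ε
        K·v≈ε = begin
          sum (λ m → K m • v m)
            ≈⟨ sum-remove {i = j} (λ m → K m • v m) ⟩
          K j • v j ∙ sum (λ l → K (p l) • v (p l))
            ≈⟨ ∙-cong (•-congˡ (v j) (Vector.insertAt-lookup kn j total))
                      (sum-cong-≋ λ l → •-congˡ (v (p l)) (Vector.insertAt-punchIn kn j total l)) ⟩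
          total • v j ∙ sum (λ l → kn l • v (p l))
            ≈⟨ comm _ _ ⟩
          sum (λ l → kn l • v (p l)) ∙ total • v j
            ≈⟨ ∙-congˡ (sum-• (λ l → k l ℤ.* (ℤ.- n (p l))) (v j)) ⟨
          sum (λ l → kn l • v (p l)) ∙ sum (λ l → (k l ℤ.* (ℤ.- n (p l))) • v j)
            ≈⟨ ∑-distrib-+ (λ l → kn l • v (p l)) (λ l → (k l ℤ.* (ℤ.- n (p l))) • v j) ⟨
          sum (λ l → kn l • v (p l) ∙ (k l ℤ.* (ℤ.- n (p l))) • v j)
            ≈⟨ sum-cong-≋ (λ l → trans (∙-cong (•-assoc (k l) (n j) _) (•-assoc (k l) (ℤ.- n (p l)) _)) (sym (•-distrib-∙ (k l) _ _))) ⟩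
          sum (λ l → k l • w l)
            ≈⟨ eq ⟩
          ε ∎
      ... | inj₁ k≡0 = k≡0
      ... | inj₂ n≡0 = contradiction n≡0 nⱼ≢0

    isMatroidRank : IsMatroidRank r
    isMatroidRank = record
      { rank-⊥       = rank-⊥
      ; rank-mono    = λ i S → rank-⊆ (add-⊇ i)
      ; rank-add-≤   = rank-add-≤
      -- Equal ranks give the saturation only up to double negation, which suffices because equality
      -- of natural numbers is decidable.
      ; closure-mono = λ {i} {S} {S′} S⊆S′ eq → decidable-stable (_ ℕ.≟ _) λ ≢ →
          ℕ.<-irrefl (≡.sym eq) (¬sat⇒rank-add λ sat → ≢ (sat⇒rank-add (sat-mono S⊆S′ sat)))
      }
      where
      rank-add-≤ : ∀ i S → r (add i S) ℕ.≤ suc (r S)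
      rank-add-≤ i S with r (add i S) | rank-attained (add i S)
      ... | zero  | _ = ℕ.z≤n
      ... | suc s | v , v∈ , indep = ℕ.s≤s (eliminate v v∈ indep)

    rank⇒independent : ∀ {B} → r B ≡ ∣ B ∣ → Independent B
    rank⇒independent {B} rB≡ i i∈B sat = ℕ.<-irrefl
      (≡.trans (≡.sym (sat⇒rank-add sat)) (cong r (add-drop i∈B)))
      (IsMatroidRank.independent⇒coloop isMatroidRank rB≡ i∈B)

    rank⇒¬¬sat : ∀ {S i} → r (add i S) ≡ r S → ¬ ¬ Sat S (el i)
    rank⇒¬¬sat eq ¬sat = ℕ.<-irrefl (≡.sym eq) (¬sat⇒rank-add ¬sat)

-- Reasoning under double negation.

module Classical where

  module _ {a : Level} where
    open RawMonad (¬¬-Monad {a}) public using (rawApplicative)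

  _>>=_ : ∀ {a b} {A : Set a} {B : Set b} → ¬ ¬ A → (A → ¬ ¬ B) → ¬ ¬ B
  (m >>= f) k = m λ a → f a k

  return : ∀ {a} {A : Set a} → A → ¬ ¬ A
  return a k = k a

  ¬¬-choice : ∀ {n p} {P : Fin n → Set p} → (∀ i → ¬ ¬ P i) → ¬ ¬ (∀ i → P i)
  ¬¬-choice = Fin.sequence rawApplicative

  ¬¬-least : ∀ {p} (P : ℕ → Set p) {n} → P n → ¬ ¬ (∃ λ d → P d × ∀ e → e ℕ.< d → ¬ P e)
  ¬¬-least P {n} = <-rec (λ n → P n → ¬ ¬ (∃ λ d → P d × ∀ e → e ℕ.< d → ¬ P e))
    (λ n rec Pn → ¬¬-excluded-middle {A = ∃ λ e → e ℕ.< n × P e} >>= λ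
      { (yes (e , e<n , Pe)) → rec e<n Pe
      ; (no  none)           → return (n , Pn , λ e e<n Pe → none (e , e<n , Pe)) }) n

-- Extension of partial homomorphisms into a divisible group.

module Extension {c ℓ g ℓg : Level} (Γ : AbelianGroup c ℓ) (G : AbelianGroup g ℓg) where

  open Classical
  private
    module Γ where
      open AbelianGroup Γ public
      open Multiples Γ public
    module G where
      open AbelianGroup G public
      open Multiples G public

  Homomorphism : Set (c ⊔ ℓ ⊔ g ⊔ ℓg)
  Homomorphism = GroupHomomorphism Γ.rawGroup G.rawGroup

  module _ (φ : Homomorphism) where

    private module φ = GroupHomomorphism φ

    ⟦_⟧ : Γ.Carrier → G.Carrier
    ⟦_⟧ = φ.⟦_⟧

    ⟦⟧-cong : ∀ {x y} → x Γ.≈ y → ⟦_⟧ x G.≈ ⟦_⟧ y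
    ⟦⟧-cong = φ.⟦⟧-cong

    ∙-homo : ∀ x y → ⟦_⟧ (x Γ.∙ y) G.≈ ⟦_⟧ x G.∙ ⟦_⟧ y
    ∙-homo = φ.homo

    ε-homo : ⟦_⟧ Γ.ε G.≈ G.ε
    ε-homo = φ.ε-homo

    ⁻¹-homo : ∀ x → ⟦_⟧ (x Γ.⁻¹) G.≈ ⟦_⟧ x G.⁻¹
    ⁻¹-homo = φ.⁻¹-homo

  -- The graph of a homomorphism from a subgroup of Γ to G.
  record IsPartialHomomorphism {p} (W : Γ.Carrier → G.Carrier → Set p) : Set (c ⊔ ℓ ⊔ g ⊔ ℓg ⊔ p) where
    field
      ε-rel    : W Γ.ε G.ε
      ∙-rel    : ∀ {x y a b} → W x a → W y b → W (x Γ.∙ y) (a G.∙ b)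
      ⁻¹-rel   : ∀ {x a} → W x a → W (x Γ.⁻¹) (a G.⁻¹)
      resp-rel : ∀ {x y a b} → x Γ.≈ y → a G.≈ b → W x a → W y b
      single   : ∀ {a} → W Γ.ε a → a G.≈ G.ε

    functional : ∀ {x a b} → W x a → W x b → a G.≈ b
    functional {x} Wxa Wxb = G.x∙y⁻¹≈ε⇒x≈y _ _
      (single (resp-rel (Γ.inverseʳ x) G.refl (∙-rel Wxa (⁻¹-rel Wxb))))

    ×-rel : ∀ n {x a} → W x a → W (n Γ.×ᴳ x) (n G.×ᴳ a)
    ×-rel zero    Wxa = ε-rel
    ×-rel (suc n) Wxa = ∙-rel Wxa (×-rel n Wxa)

    •-rel : ∀ n {x a} → W x a → W (n Γ.• x) (n G.• a)
    •-rel (ℤ.+ n)    Wxa = ×-rel n Wxa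
    •-rel ℤ.-[1+ n ] Wxa = ⁻¹-rel (×-rel (suc n) Wxa)

    ∣∣-rel : ∀ n {x a} → W (n Γ.• x) a → ∃ λ b → W (ℤ.∣ n ∣ Γ.×ᴳ x) b
    ∣∣-rel (ℤ.+ n)    Wnxa = _ , Wnxa
    ∣∣-rel ℤ.-[1+ n ] Wnxa = _ , resp-rel (Γ.⁻¹-involutive _) G.refl (⁻¹-rel Wnxa)

  _⊑_ : ∀ {p q} → (Γ.Carrier → G.Carrier → Set p) → (Γ.Carrier → G.Carrier → Set q) → Set _
  W ⊑ W′ = ∀ x a → W x a → W′ x a

  module _ (divisible : Divisible G) where

    module _ {p} {W : Γ.Carrier → G.Carrier → Set (c ⊔ ℓ ⊔ g ⊔ ℓg ⊔ p)} (isPartial : IsPartialHomomorphism W) (z : Γ.Carrier) where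

      open IsPartialHomomorphism isPartial

      -- Adding z ↦ h to the graph is consistent exactly when h already has the right value at every
      -- multiple of z in the domain.
      adjoin : ∀ h → (∀ n {a} → W (n Γ.• z) a → a G.≈ n G.• h) →
        ∃ λ (W′ : Γ.Carrier → G.Carrier → Set (c ⊔ ℓ ⊔ g ⊔ ℓg ⊔ p)) → IsPartialHomomorphism W′ × W ⊑ W′ × ∃ λ a → W′ z a
      adjoin h compatible = W′ , isPartial′
        , (λ x a Wxa → 0ℤ , x , a , Wxa , Γ.sym (Γ.identityʳ x) , G.sym (G.identityʳ a))
        , h , 1ℤ , Γ.ε , G.ε , ε-rel
            , Γ.sym (Γ.trans (Γ.identityˡ _) (Γ.1-• z)) , G.sym (G.trans (G.identityˡ _) (G.1-• h))
        where
        W′ : Γ.Carrier → G.Carrier → Set (c ⊔ ℓ ⊔ g ⊔ ℓg ⊔ p)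
        W′ x a = ∃ λ n → ∃₂ λ y b → W y b × x Γ.≈ y Γ.∙ n Γ.• z × a G.≈ b G.∙ n G.• h
        isPartial′ : IsPartialHomomorphism W′
        isPartial′ = record
          { ε-rel    = 0ℤ , Γ.ε , G.ε , ε-rel , Γ.sym (Γ.identityʳ _) , G.sym (G.identityʳ _)
          ; ∙-rel    = λ { (m , y , b , Wyb , x≈ , a≈) (n , y′ , b′ , Wyb′ , x≈′ , a≈′) →
              m ℤ.+ n , y Γ.∙ y′ , b G.∙ b′ , ∙-rel Wyb Wyb′
              , Γ.trans (Γ.∙-cong x≈ x≈′) (Γ.trans (Γ.interchange y _ y′ _) (Γ.∙-congˡ (Γ.sym (Γ.•-homo-+ m n z))))
              , G.trans (G.∙-cong a≈ a≈′) (G.trans (G.interchange b _ b′ _) (G.∙-congˡ (G.sym (G.•-homo-+ m n h)))) }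
          ; ⁻¹-rel   = λ { (n , y , b , Wyb , x≈ , a≈) → ℤ.- n , y Γ.⁻¹ , b G.⁻¹ , ⁻¹-rel Wyb
              , Γ.trans (Γ.⁻¹-cong x≈) (Γ.trans (Γ.sym (Γ.⁻¹-∙-comm y _)) (Γ.∙-congˡ (Γ.sym (Γ.-‿• n z))))
              , G.trans (G.⁻¹-cong a≈) (G.trans (G.sym (G.⁻¹-∙-comm b _)) (G.∙-congˡ (G.sym (G.-‿• n h)))) }
          ; resp-rel = λ { x≈x′ a≈a′ (n , y , b , Wyb , x≈ , a≈) → n , y , b , Wyb
              , Γ.trans (Γ.sym x≈x′) x≈ , G.trans (G.sym a≈a′) a≈ }
          ; single   = λ { (n , y , b , Wyb , ε≈ , a≈) → G.trans a≈ (G.trans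
              (G.∙-congˡ (G.sym (compatible n
                (resp-rel (Γ.sym (Γ.inverseʳ-unique _ _ (Γ.sym ε≈))) G.refl (⁻¹-rel Wyb)))))
              (G.inverseʳ b)) }
          }

      adjoin-free : (∀ d → 0 ℕ.< d → ¬ ∃ (W (d Γ.×ᴳ z))) → ∀ n {a} → W (n Γ.• z) a → a G.≈ n G.• G.ε
      adjoin-free none n {a} Wnza with n ℤ.≟ 0ℤ
      ... | yes ≡.refl = single Wnza
      ... | no  n≢0    = contradiction (∣∣-rel n Wnza) (none ℤ.∣ n ∣ (ℕ.n≢0⇒n>0 (n≢0 ∘ ℤ.∣i∣≡0⇒i≡0)))

      -- Division with remainder by the least positive multiplier that brings z into the domain: a
      -- non-zero remainder would be a smaller such multiplier. Hence one condition on h, solvable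
      -- by divisibility, settles all multiples.
      adjoin-torsion : ∀ {d a₀ h} → W (suc d Γ.×ᴳ z) a₀ →
        (∀ e → e ℕ.< suc d → ¬ (0 ℕ.< e × ∃ (W (e Γ.×ᴳ z)))) → suc d G.×ᴳ h G.≈ a₀ →
        ∀ n {a} → W (n Γ.• z) a → a G.≈ n G.• h
      adjoin-torsion {d} {a₀} {h} Wdz least dh≈a₀ n {a} Wnza = remainder (n ℤ.%ℕ suc d) (ℤ.n%ℕd<d n (suc d)) (ℤ.a≡a%ℕn+[a/ℕn]*n n (suc d))
        where
        q = n ℤ./ℕ suc d
        remainder : ∀ r → r ℕ.< suc d → n ≡ ℤ.+ r ℤ.+ q ℤ.* ℤ.+ suc d → a G.≈ n G.• h
        remainder zero _ n≡ = G.trans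
          (functional (resp-rel (Γ.•-congˡ z n≡qd) G.refl Wnza)
                      (resp-rel (Γ.sym (Γ.•-assoc q (ℤ.+ suc d) z)) G.refl (•-rel q Wdz)))
          (G.trans (G.•-congʳ q (G.sym dh≈a₀)) (G.trans (G.sym (G.•-assoc q (ℤ.+ suc d) h)) (G.•-congˡ h (≡.sym n≡qd))))
          where
          n≡qd : n ≡ q ℤ.* ℤ.+ suc d
          n≡qd = ≡.trans n≡ (ℤ.+-identityˡ _)
        remainder (suc r) r<d n≡ = contradiction
          (ℕ.z<s , _ , resp-rel cancel G.refl (∙-rel Wnza (⁻¹-rel (•-rel q Wdz)))) (least (suc r) r<d)
          where
          open import Relation.Binary.Reasoning.Setoid Γ.setoid
          cancel : n Γ.• z Γ.∙ (q Γ.• (suc d Γ.×ᴳ z)) Γ.⁻¹ Γ.≈ suc r Γ.×ᴳ z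
          cancel = begin
            n Γ.• z Γ.∙ (q Γ.• (suc d Γ.×ᴳ z)) Γ.⁻¹
              ≈⟨ Γ.∙-congʳ (Γ.trans (Γ.•-congˡ z n≡) (Γ.•-homo-+ (ℤ.+ suc r) (q ℤ.* ℤ.+ suc d) z)) ⟩
            (suc r Γ.×ᴳ z Γ.∙ (q ℤ.* ℤ.+ suc d) Γ.• z) Γ.∙ (q Γ.• (suc d Γ.×ᴳ z)) Γ.⁻¹
              ≈⟨ Γ.assoc _ _ _ ⟩
            suc r Γ.×ᴳ z Γ.∙ ((q ℤ.* ℤ.+ suc d) Γ.• z Γ.∙ (q Γ.• (suc d Γ.×ᴳ z)) Γ.⁻¹)
              ≈⟨ Γ.∙-congˡ (Γ.trans (Γ.∙-congʳ (Γ.•-assoc q (ℤ.+ suc d) z)) (Γ.inverseʳ _)) ⟩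
            suc r Γ.×ᴳ z Γ.∙ Γ.ε
              ≈⟨ Γ.identityʳ _ ⟩
            suc r Γ.×ᴳ z ∎

      ¬¬-adjoin : ¬ ¬ (∃ λ (W′ : Γ.Carrier → G.Carrier → Set (c ⊔ ℓ ⊔ g ⊔ ℓg ⊔ p)) →
        IsPartialHomomorphism W′ × W ⊑ W′ × ∃ λ a → W′ z a)
      ¬¬-adjoin = ¬¬-excluded-middle {A = ∃ λ d → 0 ℕ.< d × ∃ (W (d Γ.×ᴳ z))} >>= λ
        { (no  none)         → return (adjoin G.ε (adjoin-free λ d d>0 Wdz → none (d , d>0 , Wdz)))
        ; (yes (_ , torsion)) → ¬¬-least (λ d → 0 ℕ.< d × ∃ (W (d Γ.×ᴳ z))) torsion >>= λ
            { (zero , (() , _) , _)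
            ; (suc d , (d>0 , a , Wdz) , least) → let h , dh≈a = divisible (suc d) d>0 a in
                return (adjoin h (adjoin-torsion Wdz least dh≈a)) } }

    ¬¬-adjoin-all : ∀ {p} (L : List Γ.Carrier) {W : Γ.Carrier → G.Carrier → Set (c ⊔ ℓ ⊔ g ⊔ ℓg ⊔ p)} →
      IsPartialHomomorphism W →
      ¬ ¬ (∃ λ (W′ : Γ.Carrier → G.Carrier → Set (c ⊔ ℓ ⊔ g ⊔ ℓg ⊔ p)) →
        IsPartialHomomorphism W′ × W ⊑ W′ × ∀ x → x List.∈ L → ∃ λ a → W′ x a)
    ¬¬-adjoin-all     []      {W} isPartial = return (W , isPartial , (λ _ _ Wxa → Wxa) , λ _ ())
    ¬¬-adjoin-all {p} (z ∷ L) {W} isPartial =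
      ¬¬-adjoin {p} isPartial z >>= λ { (W′ , isPartial′ , W⊑W′ , a , Wza) →
      ¬¬-adjoin-all {p} L isPartial′ >>= λ { (W″ , isPartial″ , W′⊑W″ , total) →
      return (W″ , isPartial″ , (λ x a Wxa → W′⊑W″ x a (W⊑W′ x a Wxa)) , λ { _ (here ≡.refl) → a , W′⊑W″ z a Wza ; x (there x∈L) → total x x∈L }) } }

    module _ (finitelyGenerated : FinitelyGenerated Γ) where

      extend : ∀ {p} {W : Γ.Carrier → G.Carrier → Set p} → IsPartialHomomorphism W →
        ¬ ¬ (∃ λ (φ : Homomorphism) → ∀ {x a} → W x a → ⟦ φ ⟧ x G.≈ a)
      extend {p} {W} isPartial = ¬¬-adjoin-all {p} (proj₁ finitelyGenerated) isPartial↑ >>= λ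
        { (W′ , isPartial′ , W⊑W′ , total) → return (hom W′ isPartial′ total W⊑W′) }
        where
        open IsPartialHomomorphism isPartial
        -- Adjoining an element quantifies over both groups. In the lifted universe the enlarged
        -- graph has the level of the old one, so the recursion over the generators can be carried
        -- out.
        isPartial↑ : IsPartialHomomorphism (λ x a → Lift (c ⊔ ℓ ⊔ g ⊔ ℓg) (W x a))
        isPartial↑ = record
          { ε-rel    = lift ε-rel
          ; ∙-rel    = λ u v → lift (∙-rel (lower u) (lower v))
          ; ⁻¹-rel   = λ u → lift (⁻¹-rel (lower u))
          ; resp-rel = λ x≈y a≈b u → lift (resp-rel x≈y a≈b (lower u))
          ; single   = λ u → single (lower u)
          }
        hom : ∀ W′ → IsPartialHomomorphism {c ⊔ ℓ ⊔ g ⊔ ℓg ⊔ p} W′ →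
          (∀ x → x List.∈ proj₁ finitelyGenerated → ∃ λ a → W′ x a) → (λ x a → Lift (c ⊔ ℓ ⊔ g ⊔ ℓg) (W x a)) ⊑ W′ →
          ∃ λ (φ : Homomorphism) → ∀ {x a} → W x a → ⟦ φ ⟧ x G.≈ a
        hom W′ isPartial′ total W⊑W′ = record
          { ⟦_⟧ = f
          ; isGroupHomomorphism = record
            { isMonoidHomomorphism = record
              { isMagmaHomomorphism = record
                { isRelHomomorphism = record { cong = λ x≈y → W′.functional (W′.resp-rel x≈y G.refl (graph _)) (graph _) }
                ; homo = λ x y → W′.functional (graph _) (W′.∙-rel (graph x) (graph y))
                }
              ; ε-homo = W′.functional (graph _) W′.ε-rel
              }
            ; ⁻¹-homo = λ x → W′.functional (graph _) (W′.⁻¹-rel (graph x))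
            }
          } , λ Wxa → W′.functional (graph _) (W⊑W′ _ _ (lift Wxa))
          where
          module W′ = IsPartialHomomorphism isPartial′
          -- The value is read off from a derivation of x from the generators. That it does not
          -- depend on the derivation, and respects equality, is the functionality of the graph.
          value : ∀ {x} → Generated Γ (List._∈ proj₁ finitelyGenerated) x → ∃ λ a → W′ x a
          value (gen x∈L)      = total _ x∈L
          value unit           = _ , W′.ε-rel
          value (mult u v)     = _ , W′.∙-rel (proj₂ (value u)) (proj₂ (value v))
          value (inv u)        = _ , W′.⁻¹-rel (proj₂ (value u))
          value (resp x≈y u)   = _ , W′.resp-rel x≈y G.refl (proj₂ (value u))
          f : Γ.Carrier → G.Carrier
          f x = proj₁ (value (proj₂ finitelyGenerated x))
          graph : ∀ x → W′ x (f x)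
          graph x = proj₂ (value (proj₂ finitelyGenerated x))

      -- The map y + z ↦ φ(y) on A + C is well defined because φ vanishes on the intersection, and
      -- it then extends to Γ.
      glue : ∀ {p q} {A : Γ.Carrier → Set p} {C : Γ.Carrier → Set q} → IsSubgroup Γ A → IsSubgroup Γ C →
        (∀ {x y} → x Γ.≈ y → A x → A y) → (φ : Homomorphism) → (∀ {x} → A x → C x → ⟦ φ ⟧ x G.≈ G.ε) →
        ¬ ¬ (∃ λ (ψ : Homomorphism) → (∀ {x} → A x → ⟦ ψ ⟧ x G.≈ ⟦ φ ⟧ x) × (∀ {x} → C x → ⟦ ψ ⟧ x G.≈ G.ε))
      glue {A = A} {C} A-isSubgroup C-isSubgroup A-resp φ φ≈ε = extend isPartial >>= λ { (ψ , ψ-extends) → return (ψ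
        , (λ {x} Ax → ψ-extends (x , Γ.ε , Ax , C.ε-closed , Γ.sym (Γ.identityʳ x) , G.refl))
        , (λ {x} Cx → ψ-extends (Γ.ε , x , A.ε-closed , Cx , Γ.sym (Γ.identityˡ x) , G.sym (ε-homo φ)))) }
        where
        module A = IsSubgroup A-isSubgroup
        module C = IsSubgroup C-isSubgroup
        W : Γ.Carrier → G.Carrier → Set _
        W x a = ∃₂ λ y z → A y × C z × x Γ.≈ y Γ.∙ z × a G.≈ ⟦ φ ⟧ y
        isPartial : IsPartialHomomorphism W
        isPartial = record
          { ε-rel    = Γ.ε , Γ.ε , A.ε-closed , C.ε-closed , Γ.sym (Γ.identityʳ _) , G.sym (ε-homo φ)
          ; ∙-rel    = λ { (y , z , Ay , Cz , x≈ , a≈) (y′ , z′ , Ay′ , Cz′ , x≈′ , a≈′) →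
              y Γ.∙ y′ , z Γ.∙ z′ , A.∙-closed Ay Ay′ , C.∙-closed Cz Cz′
              , Γ.trans (Γ.∙-cong x≈ x≈′) (Γ.interchange y z y′ z′)
              , G.trans (G.∙-cong a≈ a≈′) (G.sym (∙-homo φ y y′)) }
          ; ⁻¹-rel   = λ { (y , z , Ay , Cz , x≈ , a≈) → y Γ.⁻¹ , z Γ.⁻¹ , A.⁻¹-closed Ay , C.⁻¹-closed Cz
              , Γ.trans (Γ.⁻¹-cong x≈) (Γ.sym (Γ.⁻¹-∙-comm y z))
              , G.trans (G.⁻¹-cong a≈) (G.sym (⁻¹-homo φ y)) }
          ; resp-rel = λ { x≈x′ a≈a′ (y , z , Ay , Cz , x≈ , a≈) → y , z , Ay , Cz
              , Γ.trans (Γ.sym x≈x′) x≈ , G.trans (G.sym a≈a′) a≈ }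
          ; single   = λ { (y , z , Ay , Cz , ε≈ , a≈) →
              let y⁻¹≈z = Γ.sym (Γ.inverseʳ-unique y z (Γ.sym ε≈)) in
              G.trans a≈ (G.trans (G.sym (G.⁻¹-involutive _)) (G.trans
                (G.⁻¹-cong (G.trans (G.sym (⁻¹-homo φ y)) (G.trans (⟦⟧-cong φ y⁻¹≈z)
                  (φ≈ε (A-resp y⁻¹≈z (A.⁻¹-closed Ay)) Cz))))
                G.ε⁻¹≈ε)) }
          }

-- Characters of (Γ/⟨S⟩)_tor lifted to characters of Γ.

module Lifts {c ℓ g ℓg : Level} (Γ : AbelianGroup c ℓ) (𝒜 : List (AbelianGroup.Carrier Γ))
  (G : AbelianGroup g ℓg) where

  open Classical
  open Extension Γ G
  open Spans Γ 𝒜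
  private
    module Γ where
      open AbelianGroup Γ public
      open Multiples Γ public
    module G where
      open AbelianGroup G public
      open Multiples G public

  Kills : Homomorphism → Subset (length 𝒜) → Set ℓg
  Kills φ S = ∀ i → i ∈ S → ⟦ φ ⟧ (el i) G.≈ G.ε

  AgreeOn : ∀ {p} → (Γ.Carrier → Set p) → Homomorphism → Homomorphism → Set (c ⊔ ℓg ⊔ p)
  AgreeOn A φ ψ = ∀ x → A x → ⟦ φ ⟧ x G.≈ ⟦ ψ ⟧ x

  kernel-isSubgroup : ∀ φ → IsSubgroup Γ λ x → ⟦ φ ⟧ x G.≈ G.ε
  kernel-isSubgroup φ = record
    { ε-closed  = ε-homo φ
    ; ∙-closed  = λ x≈ y≈ → G.trans (∙-homo φ _ _) (G.trans (G.∙-cong x≈ y≈) (G.identityʳ _))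
    ; ⁻¹-closed = λ x≈ → G.trans (⁻¹-homo φ _) (G.trans (G.⁻¹-cong x≈) G.ε⁻¹≈ε)
    }

  kills-span : ∀ {S} φ → Kills φ S → ∀ {x} → Span S x → ⟦ φ ⟧ x G.≈ G.ε
  kills-span φ kills = span-minimal (kernel-isSubgroup φ) (λ x≈y → G.trans (G.sym (⟦⟧-cong φ x≈y))) kills

  -- Hom((Γ/⟨S⟩)_tor, G) as the characters of Γ that kill S, modulo agreement on `Sat S`, with one
  -- chosen lift in each class.
  record Representatives (S : Subset (length 𝒜)) (N : ℕ) : Set (c ⊔ ℓ ⊔ g ⊔ ℓg) where
    field
      rep            : Fin N → Homomorphism
      rep-kills      : ∀ k → Kills (rep k) S
      rep-injective  : ∀ {k l} → AgreeOn (Sat S) (rep k) (rep l) → k ≡ l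
      rep-surjective : ∀ φ → Kills φ S → ∃ λ k → AgreeOn (Sat S) (rep k) φ

  module _ {S : Subset (length 𝒜)} where

    private
      Q = quotient Γ (Entry Γ 𝒜 S)
      module Q = AbelianGroup Q
      F = torsionSubgroup Q
      module F = AbelianGroup F
      open RawMonoidDefinitions Q.rawMonoid using () renaming (_×_ to _×ᑫ_)

      ×-quotient : ∀ n x → n ×ᑫ x ≡ n Γ.×ᴳ x
      ×-quotient zero    x = ≡.refl
      ×-quotient (suc n) x = cong (x Γ.∙_) (×-quotient n x)

      -ε : ∀ x → x Γ.- Γ.ε Γ.≈ x
      -ε x = Γ.trans (Γ.∙-congˡ Γ.ε⁻¹≈ε) (Γ.identityʳ x)

      sat⇒torsion : ∀ {x} → Sat S x → IsTorsion Q x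
      sat⇒torsion {x} (d , d>0 , dx∈) = d , d>0 , resp (Γ.trans (Γ.sym (-ε _)) (Γ.reflexive (cong (Γ._- Γ.ε) (≡.sym (×-quotient d x))))) dx∈

      torsion⇒sat : ∀ {x} → IsTorsion Q x → Sat S x
      torsion⇒sat {x} (d , d>0 , dx∈) = d , d>0 , resp (Γ.trans (-ε _) (Γ.reflexive (×-quotient d x))) dx∈

      restrict : ∀ φ → Kills φ S → GroupHomomorphism F.rawGroup G.rawGroup
      restrict φ kills = record
        { ⟦_⟧ = λ { (x , _) → ⟦ φ ⟧ x }
        ; isGroupHomomorphism = record
          { isMonoidHomomorphism = record
            { isMagmaHomomorphism = record
              { isRelHomomorphism = record { cong = λ {x} {y} x~y → G.x∙y⁻¹≈ε⇒x≈y _ _ (G.trans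
                  (G.sym (G.trans (∙-homo φ _ _) (G.∙-congˡ (⁻¹-homo φ _)))) (kills-span φ kills x~y)) }
              ; homo = λ x y → ∙-homo φ _ _
              }
            ; ε-homo = ε-homo φ
            }
          ; ⁻¹-homo = λ x → ⁻¹-homo φ _
          }
        }

      module _ (f : GroupHomomorphism F.rawGroup G.rawGroup) where

        private
          module f = GroupHomomorphism f
          ≈ε⇒~ε : ∀ {x} → x Γ.≈ Γ.ε → x Q.≈ Q.ε
          ≈ε⇒~ε x≈ε = resp (Γ.sym (Γ.trans (-ε _) x≈ε)) unit
          ≈⇒~ : ∀ {x y} → x Γ.≈ y → x Q.≈ y
          ≈⇒~ {x} {y} x≈y = resp (Γ.sym (Γ.trans (Γ.∙-congʳ x≈y) (Γ.inverseʳ y))) unit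

        graph : Γ.Carrier → G.Carrier → Set _
        graph x a = Σ (IsTorsion Q x) λ t → f.⟦ x , t ⟧ G.≈ a

        graph-isPartial : IsPartialHomomorphism graph
        graph-isPartial = record
          { ε-rel    = IsSubgroup.ε-closed (torsion-isSubgroup Q) , f.ε-homo
          ; ∙-rel    = λ { (t , a≈) (t′ , a≈′) → IsSubgroup.∙-closed (torsion-isSubgroup Q) t t′
              , G.trans (f.homo (_ , t) (_ , t′)) (G.∙-cong a≈ a≈′) }
          ; ⁻¹-rel   = λ { (t , a≈) → IsSubgroup.⁻¹-closed (torsion-isSubgroup Q) t
              , G.trans (f.⁻¹-homo (_ , t)) (G.⁻¹-cong a≈) }
          ; resp-rel = λ { x≈y a≈b (t , a≈) → sat⇒torsion (sat-resp x≈y (torsion⇒sat t))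
              , G.trans (f.⟦⟧-cong (≈⇒~ (Γ.sym x≈y))) (G.trans a≈ a≈b) }
          ; single   = λ { (t , a≈) → G.trans (G.sym a≈) (G.trans (f.⟦⟧-cong (≈ε⇒~ε Γ.refl)) f.ε-homo) }
          }

        graph-kills : ∀ φ → (∀ {x a} → graph x a → ⟦ φ ⟧ x G.≈ a) → Kills φ S
        graph-kills φ extends i i∈S = G.trans (extends (t , G.refl))
          (G.trans (f.⟦⟧-cong (resp (Γ.sym (-ε _)) (span-el i∈S))) f.ε-homo)
          where
          t = sat⇒torsion (span⊆sat (span-el i∈S))

    -- A character of the torsion subgroup is a partial homomorphism on Γ with domain `Sat S`, so it
    -- extends. The extension kills S because the entries of S are zero in the quotient.
    representatives : FinitelyGenerated Γ → Divisible G → ∀ {N} →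
      HasCardinality (Hom F G) N → ¬ ¬ Representatives S N
    representatives finitelyGenerated divisible bijection =
      ¬¬-choice (λ k → extend divisible finitelyGenerated (graph-isPartial (to k))) >>= λ lifts → return record
        { rep            = λ k → proj₁ (lifts k)
        ; rep-kills      = λ k → graph-kills (to k) (proj₁ (lifts k)) (proj₂ (lifts k))
        ; rep-injective  = λ {k} {l} agree → injective λ { (x , t) → G.trans (G.sym (proj₂ (lifts k) (t , G.refl)))
            (G.trans (agree x (torsion⇒sat t)) (proj₂ (lifts l) (t , G.refl))) }
        ; rep-surjective = λ φ kills → let k , to-k≈ = surjective (restrict φ kills) in
            k , λ x x∈ → G.trans (proj₂ (lifts k) (sat⇒torsion x∈ , G.refl)) (to-k≈ ≡.refl (x , sat⇒torsion x∈))
        }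
      where open Bijection bijection

-- Indicators and finite sums.

module Indicators where

  open import Relation.Binary.PropositionalEquality using (refl; sym; trans)
  open import Algebra.Properties.Semiring.Sum ℤ.+-*-semiring
    using (sum; sum-cong-≗; sum-replicate-zero; sum-remove)
  open import Data.Integer.Base using (_≤_; _+_; _*_; -_; _-_)
  open Forms

  𝟙 : ∀ {p} {P : Set p} → Dec P → ℤ
  𝟙 P? = if does P? then 1ℤ else 0ℤ

  𝟙-yes : ∀ {p} {P : Set p} (P? : Dec P) → P → 𝟙 P? ≡ 1ℤ
  𝟙-yes (yes _) p = refl
  𝟙-yes (no ¬p) p = contradiction p ¬p

  𝟙-no : ∀ {p} {P : Set p} (P? : Dec P) → ¬ P → 𝟙 P? ≡ 0ℤ
  𝟙-no (yes p) ¬p = contradiction p ¬p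
  𝟙-no (no _)  ¬p = refl

  𝟙-cong : ∀ {p q} {P : Set p} {Q : Set q} (P? : Dec P) (Q? : Dec Q) → (P → Q) → (Q → P) → 𝟙 P? ≡ 𝟙 Q?
  𝟙-cong (yes p) Q? to from = sym (𝟙-yes Q? (to p))
  𝟙-cong (no ¬p) Q? to from = sym (𝟙-no Q? (¬p ∘ from))

  𝟙-nonneg : ∀ {p} {P : Set p} (P? : Dec P) → 0ℤ ≤ 𝟙 P?
  𝟙-nonneg (yes _) = ℤ.+≤+ ℕ.z≤n
  𝟙-nonneg (no _)  = ℤ.≤-refl

  𝟙-≤1 : ∀ {p} {P : Set p} (P? : Dec P) → 0ℤ ≤ 1ℤ + -1ℤ * 𝟙 P?
  𝟙-≤1 (yes _) = ℤ.≤-refl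
  𝟙-≤1 (no _)  = ℤ.+≤+ ℕ.z≤n

  sum-zero : ∀ {n} (f : Fin n → ℤ) → (∀ k → f k ≡ 0ℤ) → sum f ≡ 0ℤ
  sum-zero {n} f f≡0 = trans (sum-cong-≗ f≡0) (sum-replicate-zero n)

  sum-single : ∀ {n} (f : Fin n → ℤ) i → (∀ k → k ≢ i → f k ≡ 0ℤ) → sum f ≡ f i
  sum-single {suc n} f i f≡0 = trans (sum-remove {i = i} f)
    (trans (cong (f i +_) (sum-zero (f ∘ punchIn i) λ k → f≡0 (punchIn i k) (Fin.punchInᵢ≢i i k))) (ℤ.+-identityʳ (f i)))

  sum-const : ∀ n a → sum {n} (λ _ → a) ≡ ℤ.+ n * a
  sum-const zero    a = sym (ℤ.*-zeroˡ a)
  sum-const (suc n) a = trans (cong (a +_) (sum-const n a)) (sym (ℤ.suc-* (ℤ.+ n) a))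

  term≤sum : ∀ {n} (f : Fin n → ℤ) i → (∀ k → 0ℤ ≤ f k) → f i ≤ sum f
  term≤sum {suc n} f i f≥0 = ℤ.≤-trans
    (ℤ.≤-reflexive (sym (ℤ.+-identityʳ (f i))))
    (ℤ.≤-trans (ℤ.+-monoʳ-≤ (f i) (sum-nonneg (f ∘ punchIn i) (f≥0 ∘ punchIn i)))
               (ℤ.≤-reflexive (sym (sum-remove {i = i} f))))

-- Averaging over subgroups of a finite abelian group.

module Averages {N : ℕ} {_∙_ : Op₂ (Fin N)} {ε : Fin N} {_⁻¹ : Op₁ (Fin N)}
  (isAbelianGroup : IsAbelianGroup _≡_ _∙_ ε _⁻¹) where

  open CommutativeSemigroupProperties ℤ.*-commutativeSemigroup using (x∙yz≈y∙xz)
  open import Relation.Binary.PropositionalEquality using (refl; sym; trans)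
  open import Algebra.Properties.Semiring.Sum ℤ.+-*-semiring
    using (sum; ∑-distrib-+; ∑-comm; sum-cong-≗; *-distribˡ-sum; *-distribʳ-sum; sum-permute)
  open import Data.Integer.Base using (_≤_; _+_; _*_; -_; _-_)
  open IsAbelianGroup isAbelianGroup using (assoc; comm; identityˡ; identityʳ; inverseˡ; inverseʳ)
  open Forms
  open Indicators
  open Statuses
  open DeletionContraction
  open LeafPositivity
  open ≡-Reasoning

  private
    V : Set
    V = Fin N → ℤ

  cancelʳ : ∀ k l → (k ∙ l) ∙ (l ⁻¹) ≡ k
  cancelʳ k l = trans (assoc k l (l ⁻¹)) (trans (cong (k ∙_) (inverseʳ l)) (identityʳ k))

  cancelʳ′ : ∀ k l → (k ∙ (l ⁻¹)) ∙ l ≡ k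
  cancelʳ′ k l = trans (assoc k (l ⁻¹) l) (trans (cong (k ∙_) (inverseˡ l)) (identityʳ k))

  ⁻¹-involutive : ∀ k → (k ⁻¹) ⁻¹ ≡ k
  ⁻¹-involutive k = begin
    (k ⁻¹) ⁻¹              ≡⟨ identityˡ _ ⟨
    ε ∙ ((k ⁻¹) ⁻¹)        ≡⟨ cong (_∙ ((k ⁻¹) ⁻¹)) (inverseʳ k) ⟨
    (k ∙ (k ⁻¹)) ∙ ((k ⁻¹) ⁻¹)  ≡⟨ cancelʳ k (k ⁻¹) ⟩
    k                      ∎

  sum-translate : ∀ (f : V) l → sum f ≡ sum λ k → f (k ∙ l)
  sum-translate f l = sum-permute f (Permutation.permutation (_∙ l) (_∙ (l ⁻¹)) (λ k → cancelʳ′ k l) (λ k → cancelʳ k l))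

  sum-invert : ∀ (f : V) → sum f ≡ sum λ k → f (k ⁻¹)
  sum-invert f = sum-permute f (Permutation.permutation _⁻¹ _⁻¹ ⁻¹-involutive ⁻¹-involutive)

  record DecSubgroup (p : Level) : Set (Level.suc p) where
    field
      Mem       : Fin N → Set p
      mem?      : ∀ k → Dec (Mem k)
      ε-closed  : Mem ε
      ∙-closed  : ∀ {k l} → Mem k → Mem l → Mem (k ∙ l)
      ⁻¹-closed : ∀ {k} → Mem k → Mem (k ⁻¹)

    order : ℤ
    order = sum λ k → 𝟙 (mem? k)

  module _ {p} (H : DecSubgroup p) where

    open DecSubgroup H

    private
      χ : V
      χ k = 𝟙 (mem? k)

    -- The average over H multiplied by the order of H, which keeps it integral.
    translateSum : V → V
    translateSum u k = sum λ l → χ l * u (k ∙ l)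

    χ-translate : ∀ {l} → Mem l → ∀ k → χ (k ∙ l) ≡ χ k
    χ-translate {l} l∈ k = 𝟙-cong (mem? (k ∙ l)) (mem? k)
      (λ kl∈ → subst Mem (cancelʳ k l) (∙-closed kl∈ (⁻¹-closed l∈))) (λ k∈ → ∙-closed k∈ l∈)

    χ-invert : ∀ k → χ (k ⁻¹) ≡ χ k
    χ-invert k = 𝟙-cong (mem? (k ⁻¹)) (mem? k) (λ k⁻¹∈ → subst Mem (⁻¹-involutive k) (⁻¹-closed k⁻¹∈)) ⁻¹-closed

    translateSum-invariant : ∀ u {l} → Mem l → ∀ k → translateSum u (k ∙ l) ≡ translateSum u k
    translateSum-invariant u {l} l∈ k = begin
      sum (λ m → χ m * u ((k ∙ l) ∙ m))          ≡⟨ sum-cong-≗ (λ m → cong₂ _*_ (sym (χ-translate l∈ m))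
                                                      (cong u (trans (assoc k l m) (cong (k ∙_) (comm l m))))) ⟩
      sum (λ m → χ (m ∙ l) * u (k ∙ (m ∙ l)))    ≡⟨ sum-translate (λ m → χ m * u (k ∙ m)) l ⟨
      sum (λ m → χ m * u (k ∙ m))                ∎

    translateSum-linear : IsLinear translateSum
    translateSum-linear = record
      { op-cong = λ u≗v k → sum-cong-≗ λ l → cong (χ l *_) (u≗v (k ∙ l))
      ; op-+    = λ u v k → trans (sum-cong-≗ λ l → ℤ.*-distribˡ-+ (χ l) (u (k ∙ l)) (v (k ∙ l)))
                                  (∑-distrib-+ (λ l → χ l * u (k ∙ l)) (λ l → χ l * v (k ∙ l)))
      ; op-*    = λ a u k → trans (sum-cong-≗ λ l → x∙yz≈y∙xz (χ l) a (u (k ∙ l)))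
                                  (sym (*-distribˡ-sum a λ l → χ l * u (k ∙ l)))
      }

    -- Translation by l is adjoint to translation by its inverse, and the subgroup is closed under
    -- inverses.
    translateSum-symmetric : ∀ u v → ⟨ translateSum u , v ⟩ ≡ ⟨ u , translateSum v ⟩
    translateSum-symmetric u v = begin
      sum (λ k → sum (λ l → χ l * u (k ∙ l)) * v k)
        ≡⟨ sum-cong-≗ (λ k → trans (*-distribʳ-sum (v k) λ l → χ l * u (k ∙ l)) (sum-cong-≗ λ l → ℤ.*-assoc (χ l) (u (k ∙ l)) (v k))) ⟩
      sum (λ k → sum λ l → χ l * (u (k ∙ l) * v k))
        ≡⟨ ∑-comm (λ k l → χ l * (u (k ∙ l) * v k)) ⟩
      sum (λ l → sum λ k → χ l * (u (k ∙ l) * v k))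
        ≡⟨ sum-cong-≗ (λ l → *-distribˡ-sum (χ l) λ k → u (k ∙ l) * v k) ⟨
      sum (λ l → χ l * sum λ k → u (k ∙ l) * v k)
        ≡⟨ sum-cong-≗ (λ l → cong₂ _*_ (sym (χ-invert l)) (shifted l)) ⟩
      sum (λ l → χ (l ⁻¹) * sum λ k → u k * v (k ∙ (l ⁻¹)))
        ≡⟨ sum-invert (λ l → χ l * sum λ k → u k * v (k ∙ l)) ⟨
      sum (λ l → χ l * sum λ k → u k * v (k ∙ l))
        ≡⟨ sum-cong-≗ (λ l → *-distribˡ-sum (χ l) λ k → u k * v (k ∙ l)) ⟩
      sum (λ l → sum λ k → χ l * (u k * v (k ∙ l)))
        ≡⟨ ∑-comm (λ l k → χ l * (u k * v (k ∙ l))) ⟩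
      sum (λ k → sum λ l → χ l * (u k * v (k ∙ l)))
        ≡⟨ sum-cong-≗ (λ k → trans (*-distribˡ-sum (u k) λ l → χ l * v (k ∙ l)) (sum-cong-≗ λ l → x∙yz≈y∙xz (u k) (χ l) (v (k ∙ l)))) ⟨
      sum (λ k → u k * sum λ l → χ l * v (k ∙ l)) ∎
      where
      shifted : ∀ l → sum (λ k → u (k ∙ l) * v k) ≡ sum λ k → u k * v (k ∙ (l ⁻¹))
      shifted l = trans (sum-cong-≗ λ k → cong (λ m → u (k ∙ l) * v m) (sym (cancelʳ k l)))
                        (sym (sum-translate (λ k → u k * v (k ∙ (l ⁻¹))) l))

    translateSum² : ∀ u → translateSum (translateSum u) ≗ λ k → order * translateSum u k
    translateSum² u k = trans (sum-cong-≗ λ l → pointwise l (mem? l))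
      (sym (*-distribʳ-sum (translateSum u k) χ))
      where
      pointwise : ∀ l (l∈? : Dec (Mem l)) → 𝟙 l∈? * translateSum u (k ∙ l) ≡ 𝟙 l∈? * translateSum u k
      pointwise l (yes l∈) = cong (1ℤ *_) (translateSum-invariant u l∈ k)
      pointwise l (no _)   = refl

    order-positive : ℤ.Positive order
    order-positive = ℤ.positive (ℤ.<-≤-trans (ℤ.+<+ ℕ.z<s)
      (ℤ.≤-trans (ℤ.≤-reflexive (sym (𝟙-yes (mem? ε) ε-closed))) (term≤sum χ ε (λ k → 𝟙-nonneg (mem? k)))))

    average : ScaledProjection
    average = record
      { op        = translateSum
      ; scale     = order
      ; scale-pos = order-positive
      ; isLinear  = translateSum-linear
      ; symmetric = translateSum-symmetric
      ; op-op     = translateSum²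
      }

    sum-translateSum : ∀ u → sum (translateSum u) ≡ order * sum u
    sum-translateSum u = begin
      sum (λ k → sum λ l → χ l * u (k ∙ l))  ≡⟨ ∑-comm (λ k l → χ l * u (k ∙ l)) ⟩
      sum (λ l → sum λ k → χ l * u (k ∙ l))  ≡⟨ sum-cong-≗ (λ l → *-distribˡ-sum (χ l) λ k → u (k ∙ l)) ⟨
      sum (λ l → χ l * sum λ k → u (k ∙ l))  ≡⟨ sum-cong-≗ (λ l → cong (χ l *_) (sym (sum-translate u l))) ⟩
      sum (λ l → χ l * sum u)                ≡⟨ *-distribʳ-sum (sum u) χ ⟨
      order * sum u                          ∎

  translateSum-commute : ∀ {p q} (H : DecSubgroup p) (H′ : DecSubgroup q) → Commute (translateSum H) (translateSum H′)
  translateSum-commute H H′ u k = begin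
    sum (λ l → χ l * sum λ m → χ′ m * u ((k ∙ l) ∙ m))
      ≡⟨ sum-cong-≗ (λ l → *-distribˡ-sum (χ l) λ m → χ′ m * u ((k ∙ l) ∙ m)) ⟩
    sum (λ l → sum λ m → χ l * (χ′ m * u ((k ∙ l) ∙ m)))
      ≡⟨ ∑-comm (λ l m → χ l * (χ′ m * u ((k ∙ l) ∙ m))) ⟩
    sum (λ m → sum λ l → χ l * (χ′ m * u ((k ∙ l) ∙ m)))
      ≡⟨ sum-cong-≗ (λ m → sum-cong-≗ λ l → trans (x∙yz≈y∙xz (χ l) (χ′ m) _) (cong (λ n → χ′ m * (χ l * u n)) (exchange k l m))) ⟩
    sum (λ m → sum λ l → χ′ m * (χ l * u ((k ∙ m) ∙ l)))
      ≡⟨ sum-cong-≗ (λ m → *-distribˡ-sum (χ′ m) λ l → χ l * u ((k ∙ m) ∙ l)) ⟨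
    sum (λ m → χ′ m * sum λ l → χ l * u ((k ∙ m) ∙ l)) ∎
    where
    χ χ′ : V
    χ  l = 𝟙 (DecSubgroup.mem? H l)
    χ′ m = 𝟙 (DecSubgroup.mem? H′ m)
    exchange : ∀ k l m → (k ∙ l) ∙ m ≡ (k ∙ m) ∙ l
    exchange k l m = trans (assoc k l m) (trans (cong (k ∙_) (comm l m)) (sym (assoc k m l)))

  SupportedOn : ∀ {q} → (Fin N → Set q) → V → Set q
  SupportedOn L v = ∀ k → ¬ L k → v k ≡ 0ℤ

  InvariantUnder : V → Fin N → Set
  InvariantUnder v l = ∀ k → v (k ∙ l) ≡ v k

  module _ {p : Level} where

    -- The common denominator D of a leaf: only the subgroups at free positions count.
    totalOrder : ∀ {n} → Vec Status n → (Fin n → DecSubgroup p) → ℤ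
    totalOrder []         H = 1ℤ
    totalOrder (free ∷ σ) H = DecSubgroup.order (H zero) * totalOrder σ (H ∘ suc)
    totalOrder (_    ∷ σ) H = totalOrder σ (H ∘ suc)

    totalOrder-positive : ∀ {n} (σ : Vec Status n) H → ℤ.Positive (totalOrder σ H)
    totalOrder-positive []         H = _
    totalOrder-positive (free ∷ σ) H = ℤ.positive (subst (ℤ._< h * totalOrder σ (H ∘ suc)) (ℤ.*-zeroʳ h)
      (ℤ.*-monoˡ-<-pos h {{order-positive (H zero)}} (ℤ.positive⁻¹ _ {{totalOrder-positive σ (H ∘ suc)}})))
      where h = DecSubgroup.order (H zero)
    totalOrder-positive (undecided  ∷ σ) H = totalOrder-positive σ (H ∘ suc)
    totalOrder-positive (contracted ∷ σ) H = totalOrder-positive σ (H ∘ suc)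
    totalOrder-positive (deleted    ∷ σ) H = totalOrder-positive σ (H ∘ suc)
    totalOrder-positive (torsion    ∷ σ) H = totalOrder-positive σ (H ∘ suc)

    -- Each free position multiplies the mass by the order of its subgroup, inside S through the
    -- scale and outside S through the translates. This is why the result does not depend on S.
    sum-filter : ∀ {n} (σ : Vec Status n) S H v → sum (filter σ S (average ∘ H) v) ≡ totalOrder σ H * sum v
    sum-filter []         []            H v = sym (ℤ.*-identityˡ (sum v))
    sum-filter (free ∷ σ) (inside  ∷ S) H v = trans
      (sym (*-distribˡ-sum (DecSubgroup.order (H zero)) (filter σ S (average ∘ H ∘ suc) v)))
      (trans (cong (DecSubgroup.order (H zero) *_) (sum-filter σ S (H ∘ suc) v))
             (sym (ℤ.*-assoc (DecSubgroup.order (H zero)) (totalOrder σ (H ∘ suc)) (sum v))))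
    sum-filter (free ∷ σ) (outside ∷ S) H v = trans (sum-filter σ S (H ∘ suc) (translateSum (H zero) v))
      (trans (cong (totalOrder σ (H ∘ suc) *_) (sum-translateSum (H zero) v))
             (regroup (totalOrder σ (H ∘ suc)) (DecSubgroup.order (H zero)) (sum v)))
      where
      regroup : ∀ a b c → a * (b * c) ≡ b * a * c
      regroup = solve-∀
    sum-filter (undecided  ∷ σ) (_ ∷ S) H v = sum-filter σ S (H ∘ suc) v
    sum-filter (contracted ∷ σ) (_ ∷ S) H v = sum-filter σ S (H ∘ suc) v
    sum-filter (deleted    ∷ σ) (_ ∷ S) H v = sum-filter σ S (H ∘ suc) v
    sum-filter (torsion    ∷ σ) (_ ∷ S) H v = sum-filter σ S (H ∘ suc) v

    -- Since the operators commute, the sum over translates belonging to f may be taken last, and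
    -- its output is invariant under `H f`.
    filter-invariant : ∀ {n} (σ : Vec Status n) S (H : Fin n → DecSubgroup p) v f →
      lookup σ f ≡ free → lookup S f ≡ outside → ∀ {l} → DecSubgroup.Mem (H f) l →
      InvariantUnder (filter σ S (average ∘ H) v) l
    filter-invariant (free ∷ σ) (outside ∷ S) H v zero σf Sf {l} l∈ k = begin
      filter σ S (average ∘ H ∘ suc) (translateSum (H zero) v) (k ∙ l)
        ≡⟨ commute v (k ∙ l) ⟨
      translateSum (H zero) (filter σ S (average ∘ H ∘ suc) v) (k ∙ l)
        ≡⟨ translateSum-invariant (H zero) (filter σ S (average ∘ H ∘ suc) v) l∈ k ⟩
      translateSum (H zero) (filter σ S (average ∘ H ∘ suc) v) k
        ≡⟨ commute v k ⟩
      filter σ S (average ∘ H ∘ suc) (translateSum (H zero) v) k ∎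
      where
      commute = filter-commute σ S (average ∘ H ∘ suc) (average (H zero)) (λ f → translateSum-commute (H zero) (H (suc f)))
    filter-invariant (free ∷ σ) (inside  ∷ S) H v (suc f) σf Sf l∈ k =
      cong (DecSubgroup.order (H zero) *_) (filter-invariant σ S (H ∘ suc) v f σf Sf l∈ k)
    filter-invariant (free ∷ σ) (outside ∷ S) H v (suc f) σf Sf l∈ =
      filter-invariant σ S (H ∘ suc) (translateSum (H zero) v) f σf Sf l∈
    filter-invariant (undecided  ∷ σ) (_ ∷ S) H v (suc f) σf Sf l∈ = filter-invariant σ S (H ∘ suc) v f σf Sf l∈
    filter-invariant (contracted ∷ σ) (_ ∷ S) H v (suc f) σf Sf l∈ = filter-invariant σ S (H ∘ suc) v f σf Sf l∈
    filter-invariant (deleted    ∷ σ) (_ ∷ S) H v (suc f) σf Sf l∈ = filter-invariant σ S (H ∘ suc) v f σf Sf l∈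
    filter-invariant (torsion    ∷ σ) (_ ∷ S) H v (suc f) σf Sf l∈ = filter-invariant σ S (H ∘ suc) v f σf Sf l∈

    module _ {q} (L : DecSubgroup q) where

      open DecSubgroup L

      translateSum-supported : ∀ (H : DecSubgroup p) → (∀ {k} → DecSubgroup.Mem H k → Mem k) →
        ∀ v → SupportedOn Mem v → SupportedOn Mem (translateSum H v)
      translateSum-supported H H⊆L v v-supp k k∉ = sum-zero (λ l → 𝟙 (DecSubgroup.mem? H l) * v (k ∙ l))
        λ l → pointwise l (DecSubgroup.mem? H l)
        where
        pointwise : ∀ l (l∈? : Dec (DecSubgroup.Mem H l)) → 𝟙 l∈? * v (k ∙ l) ≡ 0ℤ
        pointwise l (yes l∈) = trans (ℤ.*-identityˡ _) (v-supp (k ∙ l)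
          λ kl∈ → k∉ (subst Mem (cancelʳ k l) (∙-closed kl∈ (⁻¹-closed (H⊆L l∈)))))
        pointwise l (no _)   = refl

      -- Only translations by elements of L occur, and these preserve both L and its complement.
      filter-supported : ∀ {n} (σ : Vec Status n) S (H : Fin n → DecSubgroup p) →
        (∀ f → lookup σ f ≡ free → lookup S f ≡ outside → ∀ {k} → DecSubgroup.Mem (H f) k → Mem k) →
        ∀ v → SupportedOn Mem v → SupportedOn Mem (filter σ S (average ∘ H) v)
      filter-supported [] [] H H⊆L v v-supp = v-supp
      filter-supported (free ∷ σ) (inside  ∷ S) H H⊆L v v-supp k k∉ =
        trans (cong (DecSubgroup.order (H zero) *_) (filter-supported σ S (H ∘ suc) (H⊆L ∘ suc) v v-supp k k∉))
              (ℤ.*-zeroʳ (DecSubgroup.order (H zero)))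
      filter-supported (free ∷ σ) (outside ∷ S) H H⊆L v v-supp =
        filter-supported σ S (H ∘ suc) (H⊆L ∘ suc) (translateSum (H zero) v)
          (translateSum-supported (H zero) (H⊆L zero refl refl) v v-supp)
      filter-supported (undecided  ∷ σ) (_ ∷ S) H H⊆L = filter-supported σ S (H ∘ suc) (H⊆L ∘ suc)
      filter-supported (contracted ∷ σ) (_ ∷ S) H H⊆L = filter-supported σ S (H ∘ suc) (H⊆L ∘ suc)
      filter-supported (deleted    ∷ σ) (_ ∷ S) H H⊆L = filter-supported σ S (H ∘ suc) (H⊆L ∘ suc)
      filter-supported (torsion    ∷ σ) (_ ∷ S) H H⊆L = filter-supported σ S (H ∘ suc) (H⊆L ∘ suc)

  δ : V
  δ k = 𝟙 (k Fin.≟ ε)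

  sum-δ : sum δ ≡ 1ℤ
  sum-δ = trans (sum-single δ ε λ k k≢ε → 𝟙-no (k Fin.≟ ε) k≢ε) (𝟙-yes (ε Fin.≟ ε) refl)

  ⟨_,δ⟩ : ∀ u → ⟨ u , δ ⟩ ≡ u ε
  ⟨ u ,δ⟩ = trans (sum-single (λ k → u k * δ k) ε λ k k≢ε → trans (cong (u k *_) (𝟙-no (k Fin.≟ ε) k≢ε)) (ℤ.*-zeroʳ (u k)))
    (trans (cong (u ε *_) (𝟙-yes (ε Fin.≟ ε) refl)) (ℤ.*-identityʳ (u ε)))

  -- filter δ is constant on the subgroup generated by the translations that were averaged
  -- over, vanishes off it, and has total mass totalOrder.
  filter-δ : ∀ {n p q} (σ : Vec Status n) S (H : Fin n → DecSubgroup p) (L : DecSubgroup q) →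
    (∀ f → lookup σ f ≡ free → lookup S f ≡ outside → ∀ {k} → DecSubgroup.Mem (H f) k → DecSubgroup.Mem L k) →
    (∀ {l} → DecSubgroup.Mem L l → InvariantUnder (filter σ S (average ∘ H) δ) l) →
    DecSubgroup.order L * ⟨ filter σ S (average ∘ H) δ , δ ⟩ ≡ totalOrder σ H
  filter-δ σ S H L H⊆L invariant = begin
    order * ⟨ Q , δ ⟩                 ≡⟨ cong (order *_) ⟨ Q ,δ⟩ ⟩
    order * Q ε                       ≡⟨ *-distribʳ-sum (Q ε) (λ k → 𝟙 (mem? k)) ⟩
    sum (λ k → 𝟙 (mem? k) * Q ε)      ≡⟨ sum-cong-≗ (λ k → pointwise k (mem? k)) ⟩
    sum Q                             ≡⟨ sum-filter σ S H δ ⟩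
    totalOrder σ H * sum δ            ≡⟨ cong (totalOrder σ H *_) sum-δ ⟩
    totalOrder σ H * 1ℤ               ≡⟨ ℤ.*-identityʳ _ ⟩
    totalOrder σ H                    ∎
    where
    open DecSubgroup L
    Q = filter σ S (average ∘ H) δ
    δ-supported : SupportedOn Mem δ
    δ-supported k k∉ = 𝟙-no (k Fin.≟ ε) λ { refl → k∉ ε-closed }
    pointwise : ∀ k (k∈? : Dec (Mem k)) → 𝟙 k∈? * Q ε ≡ Q k
    pointwise k (yes k∈) = trans (ℤ.*-identityˡ (Q ε)) (trans (sym (invariant k∈ ε)) (cong Q (identityˡ k)))
    pointwise k (no k∉)  = sym (filter-supported L σ S H H⊆L δ δ-supported k k∉)

-- The finite group K of characters and its annihilator subgroups.

module Characters {c ℓ g ℓg : Level} (Γ : AbelianGroup c ℓ) (𝒜 : List (AbelianGroup.Carrier Γ)) (G : AbelianGroup g ℓg) where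

  open Classical
  open Extension Γ G
  open Lifts Γ 𝒜 G
  open Spans Γ 𝒜
  open Subsets
  private
    module Γ where
      open AbelianGroup Γ public
      open Multiples Γ public
    module G where
      open AbelianGroup G public
      open Multiples G public

  private
    hom : (f : Γ.Carrier → G.Carrier) → (∀ {x y} → x Γ.≈ y → f x G.≈ f y) →
      (∀ x y → f (x Γ.∙ y) G.≈ f x G.∙ f y) → f Γ.ε G.≈ G.ε → (∀ x → f (x Γ.⁻¹) G.≈ f x G.⁻¹) → Homomorphism
    hom f f-cong f-∙ f-ε f-⁻¹ = record
      { ⟦_⟧ = f
      ; isGroupHomomorphism = record
        { isMonoidHomomorphism = record
          { isMagmaHomomorphism = record { isRelHomomorphism = record { cong = f-cong } ; homo = f-∙ }
          ; ε-homo = f-ε }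
        ; ⁻¹-homo = f-⁻¹ }
      }

  trivial : Homomorphism
  trivial = hom (λ _ → G.ε) (λ _ → G.refl) (λ _ _ → G.sym (G.identityˡ _)) G.refl (λ _ → G.sym G.ε⁻¹≈ε)

  infixl 6 _⊕_
  _⊕_ : Homomorphism → Homomorphism → Homomorphism
  φ ⊕ ψ = hom (λ x → ⟦ φ ⟧ x G.∙ ⟦ ψ ⟧ x)
    (λ x≈y → G.∙-cong (⟦⟧-cong φ x≈y) (⟦⟧-cong ψ x≈y))
    (λ x y → G.trans (G.∙-cong (∙-homo φ x y) (∙-homo ψ x y)) (G.interchange _ _ _ _))
    (G.trans (G.∙-cong (ε-homo φ) (ε-homo ψ)) (G.identityʳ _))
    (λ x → G.trans (G.∙-cong (⁻¹-homo φ x) (⁻¹-homo ψ x)) (G.⁻¹-∙-comm _ _))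

  ⊖_ : Homomorphism → Homomorphism
  ⊖ φ = hom (λ x → ⟦ φ ⟧ x G.⁻¹)
    (λ x≈y → G.⁻¹-cong (⟦⟧-cong φ x≈y))
    (λ x y → G.trans (G.⁻¹-cong (∙-homo φ x y)) (G.sym (G.⁻¹-∙-comm _ _)))
    (G.trans (G.⁻¹-cong (ε-homo φ)) G.ε⁻¹≈ε)
    (λ x → G.⁻¹-cong (⁻¹-homo φ x))

  module CharacterGroup {B : Subset (length 𝒜)} {N : ℕ} (representatives : Representatives B N) where

    open Representatives representatives

    index : ∀ φ → Kills φ B → Fin N
    index φ kills = proj₁ (rep-surjective φ kills)

    rep-index : ∀ φ kills {x} → Sat B x → ⟦ rep (index φ kills) ⟧ x G.≈ ⟦ φ ⟧ x
    rep-index φ kills = proj₂ (rep-surjective φ kills) _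

    infixl 7 _∙_
    infix 8 _⁻¹
    _∙_ : Op₂ (Fin N)
    k ∙ l = index (rep k ⊕ rep l) λ i i∈B → G.trans (G.∙-cong (rep-kills k i i∈B) (rep-kills l i i∈B)) (G.identityʳ _)

    _⁻¹ : Op₁ (Fin N)
    k ⁻¹ = index (⊖ rep k) λ i i∈B → G.trans (G.⁻¹-cong (rep-kills k i i∈B)) G.ε⁻¹≈ε

    ε : Fin N
    ε = index trivial λ _ _ → G.refl

    rep-∙ : ∀ k l {x} → Sat B x → ⟦ rep (k ∙ l) ⟧ x G.≈ ⟦ rep k ⟧ x G.∙ ⟦ rep l ⟧ x
    rep-∙ k l = rep-index (rep k ⊕ rep l) _

    rep-⁻¹ : ∀ k {x} → Sat B x → ⟦ rep (k ⁻¹) ⟧ x G.≈ ⟦ rep k ⟧ x G.⁻¹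
    rep-⁻¹ k = rep-index (⊖ rep k) _

    rep-ε : ∀ {x} → Sat B x → ⟦ rep ε ⟧ x G.≈ G.ε
    rep-ε = rep-index trivial _

    private
      rawGroup : RawGroup _ _
      rawGroup = record { Carrier = Fin N ; _≈_ = _≡_ ; _∙_ = _∙_ ; ε = ε ; _⁻¹ = _⁻¹ }

      functions : AbelianGroup _ _
      functions = Pointwise.abelianGroup (Σ Γ.Carrier (Sat B)) G

      -- The chosen lifts are not closed under addition, but on `Sat B` the operations on indices
      -- become pointwise operations. The group laws are therefore pulled back from the functions on
      -- `Sat B`.
      isGroupMonomorphism : IsGroupMonomorphism rawGroup (AbelianGroup.rawGroup functions) λ k (x , _) → ⟦ rep k ⟧ x
      isGroupMonomorphism = record
        { isGroupHomomorphism = record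
          { isMonoidHomomorphism = record
            { isMagmaHomomorphism = record
              { isRelHomomorphism = record { cong = λ { ≡.refl _ → G.refl } }
              ; homo = λ k l (_ , x∈) → rep-∙ k l x∈
              }
            ; ε-homo = λ (_ , x∈) → rep-ε x∈
            }
          ; ⁻¹-homo = λ k (_ , x∈) → rep-⁻¹ k x∈
          }
        ; injective = λ agree → rep-injective λ x x∈ → agree (x , x∈)
        }

    isAbelianGroup : IsAbelianGroup _≡_ _∙_ ε _⁻¹
    isAbelianGroup = GroupMonomorphism.isAbelianGroup isGroupMonomorphism (AbelianGroup.isAbelianGroup functions)

    open Averages isAbelianGroup public

    -- For U ⊆ B every representative already vanishes on the span of U; the condition concerns the
    -- rest of the saturation.
    Annihilates : Subset (length 𝒜) → Fin N → Set _
    Annihilates U k = ∀ x → Sat U x → ⟦ rep k ⟧ x G.≈ G.ε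

    module _ {U : Subset (length 𝒜)} (U⊆B : U ⊆ B) where

      annihilates-ε : Annihilates U ε
      annihilates-ε x x∈U = rep-ε (sat-mono U⊆B x∈U)

      annihilates-∙ : ∀ {k l} → Annihilates U k → Annihilates U l → Annihilates U (k ∙ l)
      annihilates-∙ {k} {l} k≈ε l≈ε x x∈U = G.trans (rep-∙ k l (sat-mono U⊆B x∈U))
        (G.trans (G.∙-cong (k≈ε x x∈U) (l≈ε x x∈U)) (G.identityʳ _))

      annihilates-⁻¹ : ∀ {k} → Annihilates U k → Annihilates U (k ⁻¹)
      annihilates-⁻¹ {k} k≈ε x x∈U = G.trans (rep-⁻¹ k (sat-mono U⊆B x∈U)) (G.trans (G.⁻¹-cong (k≈ε x x∈U)) G.ε⁻¹≈ε)

      annihilator : (∀ k → Dec (Annihilates U k)) → DecSubgroup _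
      annihilator annihilates? = record
        { Mem = Annihilates U ; mem? = annihilates? ; ε-closed = annihilates-ε
        ; ∙-closed = annihilates-∙ ; ⁻¹-closed = annihilates-⁻¹ }

    characterGroup : AbelianGroup _ _
    characterGroup = record { isAbelianGroup = isAbelianGroup }

    private
      module K = AbelianGroup characterGroup
      module Kₚ = AbelianGroupProperties characterGroup

    module _ (divisible : Divisible G) (finitelyGenerated : FinitelyGenerated Γ) (indep : Independent B) where

      -- By divisibility a character vanishing on Sat U ∩ Sat (drop f B) can be cut off outside
      -- Sat (add f U); the cut-off vanishes on Sat (drop f B).
      cut-off : ∀ U f → U ⊆ B → f ∈ B → f ∉ U → ∀ k → Annihilates U k →
        ¬ ¬ (∃ λ l → Annihilates (drop f B) l × Annihilates (add f U) (k ∙ l ⁻¹))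
      cut-off U f U⊆B f∈B f∉U k k≈ε =
        glue divisible finitelyGenerated (sat-isSubgroup (add f U)) (sat-isSubgroup (drop f B)) sat-resp (rep k) disjoint >>= λ
          { (ψ , ψ≈k , ψ≈ε) →
            let
              kills : Kills ψ B
              kills = λ i i∈B → kills-el ψ ψ≈k ψ≈ε i i∈B (i Fin.≟ f)
              l = index ψ kills
            in return (l
              , (λ x x∈ → G.trans (rep-index ψ kills (sat-mono (drop-⊆ f) x∈)) (ψ≈ε x∈))
              , (λ x x∈ → let x∈B = sat-mono add⊆B x∈ in
                  G.trans (rep-∙ k (l ⁻¹) x∈B) (G.trans
                    (G.∙-congˡ (G.trans (rep-⁻¹ l x∈B) (G.⁻¹-cong (G.trans (rep-index ψ kills x∈B) (ψ≈k x∈)))))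
                    (G.inverseʳ _)))) }
        where
        add⊆B : add f U ⊆ B
        add⊆B = [ (λ { ≡.refl → f∈B }) , U⊆B ]′ ∘ ∈-add⁻
        meet⊆U : add f U ∩ drop f B ⊆ U
        meet⊆U i∈ with Subset.x∈p∩q⁻ (add f U) (drop f B) i∈
        ... | i∈add , i∈drop = [ (λ i≡f → contradiction i≡f (proj₁ (∈-drop⁻ i∈drop))) , id ]′ (∈-add⁻ i∈add)
        disjoint : ∀ {x} → Sat (add f U) x → Sat (drop f B) x → ⟦ rep k ⟧ x G.≈ G.ε
        disjoint {x} (d , d>0 , dx∈) x∈ = k≈ε x (d , d>0 , span-mono meet⊆U
          (independent-∩ indep add⊆B (drop-⊆ f) dx∈ (IsSubgroup×.×-closed d x∈)))
          where module IsSubgroup× = Multiples.Closure Γ (sat-isSubgroup (drop f B))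
        kills-el : ∀ ψ → (∀ {x} → Sat (add f U) x → ⟦ ψ ⟧ x G.≈ ⟦ rep k ⟧ x) → (∀ {x} → Sat (drop f B) x → ⟦ ψ ⟧ x G.≈ G.ε) →
          ∀ i → i ∈ B → Dec (i ≡ f) → ⟦ ψ ⟧ (el i) G.≈ G.ε
        kills-el ψ ψ≈k ψ≈ε i i∈B (yes ≡.refl) = G.trans (ψ≈k (span⊆sat (span-el (∈-add i)))) (rep-kills k i i∈B)
        kills-el ψ ψ≈k ψ≈ε i i∈B (no i≢f)     = ψ≈ε (span⊆sat (span-el (∈-drop⁺ i≢f i∈B)))

      -- The annihilator of U is generated by those of the `drop f B` with f in B outside U, stated
      -- as an induction principle. As U grows to B, each new f splits off a piece annihilating
      -- `drop f B`; with l the remainder, P is carried along for the part k ∙ l ⁻¹ already split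
      -- off.
      annihilator-decomposes : ∀ {U} → U ⊆ B → ∀ {q} (P : Fin N → Set q) →
        (∀ {k l} → P k → P l → P (k ∙ l)) → P ε →
        (∀ f → f ∈ B → f ∉ U → ∀ {l} → Annihilates (drop f B) l → P l) →
        ∀ {k} → Annihilates U k → ¬ ¬ P k
      annihilator-decomposes {U} U⊆B P P-∙ P-ε generators {k} k≈ε = remainder >>= λ { (l , l≈ε , Pkl) →
        -- A remainder that annihilates all of `Sat B` is the neutral index, so the part split off
        -- is k itself.
        let l≡ε = rep-injective (λ x x∈ → G.trans (l≈ε x x∈) (G.sym (rep-ε x∈))) in
        return (subst P (≡.trans (cong (λ l → k ∙ l ⁻¹) l≡ε) (≡.trans (cong (k ∙_) Kₚ.ε⁻¹≈ε) (K.identityʳ k))) Pkl) }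
        where
        remainder : ¬ ¬ (∃ λ l → Annihilates B l × P (k ∙ l ⁻¹))
        remainder = grow (λ U′ → ¬ ¬ (∃ λ l → Annihilates U′ l × P (k ∙ l ⁻¹))) U⊆B
          (λ U′ f U⊆U′ U′⊆B f∉U′ f∈B ¬¬step → ¬¬step >>= λ { (l , l≈ε , Pkl) →
            cut-off U′ f U′⊆B f∈B f∉U′ l l≈ε >>= λ { (l′ , l′≈ε , ll′≈ε) →
            return (l ∙ l′ ⁻¹ , ll′≈ε
              , subst P (regroup l l′) (P-∙ Pkl (generators f f∈B (f∉U′ ∘ U⊆U′) l′≈ε))) } })
          (return (k , k≈ε , subst P (≡.sym (K.inverseʳ k)) P-ε))
          where
          regroup : ∀ l l′ → (k ∙ l ⁻¹) ∙ l′ ≡ k ∙ (l ∙ l′ ⁻¹) ⁻¹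
          regroup l l′ = ≡.trans (K.assoc k (l ⁻¹) l′) (cong (k ∙_) (≡.trans
            (cong (l ⁻¹ ∙_) (≡.sym (⁻¹-involutive l′))) (Kₚ.⁻¹-∙-comm l (l′ ⁻¹))))

-- Multiplicities at a leaf, by counting characters.

module Leaves {c ℓ g ℓg : Level} (Γ : AbelianGroup c ℓ) (finitelyGenerated : FinitelyGenerated Γ)
  (𝒜 : List (AbelianGroup.Carrier Γ)) (G : AbelianGroup g ℓg) (divisible : Divisible G)
  {r m : Subset (length 𝒜) → ℕ} (isRank : IsRankFunction Γ 𝒜 r) (isMultiplicity : IsMultiplicityFunction Γ 𝒜 G m)
  {σ : Vec Statuses.Status (length 𝒜)} (decided : DeletionContraction.Decided σ) (minor : DeletionContraction.Minor r σ) where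

  open import Algebra.Properties.Semiring.Sum ℤ.+-*-semiring
    using (sum; ∑-comm; sum-cong-≗)
  open Classical
  open Coefficients
  open Statuses
  open Subsets
  open DeletionContraction
  open Forms
  open Indicators
  open LeafPositivity
  open Extension Γ G
  open Lifts Γ 𝒜 G
  open Characters Γ 𝒜 G
  open Spans Γ 𝒜
  open Ranks Γ 𝒜
  open Minor minor
  private
    module G = AbelianGroup G
    isMatroid = isMatroidRank isRank
    B = kept σ

  B-independent : Independent B
  B-independent = rank⇒independent isRank (kept-independent isMatroid decided minor)

  module _ (representatives-B : Representatives B (m B))
           (base-sat : ∀ t → lookup σ t ≡ torsion → Sat (base σ) (el t)) where

    open CharacterGroup representatives-B
    open Representatives representatives-B

    module _ (annihilates-drop? : ∀ f k → Dec (Annihilates (drop f B) k))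
             (vanishes? : ∀ t k → Dec (⟦ rep k ⟧ (el t) G.≈ G.ε)) where

      H : Fin (length 𝒜) → DecSubgroup _
      H f = annihilator (drop-⊆ f) (annihilates-drop? f)

      κ : Fin (length 𝒜) → Fin (m B) → ℤ
      κ t k = 𝟙 (vanishes? t k)

      -- The map t records where the remaining positions lie in 𝒜 as the recursion strips off the
      -- front of the status vector.
      weight-kills : ∀ {n} (τ : Vec Status n) S (t : Fin n → Fin (length 𝒜)) k →
        (weight τ S (κ ∘ t) k ≡ 1ℤ × (∀ i → lookup τ i ≡ torsion → lookup S i ≡ inside → ⟦ rep k ⟧ (el (t i)) G.≈ G.ε)) ⊎
        (weight τ S (κ ∘ t) k ≡ 0ℤ × ∃ λ i → lookup S i ≡ inside × ¬ ⟦ rep k ⟧ (el (t i)) G.≈ G.ε)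
      weight-kills [] [] t k = inj₁ (≡.refl , λ ())
      weight-kills (torsion ∷ τ) (inside ∷ S) t k with vanishes? (t zero) k
      ... | no ≉ε = inj₂ (ℤ.*-zeroˡ (weight τ S (κ ∘ t ∘ suc) k) , zero , ≡.refl , ≉ε)
      ... | yes ≈ε with weight-kills τ S (t ∘ suc) k
      ...   | inj₁ (≡1 , all)      = inj₁ (≡.trans (ℤ.*-identityˡ _) ≡1 , λ { zero _ _ → ≈ε ; (suc i) → all i })
      ...   | inj₂ (≡0 , i , Sᵢ , ≉ε) = inj₂ (≡.trans (ℤ.*-identityˡ _) ≡0 , suc i , Sᵢ , ≉ε)
      weight-kills (torsion ∷ τ) (outside ∷ S) t k with weight-kills τ S (t ∘ suc) k
      ... | inj₁ (≡1 , all)         = inj₁ (≡1 , λ { zero _ () ; (suc i) → all i })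
      ... | inj₂ (≡0 , i , Sᵢ , ≉ε) = inj₂ (≡0 , suc i , Sᵢ , ≉ε)
      weight-kills (undecided ∷ τ) (_ ∷ S) t k with weight-kills τ S (t ∘ suc) k
      ... | inj₁ (≡1 , all)         = inj₁ (≡1 , λ { zero () ; (suc i) → all i })
      ... | inj₂ (≡0 , i , Sᵢ , ≉ε) = inj₂ (≡0 , suc i , Sᵢ , ≉ε)
      weight-kills (contracted ∷ τ) (_ ∷ S) t k with weight-kills τ S (t ∘ suc) k
      ... | inj₁ (≡1 , all)         = inj₁ (≡1 , λ { zero () ; (suc i) → all i })
      ... | inj₂ (≡0 , i , Sᵢ , ≉ε) = inj₂ (≡0 , suc i , Sᵢ , ≉ε)
      weight-kills (deleted ∷ τ) (_ ∷ S) t k with weight-kills τ S (t ∘ suc) k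
      ... | inj₁ (≡1 , all)         = inj₁ (≡1 , λ { zero () ; (suc i) → all i })
      ... | inj₂ (≡0 , i , Sᵢ , ≉ε) = inj₂ (≡0 , suc i , Sᵢ , ≉ε)
      weight-kills (free ∷ τ) (_ ∷ S) t k with weight-kills τ S (t ∘ suc) k
      ... | inj₁ (≡1 , all)         = inj₁ (≡1 , λ { zero () ; (suc i) → all i })
      ... | inj₂ (≡0 , i , Sᵢ , ≉ε) = inj₂ (≡0 , suc i , Sᵢ , ≉ε)

      module _ {S : Subset (length 𝒜)} (compatible : Compatible σ S) where

        private
          S₀ = B ∩ S

        S₀⊆B : S₀ ⊆ B
        S₀⊆B = Subset.p∩q⊆p B S

        S₀⊆S : S₀ ⊆ S
        S₀⊆S = Subset.p∩q⊆q B S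

        -- The torsion elements of S lie in the saturation of `base σ`, so they may enlarge the span
        -- but not the saturation.
        sat-kept : ∀ {x} → Sat S x → Sat S₀ x
        sat-kept = sat-closed el∈
          where
          el∈ : ∀ i → i ∈ S → Sat S₀ (el i)
          el∈ i i∈S with i Subset.∈? B
          ... | yes i∈B = span⊆sat (span-el (Subset.x∈p∩q⁺ (i∈B , i∈S)))
          ... | no  i∉B = sat-mono (base⊆kept∩S isMatroid decided minor compatible)
            (base-sat i (unkept-torsion isMatroid decided minor compatible i∈S i∉B))

        sat-B : ∀ {x} → Sat S x → Sat B x
        sat-B = sat-mono S₀⊆B ∘ sat-kept

        -- Restriction from the characters in K that kill S to those of (Γ/⟨S⟩)_tor is onto: φ is
        -- kept on `Sat S` and set to zero on the entries of B outside S.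
        lift-kills : ∀ φ → Kills φ S → ¬ ¬ (∃ λ k → AgreeOn (Sat S) (rep k) φ)
        lift-kills φ kills = glue divisible finitelyGenerated (sat-isSubgroup S) (span-isSubgroup (B ∩ ∁ S)) sat-resp φ disjoint >>= λ
          { (ψ , ψ≈φ , ψ≈ε) →
            let
              kills-B : Kills ψ B
              kills-B = λ i i∈B → kills-el ψ ψ≈φ ψ≈ε i i∈B (i Subset.∈? S)
            in return (index ψ kills-B , λ x x∈S → G.trans (rep-index ψ kills-B (sat-B x∈S)) (ψ≈φ x∈S)) }
          where
          -- The span of the complement is used, not its saturation: two saturations share the
          -- torsion of Γ, on which φ need not vanish.
          disjoint : ∀ {x} → Sat S x → Span (B ∩ ∁ S) x → ⟦ φ ⟧ x G.≈ G.ε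
          disjoint x∈S x∈ = kills-span φ kills (span-mono (S₀⊆S ∘ Subset.p∩q⊆q (B ∩ ∁ S) S₀)
            (independent-∩ B-independent (Subset.p∩q⊆p B (∁ S)) S₀⊆B x∈ (sat-kept x∈S)))
          kills-el : ∀ ψ → (∀ {x} → Sat S x → ⟦ ψ ⟧ x G.≈ ⟦ φ ⟧ x) → (∀ {x} → Span (B ∩ ∁ S) x → ⟦ ψ ⟧ x G.≈ G.ε) →
            ∀ i → i ∈ B → Dec (i ∈ S) → ⟦ ψ ⟧ (el i) G.≈ G.ε
          kills-el ψ ψ≈φ ψ≈ε i i∈B (yes i∈S) = G.trans (ψ≈φ (span⊆sat (span-el i∈S))) (kills i i∈S)
          kills-el ψ ψ≈φ ψ≈ε i i∈B (no i∉S)  = ψ≈ε (span-el (Subset.x∈p∩q⁺ (i∈B , Subset.x∉p⇒x∈∁p i∉S)))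

        module _ (annihilates? : ∀ k → Dec (Annihilates S₀ k)) where

          K-S : DecSubgroup _
          K-S = annihilator S₀⊆B annihilates?

          -- The subgroups averaged over are the K_{F ∖ f} with f free and outside S. They lie in
          -- K_X and generate it, so the mass D of the filtered δ is spread evenly over K_X.
          filter-mass : DecSubgroup.order K-S ℤ.* ⟨ filter σ S (average ∘ H) δ , δ ⟩ ≡ totalOrder σ H
          filter-mass = filter-δ σ S H K-S
            (λ f σf Sf k≈ε x x∈ → k≈ε x (sat-mono (λ {i} i∈S₀ → ∈-drop⁺
              (λ { ≡.refl → lookup⇒∉ Sf (S₀⊆S i∈S₀) }) (S₀⊆B i∈S₀)) x∈))
            -- The translations that preserve the filtered δ are closed under composition and
            -- contain every K_{F ∖ f} in question, so they contain K_X.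
            λ {l} l≈ε k → decidable-stable (_ ℤ.≟ _) (annihilator-decomposes divisible finitelyGenerated B-independent S₀⊆B
              (InvariantUnder Q)
              (λ {k} {l} k-inv l-inv j → ≡.trans (cong Q (≡.sym (K.assoc j k l))) (≡.trans (l-inv (j ∙ k)) (k-inv j)))
              (λ j → cong Q (K.identityʳ j))
              (λ f f∈B f∉S₀ l≈ε → filter-invariant σ S H δ f
                (kept-free isMatroid decided minor f∈B (λ f∈base → f∉S₀ (base⊆kept∩S isMatroid decided minor compatible f∈base)))
                (∉⇒lookup (λ f∈S → f∉S₀ (Subset.x∈p∩q⁺ (f∈B , f∈S)))) l≈ε)
              l≈ε >>= λ l-inv → return (l-inv k))
            where
            Q = filter σ S (average ∘ H) δ
            module K = IsAbelianGroup isAbelianGroup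

          module _ (representatives-S : Representatives S (m S)) where

            private module S = Representatives representatives-S

            module _ (agree? : ∀ k j → Dec (AgreeOn (Sat S) (rep k) (S.rep j)))
                     (lifts : ∀ j → ∃ λ k → AgreeOn (Sat S) (rep k) (S.rep j)) where

              -- A character in K that vanishes on Y kills S, so its restriction to `Sat S` is
              -- exactly one of the representatives; any other character agrees with none of them.
              sum-over-restrictions : ∀ k → weight σ S κ k ≡ sum λ j → 𝟙 (agree? k j)
              sum-over-restrictions k with weight-kills σ S id k
              ... | inj₁ (≡1 , vanishes) = ≡.trans ≡1 (≡.sym (≡.trans
                (sum-single _ j₀ λ j j≢j₀ → 𝟙-no (agree? k j) λ agree →
                  j≢j₀ (S.rep-injective λ x x∈S → G.trans (G.sym (agree x x∈S)) (G.sym (proj₂ restriction x x∈S))))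
                (𝟙-yes (agree? k j₀) λ x x∈S → G.sym (proj₂ restriction x x∈S))))
                where
                kills : Kills (rep k) S
                kills i i∈S with i Subset.∈? B
                ... | yes i∈B = rep-kills k i i∈B
                ... | no  i∉B = vanishes i (unkept-torsion isMatroid decided minor compatible i∈S i∉B) (Vec.[]=⇒lookup i∈S)
                restriction = S.rep-surjective (rep k) kills
                j₀ = proj₁ restriction
              ... | inj₂ (≡0 , i , Sᵢ , ≉ε) = ≡.trans ≡0 (≡.sym (sum-zero (λ j → 𝟙 (agree? k j)) λ j → 𝟙-no (agree? k j) λ agree →
                let i∈S = Vec.lookup⇒[]= i S Sᵢ in
                ≉ε (G.trans (agree (el i) (span⊆sat (span-el i∈S))) (S.rep-kills j i i∈S))))

              -- The fibre of the restriction over j is a coset of K_X; translating by one lift of j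
              -- identifies it with K_X.
              sum-over-lifts : ∀ j → sum (λ k → 𝟙 (agree? k j)) ≡ DecSubgroup.order K-S
              sum-over-lifts j with lifts j
              ... | l , l≈j = ≡.trans (sum-translate (λ k → 𝟙 (agree? k j)) l)
                (sum-cong-≗ λ k → 𝟙-cong (agree? (k ∙ l) j) (annihilates? k)
                  (λ agree x x∈S₀ → let x∈S = sat-mono S₀⊆S x∈S₀ in cancel (rep-∙ k l (sat-B x∈S)) (agree x x∈S) (l≈j x x∈S))
                  (λ k≈ε x x∈S → G.trans (rep-∙ k l (sat-B x∈S))
                    (G.trans (G.∙-congʳ (k≈ε x (sat-kept x∈S))) (G.trans (G.identityˡ _) (l≈j x x∈S)))))
                where
                cancel : ∀ {a b c d} → a G.≈ b G.∙ c → a G.≈ d → c G.≈ d → b G.≈ G.ε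
                cancel {a} {b} {c} {d} a≈bc a≈d c≈d = G.trans
                  (G.sym (G.trans (G.assoc b c (c G.⁻¹)) (G.trans (G.∙-congˡ (G.inverseʳ c)) (G.identityʳ b))))
                  (G.trans (G.∙-congʳ (G.trans (G.sym a≈bc) (G.trans a≈d (G.sym c≈d)))) (G.inverseʳ c))

              weight-total : sum (weight σ S κ) ≡ ℤ.+ m S ℤ.* DecSubgroup.order K-S
              weight-total = begin
                sum (weight σ S κ)                         ≡⟨ sum-cong-≗ sum-over-restrictions ⟩
                sum (λ k → sum λ j → 𝟙 (agree? k j))       ≡⟨ ∑-comm (λ k j → 𝟙 (agree? k j)) ⟩
                sum (λ j → sum λ k → 𝟙 (agree? k j))       ≡⟨ sum-cong-≗ sum-over-lifts ⟩
                sum {m S} (λ _ → DecSubgroup.order K-S)    ≡⟨ sum-const (m S) _ ⟩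
                ℤ.+ m S ℤ.* DecSubgroup.order K-S          ∎
                where open ≡-Reasoning

        -- The order of K_X links the two counts and drops out: it divides the number of characters
        -- in K vanishing on Y with quotient m(S), and D with quotient the diagonal entry.
        multiplicity : totalOrder σ H ℤ.* ℤ.+ m S ≡ sum (weight σ S κ) ℤ.* ⟨ filter σ S (average ∘ H) δ , δ ⟩
        multiplicity = decidable-stable (_ ℤ.≟ _)
          (¬¬-choice (λ k → ¬¬-excluded-middle {A = Annihilates S₀ k}) >>= λ annihilates? →
          representatives finitelyGenerated divisible (isMultiplicity S) >>= λ representatives-S →
          ¬¬-choice (λ k → ¬¬-choice λ j → ¬¬-excluded-middle
            {A = AgreeOn (Sat S) (rep k) (Representatives.rep representatives-S j)}) >>= λ agree? →
          ¬¬-choice (λ j → lift-kills (Representatives.rep representatives-S j) (Representatives.rep-kills representatives-S j)) >>= λ lifts →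
          return (combine (ℤ.+ m S) (DecSubgroup.order (K-S annihilates?)) _ (filter-mass annihilates?)
            (weight-total annihilates? representatives-S agree? lifts)))
          where
          combine : ∀ μ o q {D W} → o ℤ.* q ≡ D → W ≡ μ ℤ.* o → D ℤ.* μ ≡ W ℤ.* q
          combine μ o q ≡.refl ≡.refl = lemma μ o q
            where
            lemma : ∀ μ o q → o ℤ.* q ℤ.* μ ≡ μ ℤ.* o ℤ.* q
            lemma = solve-∀

      leaf-nonneg : ∀ i j → 0ℤ ≤ ∑[ σ ] (tutteTerm r m i j)
      leaf-nonneg i j = ℤ.*-cancelˡ-≤-pos 0ℤ _ D {{totalOrder-positive σ H}}
        (subst (_≤ D ℤ.* ∑[ σ ] (tutteTerm r m i j)) (≡.sym (ℤ.*-zeroʳ D))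
        (subst (0ℤ ≤_) (≡.sym (≡.trans (≡.sym (∑-* σ D (tutteTerm r m i j))) (∑-cong-compatible σ scaled)))
          -- Here v = δ picks out the diagonal entry at the neutral character, and w = 1 lets each
          -- character of K count once.
          (leafTerm-∑-nonneg σ (average ∘ H) κ (λ f g → translateSum-commute (H f) (H g))
            (λ t k → 𝟙-nonneg (vanishes? t k)) (λ t k → 𝟙-≤1 (vanishes? t k)) δ (λ _ → 1ℤ) (λ _ → ℤ.+≤+ ℕ.z≤n) i j)))
        where
        D = totalOrder σ H
        scaled : ∀ S → Compatible σ S → D ℤ.* tutteTerm r m i j S ≡ leafTerm σ (average ∘ H) κ δ (λ _ → 1ℤ) i j S
        scaled S compatible = begin
          D ℤ.* (ℤ.+ m S ℤ.* powerCoeff (r Subset.⊤ ∸ r S) i ℤ.* powerCoeff (∣ S ∣ ∸ r S) j)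
            ≡⟨ cong₂ (λ a b → D ℤ.* (ℤ.+ m S ℤ.* powerCoeff a i ℤ.* powerCoeff b j))
                 (corank-compatible isMatroid decided minor compatible) (nullity-compatible isMatroid decided minor compatible) ⟩
          D ℤ.* (ℤ.+ m S ℤ.* x ℤ.* y)
            ≡⟨ regroup D (ℤ.+ m S) x y ⟩
          D ℤ.* ℤ.+ m S ℤ.* x ℤ.* y
            ≡⟨ cong (λ a → a ℤ.* x ℤ.* y) (multiplicity compatible) ⟩
          sum (weight σ S κ) ℤ.* ⟨ filter σ S (average ∘ H) δ , δ ⟩ ℤ.* x ℤ.* y
            ≡⟨ cong (λ a → a ℤ.* ⟨ filter σ S (average ∘ H) δ , δ ⟩ ℤ.* x ℤ.* y) (sum-cong-≗ λ k → ≡.sym (ℤ.*-identityˡ (weight σ S κ k))) ⟩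
          ⟨ (λ _ → 1ℤ) , weight σ S κ ⟩ ℤ.* ⟨ filter σ S (average ∘ H) δ , δ ⟩ ℤ.* x ℤ.* y ∎
          where
          open ≡-Reasoning
          x = powerCoeff (freeOutside σ S) i
          y = powerCoeff (torsionInside σ S) j
          regroup : ∀ a b c d → a ℤ.* (b ℤ.* c ℤ.* d) ≡ a ℤ.* b ℤ.* c ℤ.* d
          regroup = solve-∀

  ∑-leaf-nonneg : ∀ i j → 0ℤ ≤ ∑[ σ ] (tutteTerm r m i j)
  ∑-leaf-nonneg i j = decidable-stable (0ℤ ℤ.≤? _)
    (representatives finitelyGenerated divisible (isMultiplicity B) >>= λ representatives-B →
    ¬¬-choice (λ t → ¬¬-base-sat t (torsion? (lookup σ t))) >>= λ base-sat →
    ¬¬-choice (λ f → ¬¬-choice λ k → ¬¬-excluded-middle {A = CharacterGroup.Annihilates representatives-B (drop f B) k}) >>= λ annihilates? →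
    ¬¬-choice (λ t → ¬¬-choice λ k → ¬¬-excluded-middle {A = ⟦ Representatives.rep representatives-B k ⟧ (el t) G.≈ G.ε}) >>= λ vanishes? →
    return (leaf-nonneg representatives-B base-sat annihilates? vanishes? i j))
    where
    torsion? : ∀ s → Dec (s ≡ torsion)
    torsion? undecided  = no λ ()
    torsion? contracted = no λ ()
    torsion? deleted    = no λ ()
    torsion? free       = no λ ()
    torsion? torsion    = yes ≡.refl
    ¬¬-base-sat : ∀ t → Dec (lookup σ t ≡ torsion) → ¬ ¬ (lookup σ t ≡ torsion → Sat (base σ) (el t))
    ¬¬-base-sat t (yes σₜ) = rank⇒¬¬sat isRank (torsion-loop t σₜ) >>= λ sat → return λ _ → sat
    ¬¬-base-sat t (no σₜ≢) = return λ σₜ → contradiction σₜ σₜ≢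

-- Non-negativity of every coefficient, collected from the leaves.

mainTheorem18 : ∀ {c ℓ g ℓg : Level} (Γ : AbelianGroup c ℓ) → FinitelyGenerated Γ →
    (𝒜 : List (AbelianGroup.Carrier Γ)) →
    (G : AbelianGroup g ℓg) → TorsionWiseFinite G → Divisible G →
    (r m : Subset (length 𝒜) → ℕ) →
    IsRankFunction Γ 𝒜 r → IsMultiplicityFunction Γ 𝒜 G m →
    ∀ i j → 0ℤ ≤ coefficient (tuttePolynomial r m) i j
mainTheorem18 Γ finitelyGenerated 𝒜 G _ divisible r m isRank isMultiplicity i j =
  subst (0ℤ ≤_) (≡.sym (coefficient-tuttePolynomial r m i j))
    (∑-nonneg (Ranks.isMatroidRank Γ 𝒜 isRank) (tutteTerm r m i j) λ σ decided minor →
      Leaves.∑-leaf-nonneg Γ finitelyGenerated 𝒜 G divisible isRank isMultiplicity decided minor i j)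
  where
  open Statuses
  open DeletionContraction
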